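{- Assume that $R_\nu$ is a principal ideal domain. Let $\Delta$ be a lattice in $K_\nu^n$. Then for any $\Delta$-rational subspaces $L$ and $M$ of $K_\nu^n$, $$d_{\Delta}(L)\,d_{\Delta}(M) \geq d_{\Delta}(L \cap M)\,d_{\Delta}(L + M),$$ or equivalently, $$\mathrm{Covol}(L \cap \Delta)\, \mathrm{Covol}(M \cap \Delta) \geq \mathrm{Covol}(L \cap M \cap \Delta)\, \mathrm{Covol}((L+M) \cap \Delta).$$
   Context: Setting: $K$ is the function field of a geometrically connected smooth projective curve $\mathbf{C}$ of genus $g$ over a finite field $\mathbb{F}_q$. Fix a discrete valuation $\nu$ on $K$ (normalized, i.e. there is $\pi_\nu\in K$ with $\nu(\pi_\nu)=1$); $K_\nu$ is the completion of $K$ at $\nu$, $\mathcal{O}_\nu$ its valuation ring, $k_\nu=\mathcal{O}_\nu/\pi_\nu\mathcal{O}_\nu$, $q_\nu$ the cardinality of $k_\nu$, and $|x|=q_\nu^{ -\nu(x)}$ for $x\in K_\nu$ (with $|0|=0$). $R_\nu$ is the affine algebra of the affine curve $\mathbf{C}-\{\nu\}$ (functions in $K$ regular away from $\nu$); it is a discrete subring of $K_\nu$. Let $n$ be a positive integer. Norm: let $\mathbf{e}_1,\dots,\mathbf{e}_n$ be the standard basis of $K_\nu^n$. For $I=\{\iota_1<\dots<\iota_i\}\subseteq\{1,\dots,n\}$ put $\mathbf{e}_I=\mathbf{e}_{\iota_1}\wedge\dots\wedge\mathbf{e}_{\iota_i}$. For $\mathbf{v}=\sum_{I}c_I\mathbf{e}_I\in\bigwedge^i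 K_\nu^n$ (sum over subsets $I$ with $i$ elements), $\|\mathbf{v}\|=\max_I|c_I|$. Lattices: let $V$ be a $K_\nu$-subspace of $K_\nu^n$ and $\Delta$ a discrete $R_\nu$-module contained in $V$. An $R_\nu$-basis of $\Delta$ is a basis of $\Delta$ over $R_\nu$ which is also linearly independent over $K_\nu$. The rank of $\Delta$ is $\dim_{K_\nu}\mathrm{span}_{K_\nu}(\Delta)$. $\Delta$ is a lattice in $V$ if it has an $R_\nu$-basis and its rank equals $\dim_{K_\nu}(V)$. Given a lattice $\Delta$ in $V$, a subspace $W$ of $V$ is $\Delta$-rational if $W\cap\Delta$ is a lattice in $W$; then $d_\Delta(W)=\|\mathbf{w}_1\wedge\dots\wedge\mathbf{w}_i\|$ for any $R_\nu$-basis $\{\mathbf{w}_1,\dots,\mathbf{w}_i\}$ of $W\cap\Delta$ (this is independent of the basis), and $d_\Delta(\{0\})=1$. The covolume of a lattice $\Lambda$ in a subspace $V\subseteq K_\nu^n$ is $\mathrm{Covol}(\Lambda)=q^{(g-1)\dim(V)}d_\Lambda(V)$. (When $R_\nu$ is a principal ideal domain, sums and intersections of $\Delta$-rational subspaces are $\Delta$-rational, so all quantities in the claim are defined.) -}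

module Defs where

open import Algebra.Bundles using (CommutativeRing; RawRing)
open import Algebra.Module.Bundles.Raw using (RawLeftModule)
open import Algebra.Morphism.Structures using (module RingMorphisms)
import Algebra.Definitions.RawMonoid as RawMonoidDefs
import Algebra.Definitions.RawSemiring as RawSemiringDefs
import Algebra.Module.Construct.TensorUnit as TensorUnit
open import Data.Fin.Base using (Fin; toℕ)
open import Data.Fin.Properties using (nonZeroIndex)
open import Data.Fin.Subset using (Subset; ∣_∣; inside; outside)
open import Data.Integer.Base as ℤ using (ℤ; +_; -[1+_]; 0ℤ; 1ℤ)
open import Data.List.Base as List using (List)
open import Data.Nat.Base as ℕ using (ℕ; zero; suc; NonZero)
import Data.Nat.Properties as ℕ
open import Data.Product.Base using (Σ; ∃; ∃₂; _×_; _,_; proj₁; proj₂)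
open import Data.Rational.Base as ℚ using (ℚ; 0ℚ)
open import Data.Sum.Base using (_⊎_)
open import Data.Vec.Base using ([]; _∷_)
open import Data.Vec.Functional as Vector using (Vector)
open import Function.Base using (_∘_)
open import Function.Bundles using (_⇔_; module Equivalence)
open import Level using (Level; _⊔_) renaming (suc to lsuc)
open import Relation.Binary.Construct.Add.Supremum.NonStrict ℤ._≤_ using (_≤⁺_; _≤⊤⁺)
open import Relation.Binary.Core using (Rel)
open import Relation.Binary.PropositionalEquality as ≡ using (_≡_)
open import Relation.Nullary.Construct.Add.Supremum using (_⁺; ⊤⁺; [_])
open import Relation.Nullary.Negation.Core using (¬_)
open import Relation.Unary using (Pred; U; _∈_; _⊆_; _∩_)

private
  variable
    a b c ℓ m r s t : Level

ℤ∞ : Set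
ℤ∞ = ℤ ⁺

infixl 6 _+∞_
_+∞_ : ℤ∞ → ℤ∞ → ℤ∞
[ k ] +∞ [ l ] = [ k ℤ.+ l ]
[ k ] +∞ ⊤⁺    = ⊤⁺
⊤⁺    +∞ _     = ⊤⁺

infixr 8 _^ᶻ_
_^ᶻ_ : (n : ℕ) .{{_ : NonZero n}} → ℤ → ℚ
n ^ᶻ (+ k)    = + (n ℕ.^ k) ℚ./ 1
n ^ᶻ -[1+ k ] = ℚ._/_ 1ℤ (n ℕ.^ suc k) {{ℕ.m^n≢0 n (suc k)}}

-- The quotient of the subset P by the equivalence relation _~_ has exactly
-- k elements: it has a complete irredundant system of k representatives.
record HasCardinality {A : Set a} (_~_ : Rel A ℓ) (P : Pred A s) (k : ℕ) : Set (a ⊔ ℓ ⊔ s) where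
  field
    rep      : Fin k → A
    rep∈     : ∀ i → rep i ∈ P
    complete : ∀ x → x ∈ P → ∃ λ i → x ~ rep i
    distinct : ∀ i j → rep i ~ rep j → i ≡ j

card-nonZero : ∀ {A : Set a} {_~_ : Rel A ℓ} {P : Pred A s} {k x} →
               x ∈ P → HasCardinality _~_ P k → NonZero k
card-nonZero x∈P card = nonZeroIndex (proj₁ (HasCardinality.complete card _ x∈P))

------------------------------------------------------------------------
-- Linear algebra with coefficients restricted to a subset S of the ring R
-- (for instance a subring).  Only the raw operations enter the definitions,
-- so that a quotient module can be given by coarsening _≈ᴹ_.

module LinearAlgebra (R : RawRing r ℓ) (M : RawLeftModule (RawRing.Carrier R) m t) where

  open RawRing R using (_≈_; 0#) renaming (Carrier to A)
  open RawLeftModule M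
  open RawMonoidDefs +ᴹ-rawMonoid using (sum)

  linComb : ∀ {k} → Vector A k → Vector Carrierᴹ k → Carrierᴹ
  linComb c w = sum (λ i → c i *ₗ w i)

  Independent : Pred A s → ∀ {k} → Vector Carrierᴹ k → Set _
  Independent S {k} w =
    (c : Vector A k) → (∀ i → c i ∈ S) → linComb c w ≈ᴹ 0ᴹ → ∀ i → c i ≈ 0#

  Span : Pred A s → Pred Carrierᴹ b → Pred Carrierᴹ _
  Span S P x = ∃ λ k → ∃₂ λ (c : Vector A k) (w : Vector Carrierᴹ k) →
    (∀ i → c i ∈ S) × (∀ i → w i ∈ P) × x ≈ᴹ linComb c w

  record IsBasis (S : Pred A s) (P : Pred Carrierᴹ b) {k} (w : Vector Carrierᴹ k)
                 : Set (r ⊔ ℓ ⊔ m ⊔ t ⊔ s ⊔ b) where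
    field
      members     : ∀ i → w i ∈ P
      generates   : ∀ x → x ∈ P → ∃ λ c → (∀ i → c i ∈ S) × x ≈ᴹ linComb c w
      independent : Independent S w

  HasDimension : Pred A s → Pred Carrierᴹ b → ℕ → Set _
  HasDimension S P k = Σ (Vector Carrierᴹ k) (IsBasis S P)

  hasDimension-resp : {S : Pred A s} {P : Pred Carrierᴹ a} {Q : Pred Carrierᴹ b} {k : ℕ} →
                      P ⊆ Q → Q ⊆ P → HasDimension S P k → HasDimension S Q k
  hasDimension-resp P⊆Q Q⊆P (w , isBasis) = w , record
    { members     = λ i → P⊆Q (members i)
    ; generates   = λ x x∈Q → generates x (Q⊆P x∈Q)
    ; independent = independent
    }
    where open IsBasis isBasis

  span-mono : {S : Pred A s} {P : Pred Carrierᴹ a} {Q : Pred Carrierᴹ b} →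
              P ⊆ Q → Span S P ⊆ Span S Q
  span-mono P⊆Q (k , c , w , c∈S , w∈P , eq) = k , c , w , c∈S , (λ i → P⊆Q (w∈P i)) , eq

  record IsSubmodule (S : Pred A s) (P : Pred Carrierᴹ b) : Set (r ⊔ m ⊔ t ⊔ s ⊔ b) where
    field
      respects : ∀ {x y} → x ≈ᴹ y → x ∈ P → y ∈ P
      0ᴹ∈      : 0ᴹ ∈ P
      +ᴹ∈      : ∀ {x y} → x ∈ P → y ∈ P → x +ᴹ y ∈ P
      *ₗ∈      : ∀ {a x} → a ∈ S → x ∈ P → a *ₗ x ∈ P

record IsField (R : CommutativeRing c ℓ) : Set (c ⊔ ℓ) where
  open CommutativeRing R
  field
    nontrivial : ¬ 1# ≈ 0#
    invertible : ∀ x → ¬ x ≈ 0# → ∃ λ y → x * y ≈ 1#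

-- The valuation is a total ℤ∞-valued function, as in classical mathematics, so
-- that vanishing is decidable.  val-+ says val (x + y) ≥ min (val x) (val y).
record DiscreteValuation (K : CommutativeRing c ℓ) : Set (c ⊔ ℓ) where
  open CommutativeRing K
  field
    val      : Carrier → ℤ∞
    val-cong : ∀ {x y} → x ≈ y → val x ≡ val y
    val-zero : ∀ x → val x ≡ ⊤⁺ ⇔ x ≈ 0#
    val-*    : ∀ x y → val (x * y) ≡ val x +∞ val y
    val-+    : ∀ x y → val x ≤⁺ val (x + y) ⊎ val y ≤⁺ val (x + y)
    π        : Carrier
    val-π    : val π ≡ [ 1ℤ ]

-- Two normalized valuations are the same when they agree as functions
-- (the choice of uniformizer is irrelevant).
_≈ᵛ_ : {K : CommutativeRing c ℓ} → Rel (DiscreteValuation K) c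
v ≈ᵛ w = ∀ x → val v x ≡ val w x
  where open DiscreteValuation

module ValuationRing {K : CommutativeRing c ℓ} (v : DiscreteValuation K) where

  open CommutativeRing K
  open DiscreteValuation v

  𝒪 : Pred Carrier _
  𝒪 x = [ 0ℤ ] ≤⁺ val x

  0∈𝒪 : 0# ∈ 𝒪
  0∈𝒪 = ≡.subst ([ 0ℤ ] ≤⁺_) (≡.sym (Equivalence.from (val-zero 0#) refl)) (_ ≤⊤⁺)

  _∼_ : Rel Carrier (c ⊔ ℓ)
  x ∼ y = ∃ λ z → z ∈ 𝒪 × x - y ≈ π * z

  ResidueCardinality : ℕ → Set _
  ResidueCardinality = HasCardinality _∼_ 𝒪

  -- The residue field is the subset 𝒪 of this (raw) module, taken up to _∼_.
  residueModule : RawLeftModule Carrier c (c ⊔ ℓ)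
  residueModule = record
    { _≈ᴹ_ = _∼_ ; _+ᴹ_ = _+_ ; _*ₗ_ = _*_ ; 0ᴹ = 0# ; -ᴹ_ = -_ }

-- Any completion of (K , v): a complete valued field in which K is dense.
record Completion {K : CommutativeRing c ℓ} (v : DiscreteValuation K) : Set (lsuc (c ⊔ ℓ)) where
  private module K = CommutativeRing K
  field
    K̂           : CommutativeRing c ℓ
    K̂-isField   : IsField K̂
    v̂           : DiscreteValuation K̂
    embed       : K.Carrier → CommutativeRing.Carrier K̂
    embed-isHom : RingMorphisms.IsRingHomomorphism K.rawRing (CommutativeRing.rawRing K̂) embed
  open CommutativeRing K̂
  open DiscreteValuation v̂ using () renaming (val to val̂)
  field
    extends  : ∀ x → val̂ (embed x) ≡ DiscreteValuation.val v x
    dense    : ∀ x (k : ℤ) → ∃ λ a → [ k ] ≤⁺ val̂ (x - embed a)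
    complete : (f : ℕ → Carrier) →
      (∀ (k : ℤ) → ∃ λ N → ∀ i j → N ℕ.≤ i → N ℕ.≤ j → [ k ] ≤⁺ val̂ (f i - f j)) →
      ∃ λ x → ∀ (k : ℤ) → ∃ λ N → ∀ i → N ℕ.≤ i → [ k ] ≤⁺ val̂ (f i - x)

------------------------------------------------------------------------
-- Function fields.  A smooth projective curve over F is determined by its
-- function field, its closed points being the discrete valuations of K
-- (which are automatically trivial on the finite field F).  As F is perfect,
-- the curve is geometrically connected iff F is algebraically closed in K.

record FunctionField ℓ : Set (lsuc ℓ) where
  field
    F K        : CommutativeRing ℓ ℓ
    F-isField  : IsField F
    K-isField  : IsField K
    q          : ℕ
    F-card     : HasCardinality (CommutativeRing._≈_ F) U q
  private module F = CommutativeRing F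
  open CommutativeRing K
  open RawSemiringDefs (RawRing.rawSemiring rawRing) using (_^_)
  field
    ι          : F.Carrier → Carrier
    ι-isHom    : RingMorphisms.IsRingHomomorphism F.rawRing rawRing ι

  Const : Pred Carrier ℓ
  Const x = ∃ λ a → ι a ≈ x

  K-module : RawLeftModule Carrier ℓ ℓ
  K-module = TensorUnit.rawLeftModule {R = rawRing}

  open LinearAlgebra rawRing K-module

  powers : Carrier → ∀ k → Vector Carrier k
  powers x k i = x ^ toℕ i

  Transcendental : Pred Carrier _
  Transcendental x = ∀ k → Independent Const (powers x k)

  Algebraic : Pred Carrier _
  Algebraic x = ∃₂ λ k (c : Vector Carrier k) →
    (∀ i → c i ∈ Const) × (∃ λ i → ¬ c i ≈ 0#) × linComb c (powers x k) ≈ 0#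

  F[_] : Carrier → Pred Carrier ℓ
  F[ x ] y = ∃₂ λ k (c : Vector Carrier k) → (∀ i → c i ∈ Const) × y ≈ linComb c (powers x k)

  F⟨_⟩ : Carrier → Pred Carrier ℓ
  F⟨ x ⟩ y = ∃₂ λ f h → f ∈ F[ x ] × h ∈ F[ x ] × ¬ h ≈ 0# × y * h ≈ f

  field
    oneVariable : ∃ λ x → Transcendental x × ∃ λ d → HasDimension F⟨ x ⟩ U d
    constants   : ∀ x → Algebraic x → x ∈ Const

  q-nonZero : NonZero q
  q-nonZero = card-nonZero {x = F.0#} _ F-card

  Place : Set ℓ
  Place = DiscreteValuation K

  open DiscreteValuation using (val)

  RegularAwayFrom : Place → Pred Carrier ℓ
  RegularAwayFrom v x = ∀ (w : Place) → ¬ w ≈ᵛ v → x ∈ ValuationRing.𝒪 w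

  HasDegree : Place → ℕ → Set ℓ
  HasDegree p = LinearAlgebra.HasDimension rawRing (ValuationRing.residueModule p)
                  Const (ValuationRing.𝒪 p)

  record Divisor : Set ℓ where
    field
      size     : ℕ
      place    : Fin size → Place
      coeff    : Fin size → ℤ
      distinct : ∀ i j → place i ≈ᵛ place j → i ≡ j

  module _ (D : Divisor) where
    open Divisor D

    RiemannRochSpace : Pred Carrier ℓ
    RiemannRochSpace f =
      (∀ i → [ ℤ.- coeff i ] ≤⁺ val (place i) f) ×
      (∀ (w : Place) → (∀ i → ¬ w ≈ᵛ place i) → f ∈ ValuationRing.𝒪 w)

    DivisorDegree : ℤ → Set ℓ
    DivisorDegree e = ∃ λ (d : Fin size → ℕ) → (∀ i → HasDegree (place i) (d i)) ×
      e ≡ Vector.foldr ℤ._+_ 0ℤ (λ i → coeff i ℤ.* + d i)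

  -- Riemann: the genus is the maximum of deg D − ℓ(D) + 1 over all divisors D.
  -- DefectIs D e says that this quantity equals e.
  DefectIs : Divisor → ℤ → Set ℓ
  DefectIs D e = ∃₂ λ d l → DivisorDegree D d × HasDimension Const (RiemannRochSpace D) l ×
    e ≡ d ℤ.- + l ℤ.+ 1ℤ

  record IsGenus (g : ℕ) : Set ℓ where
    field
      upperBound : ∀ D e → DefectIs D e → e ℤ.≤ + g
      attained   : ∃ λ D → DefectIs D (+ g)

------------------------------------------------------------------------
-- Exterior algebra of Kⁿ in the standard basis: ω : Exterior n stands for
-- the sum of the ω I e_I over all subsets I of {1,…,n}.

module ExteriorAlgebra (K : CommutativeRing c ℓ) where

  open CommutativeRing K

  Exterior : ℕ → Set c
  Exterior n = Subset n → Carrier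

  one : ∀ {n} → Exterior n
  one []            = 1#
  one (outside ∷ I) = one I
  one (inside  ∷ _) = 0#

  -- Write v = v₁ e₁ + v′ and ω = ω₀ + e₁ ∧ ω₁ with v′, ω₀, ω₁ not involving e₁;
  -- then v ∧ ω = v′ ∧ ω₀ + e₁ ∧ (v₁ ω₀ − v′ ∧ ω₁).
  infixr 7 _∧_
  _∧_ : ∀ {n} → Vector Carrier n → Exterior n → Exterior n
  (v ∧ ω) []            = 0#
  (v ∧ ω) (outside ∷ I) = (Vector.tail v ∧ (ω ∘ (outside ∷_))) I
  (v ∧ ω) (inside  ∷ I) =
    Vector.head v * ω (outside ∷ I) - (Vector.tail v ∧ (ω ∘ (inside ∷_))) I

  ⋀ : ∀ {n k} → Vector (Vector Carrier n) k → Exterior n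
  ⋀ = Vector.foldr _∧_ one

subsets : ∀ n → List (Subset n)
subsets zero    = List.[ [] ]
subsets (suc n) = List.map (outside ∷_) (subsets n) List.++ List.map (inside ∷_) (subsets n)

------------------------------------------------------------------------
-- The completion Kν is written K̂, and the image in it of Rν is written R̂ν.

record Setting ℓ : Set (lsuc ℓ) where
  field
    functionField : FunctionField ℓ
  open FunctionField functionField public
  field
    g          : ℕ
    g-isGenus  : IsGenus g
    ν          : Place
    completion : Completion ν
  open Completion completion public using (K̂; v̂; embed)
  open ValuationRing v̂ using (ResidueCardinality; 0∈𝒪)
  field
    qν         : ℕ
    qν-card    : ResidueCardinality qν

  qν-nonZero : NonZero qν
  qν-nonZero = card-nonZero 0∈𝒪 qν-card

  private module K = CommutativeRing K
  open CommutativeRing K̂ using (Carrier; _≈_; _+_; _*_; _-_; -_; 0#; rawRing)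
  open DiscreteValuation v̂ using () renaming (val to val̂)
  open ExteriorAlgebra K̂ using (Exterior; ⋀)

  Rν : Pred K.Carrier ℓ
  Rν = RegularAwayFrom ν

  -- The ideals of Rν are its Rν-submodules; being a subring of a field, Rν is
  -- automatically an integral domain.
  RνIsPID : Set (lsuc ℓ)
  RνIsPID = (I : Pred K.Carrier ℓ) → I ⊆ Rν →
    LinearAlgebra.IsSubmodule K.rawRing K-module Rν I →
    ∃ λ d → d ∈ I × (∀ x → x ∈ I → ∃ λ r → r ∈ Rν × x K.≈ r K.* d)

  absVal : ℤ∞ → ℚ
  absVal [ k ] = _^ᶻ_ qν {{qν-nonZero}} (ℤ.- k)
  absVal ⊤⁺    = 0ℚ

  abs : Carrier → ℚ
  abs x = absVal (val̂ x)

  norm : ∀ {n} → ℕ → Exterior n → ℚ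
  norm {n} i ω = List.foldr ℚ._⊔_ 0ℚ
    (List.map (abs ∘ ω) (List.filter (λ I → ∣ I ∣ ℕ.≟ i) (subsets n)))

  K̂^_ : ℕ → RawLeftModule Carrier ℓ ℓ
  K̂^ n = record
    { Carrierᴹ = Vector Carrier n
    ; _≈ᴹ_     = λ x y → ∀ i → x i ≈ y i
    ; _+ᴹ_     = λ x y i → x i + y i
    ; _*ₗ_     = λ a x i → a * x i
    ; 0ᴹ       = λ _ → 0#
    ; -ᴹ_      = λ x i → - x i
    }

  R̂ν : Pred Carrier ℓ
  R̂ν x = ∃ λ a → a ∈ Rν × embed a ≈ x

  module Lattices (n : ℕ) where

    open LinearAlgebra rawRing (K̂^ n) public
    open RawLeftModule (K̂^ n)

    Kⁿ : Set ℓ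
    Kⁿ = Vector Carrier n

    IsSubspace : Pred Kⁿ b → Set _
    IsSubspace = IsSubmodule U

    infixl 6 _+ₛ_
    _+ₛ_ : Pred Kⁿ a → Pred Kⁿ b → Pred Kⁿ _
    (L +ₛ M) x = ∃₂ λ u v → u ∈ L × v ∈ M × x ≈ᴹ u +ᴹ v

    IsDiscrete : Pred Kⁿ b → Set _
    IsDiscrete Δ = ∀ x → x ∈ Δ → ∃ λ (k : ℤ) →
      ∀ y → y ∈ Δ → (∀ i → [ k ] ≤⁺ val̂ (y i - x i)) → y ≈ᴹ x

    record IsLattice (V : Pred Kⁿ a) (Δ : Pred Kⁿ b) : Set (ℓ ⊔ a ⊔ b) where
      field
        V-subspace : IsSubspace V
        submodule  : IsSubmodule R̂ν Δ
        discrete   : IsDiscrete Δ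
        contained  : Δ ⊆ V
        size       : ℕ
        basis      : Vector Kⁿ size
        isBasis    : IsBasis R̂ν Δ basis
        K̂-indep    : Independent U basis
        dim        : ℕ
        rank-dim   : HasDimension U (Span U Δ) dim
        V-dim      : HasDimension U V dim

    Rational : Pred Kⁿ b → Pred Kⁿ a → Set _
    Rational Δ W = IsLattice W (W ∩ Δ)

    -- d_Δ(W), computed with the basis of W ∩ Δ contained in the witness.
    d : (Δ : Pred Kⁿ b) (W : Pred Kⁿ a) → Rational Δ W → ℚ
    d Δ W rat = norm size (⋀ basis)
      where open IsLattice rat

    self-rational : {V : Pred Kⁿ a} {Λ : Pred Kⁿ b} → IsLattice V Λ → Rational Λ V
    self-rational {V = V} {Λ = Λ} lat = record
      { V-subspace = V-subspace
      ; submodule  = record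
        { respects = λ e (v , l) → V.respects e v , Λ.respects e l
        ; 0ᴹ∈      = V.0ᴹ∈ , Λ.0ᴹ∈
        ; +ᴹ∈      = λ (v , l) (v′ , l′) → V.+ᴹ∈ v v′ , Λ.+ᴹ∈ l l′
        ; *ₗ∈      = λ r (v , l) → V.*ₗ∈ _ v , Λ.*ₗ∈ r l
        }
      ; discrete   = λ x (_ , l) → let (k , sep) = discrete x l in
                       k , λ y (_ , l′) → sep y l′
      ; contained  = proj₁
      ; size       = size
      ; basis      = basis
      ; isBasis    = record
        { members     = λ i → contained (B.members i) , B.members i
        ; generates   = λ x (_ , l) → B.generates x l
        ; independent = B.independent
        }
      ; K̂-indep    = K̂-indep
      ; dim        = dim
      ; rank-dim   = hasDimension-resp {P = Span U Λ} {Q = Span U (V ∩ Λ)}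
                       (span-mono {P = Λ} {Q = V ∩ Λ} (λ l → contained l , l))
                       (span-mono {P = V ∩ Λ} {Q = Λ} proj₂) rank-dim
      ; V-dim      = V-dim
      }
      where
      open IsLattice lat
      module V = IsSubmodule V-subspace
      module Λ = IsSubmodule submodule
      module B = IsBasis isBasis

    Covol : (V : Pred Kⁿ a) (Λ : Pred Kⁿ b) → IsLattice V Λ → ℚ
    Covol V Λ lat =
      _^ᶻ_ q {{q-nonZero}} ((+ g ℤ.- 1ℤ) ℤ.* + IsLattice.dim lat) ℚ.* d Λ V (self-rational lat)

{-# OPTIONS --safe #-}

-- If k independent vectors x lie in the Rν-span of k vectors y then ⋀ x = δ ⋀ y
-- with 0 ≠ δ ∈ Rν, and |δ| ≥ 1 as Δ is discrete; hence ‖⋀ y‖ ≤ ‖⋀ x‖.  Since Rν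
-- is a principal ideal domain, a basis e of L ∩ M ∩ Δ extends to bases e, f of
-- L ∩ Δ and e, g of M ∩ Δ; then e, f, g are independent vectors of (L + M) ∩ Δ,
-- so it suffices to show
--   ‖e‖ ‖e ∧ f ∧ g‖ ≤ ‖e ∧ f‖ ‖e ∧ g‖.
-- Ultrametric Gram–Schmidt splits off the vectors of e one at a time, each
-- contributing the same factor to the four norms, and reduces this to
-- ‖f ∧ g‖ ≤ ‖f‖ ‖g‖, which follows in the same way.
-- A form ⋀ w vanishes iff w is dependent; this replaces determinants and
-- dimension counts throughout.

module Submission where

open import Algebra.Bundles using (CommutativeMonoid; CommutativeRing; RawRing)
import Algebra.Properties.CommutativeSemigroup as CommutativeSemigroupProperties
import Algebra.Properties.Ring as RingProperties
import Algebra.Properties.Semiring.Exp as Exp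
import Algebra.Properties.Semiring.Mult.TCOptimised as Mult
import Algebra.Solver.Ring as RingSolver
open import Algebra.Morphism.Structures using (module RingMorphisms)
open import Algebra.Solver.Ring.AlmostCommutativeRing
  using (fromCommutativeRing; _-Raw-AlmostCommutative⟶_)
open import Data.Empty using (⊥; ⊥-elim)
open import Data.Fin.Base as Fin using (Fin; zero; suc)
import Data.Fin.Properties as Fin
open import Data.Fin.Subset.Properties using (∣p∣≤n)
open import Data.Fin.Subset using (Subset; ∣_∣; inside; outside) renaming (⊤ to full)
open import Data.Integer.Base as ℤ using (ℤ; +_; -[1+_]; 0ℤ; 1ℤ)
import Data.Integer.Properties as ℤ
open import Data.List.Base as List using (List; []; _∷_; _++_; length)
import Data.List.Properties as List
import Data.List.Relation.Binary.Pointwise as Pointwise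
open import Data.List.Relation.Binary.Pointwise using (Pointwise; []; _∷_)
open import Data.List.Membership.Propositional using () renaming (_∈_ to _∈ₗ_)
open import Data.List.Membership.Propositional.Properties using (∈-++⁺ˡ; ∈-++⁺ʳ; ∈-map⁺; ∈-filter⁺; ∈-lookup)
open import Data.List.Relation.Unary.Any using (here; there)
open import Data.List.Relation.Unary.All as All using (All; []; _∷_)
import Data.List.Relation.Unary.All.Properties as All
open import Data.Maybe.Base using (Maybe; just; nothing)
open import Data.Nat.Base as ℕ using (ℕ; zero; suc; NonZero)
import Data.Nat.Properties as ℕ
open import Data.Product.Base using (∃; ∃₂; _×_; _,_; proj₁; proj₂)
open import Data.Rational.Base as ℚ using (ℚ; 0ℚ; 1ℚ)
import Data.Rational.Properties as ℚ
import Data.Rational.Unnormalised.Base as ℚᵘ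
import Data.Rational.Unnormalised.Properties as ℚᵘ
import Data.Sign.Base as Sign
open import Data.Sum.Base as Sum using (_⊎_; inj₁; inj₂)
open import Data.Unit.Base using (⊤; tt)
import Data.Vec.Base as Vec
import Data.Vec.Properties as Vec
open import Data.Vec.Functional as Vector using (Vector)
open import Defs
open import Function.Base using (_∘_)
open import Function.Bundles using (Equivalence)
open import Level using (Level; _⊔_; 0ℓ)
open import Relation.Binary.Construct.Add.Supremum.NonStrict ℤ._≤_ as ≤⁺
  using (_≤⁺_; _≤⊤⁺) renaming ([_] to [_]≤)
import Relation.Binary.Reasoning.Setoid as SetoidReasoning
open import Relation.Binary.PropositionalEquality as ≡ using (_≡_)
open import Relation.Nullary.Construct.Add.Supremum using (⊤⁺; [_])
open import Relation.Nullary.Decidable.Core using (Dec; yes; no)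
open import Relation.Nullary.Negation.Core using (¬_)
open import Relation.Unary using (Pred; U; _∈_; _⊆_; _∩_)

-- Independence is the delicate point. The argument that `e`, `f`, `g` satisfy no relation takes
-- place inside Δ, so its coefficients must lie in Rν: a combination over the completion leaves Δ.
-- Yet norms, ranks and the rationality of L ∩ M require independence over the completion, which is
-- in general much stronger. The gap closes because vectors of Δ have coordinates in Rν with respect
-- to a basis of Δ, and elimination by `v p * w - w p * v` instead of division keeps them there. A
-- family of such vectors independent over Rν thus has a nonzero form, and a nonzero form gives
-- independence over the whole field. Inequality rather than equality has two sources: the norm of a
-- wedge is only bounded by a product, and (L ∩ Δ) + (M ∩ Δ) may be a proper submodule of (L + M) ∩
-- Δ. Extending a basis requires deciding whether a subspace contains a nonzero lattice vector. Such
-- decisions come from the hypothesis on Rν itself: as it speaks of arbitrary ideals, it implies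
-- excluded middle for the propositions that occur.

private
  variable
    c ℓ : Level

-- Integer coefficients for identities in a commutative ring.

module IntegerCoefficients (R : CommutativeRing c ℓ) where

  open CommutativeRing R
  open RingProperties ring
  open Mult semiring using (×-homo-+; ×1-homo-*; 1+×) renaming (_×_ to _·_)
  open SetoidReasoning setoid

  -- These multiples satisfy `1 · x = x` by computation, so `con 1ℤ` stands for `1#` itself in the
  -- identities to be solved.
  ⟦_⟧ᶻ : ℤ → Carrier
  ⟦ + n ⟧ᶻ      = n · 1#
  ⟦ -[1+ n ] ⟧ᶻ = - (suc n · 1#)

  ⊖-homo : ∀ m n → ⟦ m ℤ.⊖ n ⟧ᶻ ≈ m · 1# - n · 1#
  ⊖-homo m       zero    = sym (trans (+-congˡ -0#≈0#) (+-identityʳ _))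
  ⊖-homo zero    (suc n) = sym (+-identityˡ _)
  ⊖-homo (suc m) (suc n) = begin
    ⟦ suc m ℤ.⊖ suc n ⟧ᶻ                   ≡⟨ ≡.cong ⟦_⟧ᶻ (ℤ.[1+m]⊖[1+n]≡m⊖n m n) ⟩
    ⟦ m ℤ.⊖ n ⟧ᶻ                           ≈⟨ ⊖-homo m n ⟩
    m · 1# - n · 1#                        ≈⟨ +-congˡ (trans (sym (+-identityˡ _)) (+-congʳ (sym (-‿inverseʳ 1#)))) ⟩
    m · 1# + (1# - 1# - n · 1#)            ≈⟨ +-congˡ (trans (+-assoc _ _ _) (+-congˡ (-‿+-comm 1# (n · 1#)))) ⟩
    m · 1# + (1# - (1# + n · 1#))          ≈⟨ +-assoc _ _ _ ⟨
    (m · 1# + 1#) - (1# + n · 1#)          ≈⟨ +-cong (trans (+-comm _ _) (sym (1+× m 1#))) (-‿cong (sym (1+× n 1#))) ⟩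
    suc m · 1# - suc n · 1#                ∎

  +-homoᶻ : ∀ i j → ⟦ i ℤ.+ j ⟧ᶻ ≈ ⟦ i ⟧ᶻ + ⟦ j ⟧ᶻ
  +-homoᶻ (+ m)    (+ n)    = ×-homo-+ 1# m n
  +-homoᶻ (+ m)    -[1+ n ] = ⊖-homo m (suc n)
  +-homoᶻ -[1+ m ] (+ n)    = trans (⊖-homo n (suc m)) (+-comm _ _)
  +-homoᶻ -[1+ m ] -[1+ n ] = begin
    - (suc (suc (m ℕ.+ n)) · 1#)           ≡⟨ ≡.cong (λ k → - (k · 1#)) (≡.cong suc (ℕ.+-suc m n)) ⟨
    - ((suc m ℕ.+ suc n) · 1#)             ≈⟨ -‿cong (×-homo-+ 1# (suc m) (suc n)) ⟩
    - (suc m · 1# + suc n · 1#)            ≈⟨ -‿+-comm _ _ ⟨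
    - (suc m · 1#) - suc n · 1#            ∎

  -◃-homo : ∀ n → ⟦ Sign.- ℤ.◃ n ⟧ᶻ ≈ - (n · 1#)
  -◃-homo zero    = sym -0#≈0#
  -◃-homo (suc n) = refl

  +◃-homo : ∀ n → ⟦ Sign.+ ℤ.◃ n ⟧ᶻ ≈ n · 1#
  +◃-homo zero    = refl
  +◃-homo (suc n) = refl

  *-homoᶻ : ∀ i j → ⟦ i ℤ.* j ⟧ᶻ ≈ ⟦ i ⟧ᶻ * ⟦ j ⟧ᶻ
  *-homoᶻ (+ m)    (+ n)    = trans (+◃-homo (m ℕ.* n)) (×1-homo-* m n)
  *-homoᶻ (+ m)    -[1+ n ] = trans (-◃-homo (m ℕ.* suc n))
    (trans (-‿cong (×1-homo-* m (suc n))) (-‿distribʳ-* _ _))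
  *-homoᶻ -[1+ m ] (+ n)    = trans (-◃-homo (suc m ℕ.* n))
    (trans (-‿cong (×1-homo-* (suc m) n)) (-‿distribˡ-* _ _))
  *-homoᶻ -[1+ m ] -[1+ n ] = begin
    ⟦ Sign.+ ℤ.◃ (suc m ℕ.* suc n) ⟧ᶻ      ≈⟨ +◃-homo (suc m ℕ.* suc n) ⟩
    (suc m ℕ.* suc n) · 1#                 ≈⟨ ×1-homo-* (suc m) (suc n) ⟩
    suc m · 1# * suc n · 1#                ≈⟨ -‿involutive _ ⟨
    - - (suc m · 1# * suc n · 1#)          ≈⟨ -‿cong (-‿distribˡ-* _ _) ⟩
    - (- (suc m · 1#) * suc n · 1#)        ≈⟨ -‿distribʳ-* _ _ ⟩
    - (suc m · 1#) * - (suc n · 1#)        ∎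

  -‿homoᶻ : ∀ i → ⟦ ℤ.- i ⟧ᶻ ≈ - ⟦ i ⟧ᶻ
  -‿homoᶻ (+ zero)  = sym -0#≈0#
  -‿homoᶻ (+ suc n) = refl
  -‿homoᶻ -[1+ n ]  = sym (-‿involutive _)

  ℤ-rawRing : RawRing _ _
  ℤ-rawRing = record
    { _≈_ = _≡_ ; _+_ = ℤ._+_ ; _*_ = ℤ._*_ ; -_ = ℤ.-_ ; 0# = 0ℤ ; 1# = 1ℤ }

  morphism : ℤ-rawRing -Raw-AlmostCommutative⟶ fromCommutativeRing R
  morphism = record
    { ⟦_⟧    = ⟦_⟧ᶻ
    ; +-homo = +-homoᶻ
    ; *-homo = *-homoᶻ
    ; -‿homo = -‿homoᶻ
    ; 0-homo = refl
    ; 1-homo = refl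
    }

  -- Only a positive answer carries information: distinct integers may have equal images, the fields
  -- of interest having positive characteristic.
  ℤ-equal? : ∀ i j → Maybe (⟦ i ⟧ᶻ ≈ ⟦ j ⟧ᶻ)
  ℤ-equal? i j with i ℤ.≟ j
  ... | yes i≡j = just (reflexive (≡.cong ⟦_⟧ᶻ i≡j))
  ... | no _    = nothing

  open RingSolver ℤ-rawRing (fromCommutativeRing R) morphism ℤ-equal? public
    using (solve; con; _:+_; _:*_; _:-_; :-_; _:=_)

-- The wedge of a vector with a form: linearity and alternation.

module ExteriorProperties (K : CommutativeRing c ℓ) where

  open CommutativeRing K hiding (zero)
  open ExteriorAlgebra K
  open IntegerCoefficients K
  open RingProperties ring using (-0#≈0#)
  open SetoidReasoning setoid

  infix 4 _≐_
  _≐_ : ∀ {a} {A : Set a} → (A → Carrier) → (A → Carrier) → Set _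
  f ≐ g = ∀ i → f i ≈ g i

  Zero : ∀ {n} → Exterior n → Set _
  Zero ω = ∀ I → ω I ≈ 0#

  ∧-cong : ∀ {n} {x y : Vector Carrier n} {ω η : Exterior n} →
           x ≐ y → ω ≐ η → (x ∧ ω) ≐ (y ∧ η)
  ∧-cong x≐y ω≐η Vec.[]              = refl
  ∧-cong x≐y ω≐η (outside Vec.∷ I) = ∧-cong (x≐y ∘ suc) (λ J → ω≐η (outside Vec.∷ J)) I
  ∧-cong x≐y ω≐η (inside Vec.∷ I)  = +-cong (*-cong (x≐y zero) (ω≐η (outside Vec.∷ I)))
    (-‿cong (∧-cong (x≐y ∘ suc) (λ J → ω≐η (inside Vec.∷ J)) I))

  -- Phrased for any `z` with the right coordinates, since vectors are only compared coordinatewise.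
  -- Scaling, shifting by a multiple and, with both coefficients 0, vanishing are all instances.
  ∧-linˡ : ∀ {n} a b {x y z : Vector Carrier n} (ω : Exterior n) →
           (∀ i → z i ≈ a * x i + b * y i) → ∀ I → (z ∧ ω) I ≈ a * (x ∧ ω) I + b * (y ∧ ω) I
  ∧-linˡ a b ω z≈ Vec.[] =
    solve 2 (λ a b → con 0ℤ := a :* con 0ℤ :+ b :* con 0ℤ) refl a b
  ∧-linˡ a b ω z≈ (outside Vec.∷ I) = ∧-linˡ a b _ (z≈ ∘ suc) I
  ∧-linˡ a b {x} {y} {z} ω z≈ (inside Vec.∷ I) =
    trans (+-cong (*-congʳ (z≈ zero)) (-‿cong (∧-linˡ a b _ (z≈ ∘ suc) I)))
      (solve 7 (λ a b x y w p q → (a :* x :+ b :* y) :* w :- (a :* p :+ b :* q) :=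
        a :* (x :* w :- p) :+ b :* (y :* w :- q)) refl a b (x zero) (y zero) (ω (outside Vec.∷ I)) _ _)

  ∧-linʳ : ∀ {n} a b (x : Vector Carrier n) {ω η ζ : Exterior n} →
           (∀ I → ζ I ≈ a * ω I + b * η I) → ∀ I → (x ∧ ζ) I ≈ a * (x ∧ ω) I + b * (x ∧ η) I
  ∧-linʳ a b x ζ≈ Vec.[] =
    solve 2 (λ a b → con 0ℤ := a :* con 0ℤ :+ b :* con 0ℤ) refl a b
  ∧-linʳ a b x ζ≈ (outside Vec.∷ I) = ∧-linʳ a b _ (λ J → ζ≈ (outside Vec.∷ J)) I
  ∧-linʳ a b x {ω} {η} ζ≈ (inside Vec.∷ I) =
    trans (+-cong (*-congˡ (ζ≈ (outside Vec.∷ I))) (-‿cong (∧-linʳ a b _ (λ J → ζ≈ (inside Vec.∷ J)) I)))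
      (solve 7 (λ a b x w h p q → x :* (a :* w :+ b :* h) :- (a :* p :+ b :* q) :=
        a :* (x :* w :- p) :+ b :* (x :* h :- q)) refl a b (x zero) (ω (outside Vec.∷ I)) (η (outside Vec.∷ I)) _ _)

  private
    inside-∧ : ∀ {n} (x : Vector Carrier (suc n)) (y : Vector Carrier n) (ω : Exterior (suc n)) I →
      (y ∧ ((x ∧ ω) ∘ (inside Vec.∷_))) I ≈
      Vector.head x * (y ∧ (ω ∘ (outside Vec.∷_))) I + - 1# * (y ∧ (Vector.tail x ∧ (ω ∘ (inside Vec.∷_)))) I
    inside-∧ x y ω I = ∧-linʳ (x zero) (- 1#) y
      (λ J → solve 2 (λ s t → s :- t := s :+ (:- con 1ℤ) :* t) refl _ _) I

  -- Not a consequence of `∧-anti`, which yields only twice this form and so says nothing in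
  -- characteristic 2. In the component along the first basis vector the two terms from the
  -- `outside` part of `ω` cancel, and induction disposes of the other.
  ∧-alt : ∀ {n} (x : Vector Carrier n) (ω : Exterior n) → Zero (x ∧ (x ∧ ω))
  ∧-alt x ω Vec.[] = refl
  ∧-alt x ω (outside Vec.∷ I) = ∧-alt _ _ I
  ∧-alt x ω (inside Vec.∷ I) = trans
    (+-congˡ (-‿cong (trans (inside-∧ x (Vector.tail x) ω I) (+-congˡ (*-congˡ (∧-alt _ _ I))))))
    (solve 1 (λ s → s :- (s :+ (:- con 1ℤ) :* con 0ℤ) := con 0ℤ) refl _)

  ∧-anti : ∀ {n} (x y : Vector Carrier n) (ω : Exterior n) I → (x ∧ (y ∧ ω)) I ≈ - (y ∧ (x ∧ ω)) I
  ∧-anti x y ω Vec.[] = sym -0#≈0#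
  ∧-anti x y ω (outside Vec.∷ I) = ∧-anti _ _ _ I
  ∧-anti x y ω (inside Vec.∷ I) = begin
    x zero * p - (Vector.tail x ∧ ((y ∧ ω) ∘ (inside Vec.∷_))) I
      ≈⟨ +-congˡ (-‿cong (trans (inside-∧ y (Vector.tail x) ω I) (+-congˡ (*-congˡ (∧-anti _ _ _ I))))) ⟩
    x zero * p - (y zero * q + - 1# * - r)
      ≈⟨ solve 5 (λ x y p q r → x :* p :- (y :* q :+ (:- con 1ℤ) :* (:- r)) :=
           :- (y :* q :- (x :* p :+ (:- con 1ℤ) :* r))) refl (x zero) (y zero) p q r ⟩
    - (y zero * q - (x zero * p + - 1# * r))
      ≈⟨ -‿cong (+-congˡ (-‿cong (inside-∧ x (Vector.tail y) ω I))) ⟨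
    - (y zero * q - (Vector.tail y ∧ ((x ∧ ω) ∘ (inside Vec.∷_))) I) ∎
    where
    p = (Vector.tail y ∧ (ω ∘ (outside Vec.∷_))) I
    q = (Vector.tail x ∧ (ω ∘ (outside Vec.∷_))) I
    r = (Vector.tail y ∧ (Vector.tail x ∧ (ω ∘ (inside Vec.∷_)))) I

-- Finite families of vectors, their combinations and their forms.

module Families (K : CommutativeRing c ℓ) where

  open CommutativeRing K hiding (zero)
  open ExteriorAlgebra K
  open ExteriorProperties K
  open IntegerCoefficients K
  open RingProperties ring using (-0#≈0#; -‿involutive)
  open Exp semiring public using (_^_)
  open SetoidReasoning setoid

  record IsSubring {s} (S : Pred Carrier s) : Set (c ⊔ ℓ ⊔ s) where
    field
      respects : ∀ {x y} → x ≈ y → x ∈ S → y ∈ S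
      0∈       : 0# ∈ S
      1∈       : 1# ∈ S
      +∈       : ∀ {x y} → x ∈ S → y ∈ S → x + y ∈ S
      *∈       : ∀ {x y} → x ∈ S → y ∈ S → x * y ∈ S
      -∈       : ∀ {x} → x ∈ S → - x ∈ S

  U-subring : IsSubring {0ℓ} U
  U-subring = _

  V : ℕ → Set c
  V = Vector Carrier

  -- Families of vectors are lists rather than functions on Fin k, so that bases
  -- can be extended by _++_.
  data Comb {s} (S : Pred Carrier s) {n} : List (V n) → V n → Set (c ⊔ ℓ ⊔ s) where
    nil  : ∀ {x} → (∀ i → x i ≈ 0#) → Comb S [] x
    cons : ∀ {w ws x} a y → a ∈ S → Comb S ws y → (∀ i → x i ≈ a * w i + y i) → Comb S (w ∷ ws) x

  -- A triangular form of independence: a relation on `w ∷ ws` is only asked to have leading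
  -- coefficient 0, after which it is a relation on `ws`. This suits induction along the list.
  data Indep {s} (S : Pred Carrier s) {n} : List (V n) → Set (c ⊔ ℓ ⊔ s) where
    []  : Indep S []
    _∷_ : ∀ {w ws} → (∀ a y → a ∈ S → Comb S ws y → (∀ i → a * w i + y i ≈ 0#) → a ≈ 0#) →
          Indep S ws → Indep S (w ∷ ws)

  ⋀ₗ : ∀ {n} → List (V n) → Exterior n
  ⋀ₗ = List.foldr _∧_ one

  lin : ∀ {n} (ws : List (V n)) → V (length ws) → V n
  lin []       a i = 0#
  lin (w ∷ ws) a i = a zero * w i + lin ws (Vector.tail a) i

  -- The map of exterior algebras induced by lin ws.
  push : ∀ {n} (ws : List (V n)) → Exterior (length ws) → Exterior n
  push []       ω I = ω Vec.[] * one I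
  push (w ∷ ws) ω I = push ws (ω ∘ (outside Vec.∷_)) I + (w ∧ push ws (ω ∘ (inside Vec.∷_))) I

  HomogeneousOf : ∀ {n} → ℕ → Exterior n → Set ℓ
  HomogeneousOf k ω = ∀ I → ¬ ∣ I ∣ ≡ k → ω I ≈ 0#

  comb-resp : ∀ {s} {S : Pred Carrier s} {n} {ws : List (V n)} {x y} →
              x ≐ y → Comb S ws x → Comb S ws y
  comb-resp x≐y (nil x≈0)           = nil λ i → trans (sym (x≐y i)) (x≈0 i)
  comb-resp x≐y (cons a z a∈ z∈ x≈) = cons a z a∈ z∈ λ i → trans (sym (x≐y i)) (x≈ i)

  comb-mono : ∀ {s t} {S : Pred Carrier s} {T : Pred Carrier t} {n} {ws : List (V n)} {x} →
              S ⊆ T → Comb S ws x → Comb T ws x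
  comb-mono S⊆T (nil x≈0)           = nil x≈0
  comb-mono S⊆T (cons a z a∈ z∈ x≈) = cons a z (S⊆T a∈) (comb-mono S⊆T z∈) x≈

  comb-∈ : ∀ {s p} {S : Pred Carrier s} {n} {P : Pred (V n) p} {ws : List (V n)} {x} →
           (∀ {x y} → x ≐ y → x ∈ P → y ∈ P) → (λ _ → 0#) ∈ P →
           (∀ {a x y} → a ∈ S → x ∈ P → y ∈ P → (λ i → a * x i + y i) ∈ P) →
           All P ws → Comb S ws x → x ∈ P
  comb-∈ resp 0∈ lin∈ []       (nil x≈0)           = resp (λ i → sym (x≈0 i)) 0∈
  comb-∈ resp 0∈ lin∈ (w ∷ ws) (cons a y a∈ y∈ x≈) =
    resp (λ i → sym (x≈ i)) (lin∈ a∈ w (comb-∈ resp 0∈ lin∈ ws y∈))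

  ∧-zeroʳ : ∀ {n} (x : V n) {ω} → Zero ω → Zero (x ∧ ω)
  ∧-zeroʳ x {ω} ω≈0 I = trans
    (∧-linʳ 0# 0# x {ω} {ω} (λ J → trans (ω≈0 J) (solve 1 (λ w → con 0ℤ := con 0ℤ :* w :+ con 0ℤ :* w) refl (ω J))) I)
    (solve 1 (λ w → con 0ℤ :* w :+ con 0ℤ :* w := con 0ℤ) refl _)

  ∧-zeroˡ : ∀ {n} {x : V n} ω → (∀ i → x i ≈ 0#) → Zero (x ∧ ω)
  ∧-zeroˡ {x = x} ω x≈0 I = trans
    (∧-linˡ 0# 0# {x} {x} ω (λ j → trans (x≈0 j) (solve 1 (λ w → con 0ℤ := con 0ℤ :* w :+ con 0ℤ :* w) refl (x j))) I)
    (solve 1 (λ w → con 0ℤ :* w :+ con 0ℤ :* w := con 0ℤ) refl _)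

  ∧-scaleʳ : ∀ {n} a (x : V n) {ω η} → (∀ I → η I ≈ a * ω I) → ∀ I → (x ∧ η) I ≈ a * (x ∧ ω) I
  ∧-scaleʳ a x {ω} η≈ I = trans
    (∧-linʳ a 0# x {ω} {ω} (λ J → trans (η≈ J) (solve 2 (λ a w → a :* w := a :* w :+ con 0ℤ :* w) refl a (ω J))) I)
    (solve 2 (λ a w → a :* w :+ con 0ℤ :* w := a :* w) refl a _)

  ∧-shift : ∀ {n} a {w x y : V n} ω → (∀ i → x i ≈ a * w i + y i) →
            ∀ I → (x ∧ ω) I ≈ a * (w ∧ ω) I + (y ∧ ω) I
  ∧-shift a ω x≈ I = trans (∧-linˡ a 1# ω (λ i → trans (x≈ i) (+-congˡ (sym (*-identityˡ _)))) I)
                           (+-congˡ (*-identityˡ _))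

  ∧-swap-zero : ∀ {n} (x y : V n) {ω} → Zero (y ∧ ω) → Zero (y ∧ (x ∧ ω))
  ∧-swap-zero x y yω≈0 I = trans (∧-anti y x _ I) (trans (-‿cong (∧-zeroʳ x yω≈0 I)) -0#≈0#)

  ⋀ₗ-cong : ∀ {n} {xs ys : List (V n)} → Pointwise _≐_ xs ys → ⋀ₗ xs ≐ ⋀ₗ ys
  ⋀ₗ-cong []       I = refl
  ⋀ₗ-cong (p ∷ ps) I = ∧-cong p (⋀ₗ-cong ps) I

  -- The multiple of `w` meets `w` again and dies; the remainder `y` moves past `w` at the cost of a
  -- sign and falls under the induction hypothesis.
  comb-∧-⋀ₗ : ∀ {s} {S : Pred Carrier s} {n} {ws : List (V n)} {x} → Comb S ws x → Zero (x ∧ ⋀ₗ ws)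
  comb-∧-⋀ₗ (nil x≈0) = ∧-zeroˡ one x≈0
  comb-∧-⋀ₗ {ws = w ∷ ws} {x} (cons a y a∈ y∈ x≈) I = begin
    (x ∧ (w ∧ ⋀ₗ ws)) I                             ≈⟨ ∧-shift a _ x≈ I ⟩
    a * (w ∧ (w ∧ ⋀ₗ ws)) I + (y ∧ (w ∧ ⋀ₗ ws)) I   ≈⟨ +-cong (*-congˡ (∧-alt w (⋀ₗ ws) I)) (∧-swap-zero w y (comb-∧-⋀ₗ y∈) I) ⟩
    a * 0# + 0#                                     ≈⟨ trans (+-identityʳ _) (zeroʳ a) ⟩
    0#                                              ∎

  -- An elimination step along `v`. The factor `s` covers two uses: `s = v p` clears coordinate `p`
  -- without division, and `s = 1` gives Gram-Schmidt.
  shear : ∀ {n} → Carrier → (V n → Carrier) → V n → V n → V n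
  shear s t v w i = s * w i + t w * v i

  -- The added multiples of `v` are killed by the leading `v`, so each vector of the family only
  -- contributes its factor `s`.
  ∧-⋀ₗ-shear : ∀ {n} s (t : V n → Carrier) v ws I →
               (v ∧ ⋀ₗ (List.map (shear s t v) ws)) I ≈ s ^ length ws * (v ∧ ⋀ₗ ws) I
  ∧-⋀ₗ-shear s t v []       I = sym (*-identityˡ _)
  ∧-⋀ₗ-shear s t v (w ∷ ws) I = begin
    (v ∧ (shear s t v w ∧ η′)) I                    ≈⟨ ∧-anti v (shear s t v w) η′ I ⟩
    - (shear s t v w ∧ (v ∧ η′)) I                  ≈⟨ -‿cong (∧-linˡ s (t w) {w} {v} (v ∧ η′) (λ _ → refl) I) ⟩
    - (s * (w ∧ (v ∧ η′)) I + t w * (v ∧ (v ∧ η′)) I)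
      ≈⟨ -‿cong (+-cong (*-congˡ (∧-scaleʳ (s ^ length ws) w (∧-⋀ₗ-shear s t v ws) I)) (*-congˡ (∧-alt v η′ I))) ⟩
    - (s * (s ^ length ws * (w ∧ (v ∧ η)) I) + t w * 0#)
      ≈⟨ -‿cong (+-congʳ (*-congˡ (*-congˡ (∧-anti w v η I)))) ⟩
    - (s * (s ^ length ws * - (v ∧ (w ∧ η)) I) + t w * 0#)
      ≈⟨ solve 4 (λ s p x t → :- (s :* (p :* (:- x)) :+ t :* con 0ℤ) := s :* p :* x) refl s _ _ (t w) ⟩
    s * s ^ length ws * (v ∧ (w ∧ η)) I             ∎
    where
    η  = ⋀ₗ ws
    η′ = ⋀ₗ (List.map (shear s t v) ws)

  push-lin : ∀ {n} (ws : List (V n)) a b {ω η ζ} → (∀ I → ζ I ≈ a * ω I + b * η I) →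
             ∀ I → push ws ζ I ≈ a * push ws ω I + b * push ws η I
  push-lin [] a b {ω} {η} ζ≈ I = trans (*-congʳ (ζ≈ Vec.[]))
    (solve 5 (λ a b x y o → (a :* x :+ b :* y) :* o := a :* (x :* o) :+ b :* (y :* o)) refl a b (ω Vec.[]) (η Vec.[]) _)
  push-lin (w ∷ ws) a b ζ≈ I = trans
    (+-cong (push-lin ws a b (λ J → ζ≈ (outside Vec.∷ J)) I)
            (∧-linʳ a b w (push-lin ws a b (λ J → ζ≈ (inside Vec.∷ J))) I))
    (solve 6 (λ a b x y z t → (a :* x :+ b :* y) :+ (a :* z :+ b :* t) := a :* (x :+ z) :+ b :* (y :+ t))
      refl a b _ _ _ _)

  push-zero : ∀ {n} (ws : List (V n)) {ω} → Zero ω → Zero (push ws ω)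
  push-zero ws {ω} ω≈0 I = trans
    (push-lin ws 0# 0# {ω} {ω} (λ J → trans (ω≈0 J) (solve 1 (λ w → con 0ℤ := con 0ℤ :* w :+ con 0ℤ :* w) refl (ω J))) I)
    (solve 1 (λ w → con 0ℤ :* w :+ con 0ℤ :* w := con 0ℤ) refl _)

  -- Functoriality of the exterior algebra. Terms containing `w` twice vanish, and exchanging `w`
  -- with the image of the tail of `v` accounts for the minus sign in the recursion of `∧`.
  push-∧ : ∀ {n} (ws : List (V n)) v ω → push ws (v ∧ ω) ≐ (lin ws v ∧ push ws ω)
  push-∧ [] v ω I = trans (zeroˡ _) (sym (∧-zeroˡ (push [] ω) (λ _ → refl) I))
  push-∧ (w ∷ ws) v ω I = begin
    push ws (v′ ∧ ωₒ) I + (w ∧ push ws (λ J → v zero * ωₒ J - (v′ ∧ ωᵢ) J)) I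
      ≈⟨ +-cong (push-∧ ws v′ ωₒ I) (∧-linʳ (v zero) (- 1#) w (λ J → trans
           (push-lin ws (v zero) (- 1#) {ωₒ} {v′ ∧ ωᵢ}
              (λ L → solve 2 (λ s t → s :- t := s :+ (:- con 1ℤ) :* t) refl _ _) J)
           (+-congˡ (*-congˡ (push-∧ ws v′ ωᵢ J)))) I) ⟩
    (x ∧ pₒ) I + (v zero * (w ∧ pₒ) I + - 1# * (w ∧ (x ∧ pᵢ)) I)
      ≈⟨ +-congˡ (+-congˡ (*-congˡ (∧-anti w x pᵢ I))) ⟩
    (x ∧ pₒ) I + (v zero * (w ∧ pₒ) I + - 1# * - (x ∧ (w ∧ pᵢ)) I)
      -- The added 0 is about to become `w ∧ (w ∧ pᵢ)`, which completes `w ∧ pₒ` to `w ∧ p`.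
      ≈⟨ solve 4 (λ p a q r → p :+ (a :* q :+ (:- con 1ℤ) :* (:- r)) :=
           a :* (q :+ con 0ℤ) :+ (p :+ r)) refl _ (v zero) _ _ ⟩
    v zero * ((w ∧ pₒ) I + 0#) + ((x ∧ pₒ) I + (x ∧ (w ∧ pᵢ)) I)
      ≈⟨ +-cong (*-congˡ (trans (∧-sum w I) (+-congˡ (∧-alt w pᵢ I)))) (∧-sum x I) ⟨
    v zero * (w ∧ p) I + (x ∧ p) I
      ≈⟨ ∧-shift (v zero) p (λ _ → refl) I ⟨
    (lin (w ∷ ws) v ∧ p) I ∎
    where
    v′ = Vector.tail v
    ωₒ = ω ∘ (outside Vec.∷_)
    ωᵢ = ω ∘ (inside Vec.∷_)
    x  = lin ws v′
    pₒ = push ws ωₒ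
    pᵢ = push ws ωᵢ
    p  = push (w ∷ ws) ω
    ∧-sum : ∀ z J → (z ∧ p) J ≈ (z ∧ pₒ) J + (z ∧ (w ∧ pᵢ)) J
    ∧-sum z J = trans (∧-linʳ 1# 1# z (λ L → sym (+-cong (*-identityˡ _) (*-identityˡ _))) J)
                      (+-cong (*-identityˡ _) (*-identityˡ _))

  push-one : ∀ {n} (ws : List (V n)) → push ws one ≐ one
  push-one []       I = *-identityˡ _
  push-one (w ∷ ws) I = trans
    (+-cong (push-one ws I) (∧-zeroʳ w (push-zero ws (λ _ → refl)) I)) (+-identityʳ _)

  push-⋀ₗ : ∀ {n} (ws : List (V n)) vs → push ws (⋀ₗ vs) ≐ ⋀ₗ (List.map (lin ws) vs)
  push-⋀ₗ ws []       I = push-one ws I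
  push-⋀ₗ ws (v ∷ vs) I = trans (push-∧ ws v (⋀ₗ vs) I) (∧-cong (λ _ → refl) (push-⋀ₗ ws vs) I)

  one-homogeneous : ∀ {n} → HomogeneousOf 0 (one {n})
  one-homogeneous Vec.[]              ≢0 = ⊥-elim (≢0 ≡.refl)
  one-homogeneous (outside Vec.∷ I) ≢0 = one-homogeneous I ≢0
  one-homogeneous (inside Vec.∷ I)  _  = refl

  ∧-homogeneous : ∀ {n k} (v : V n) {ω} → HomogeneousOf k ω → HomogeneousOf (suc k) (v ∧ ω)
  ∧-homogeneous v hom Vec.[] _ = refl
  ∧-homogeneous v hom (outside Vec.∷ I) ≢k = ∧-homogeneous _ (λ J → hom (outside Vec.∷ J)) I ≢k
  ∧-homogeneous {k = zero} v hom (inside Vec.∷ I) ≢k = trans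
    (+-cong (*-congˡ (hom (outside Vec.∷ I) (≢k ∘ ≡.cong suc)))
            (-‿cong (∧-zeroʳ _ (λ J → hom (inside Vec.∷ J) λ ()) I)))
    (solve 1 (λ x → x :* con 0ℤ :- con 0ℤ := con 0ℤ) refl (v zero))
  ∧-homogeneous {k = suc k} v hom (inside Vec.∷ I) ≢k = trans
    (+-cong (*-congˡ (hom (outside Vec.∷ I) (≢k ∘ ≡.cong suc)))
            (-‿cong (∧-homogeneous _ (λ J ≢ → hom (inside Vec.∷ J) (≢ ∘ ℕ.suc-injective)) I (≢k ∘ ≡.cong suc))))
    (solve 1 (λ x → x :* con 0ℤ :- con 0ℤ := con 0ℤ) refl (v zero))

  ⋀ₗ-homogeneous : ∀ {n} (ws : List (V n)) → HomogeneousOf (length ws) (⋀ₗ ws)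
  ⋀ₗ-homogeneous []       = one-homogeneous
  ⋀ₗ-homogeneous (w ∷ ws) = ∧-homogeneous w (⋀ₗ-homogeneous ws)

  homogeneous-above : ∀ {n k} {ω : Exterior n} → n ℕ.< k → HomogeneousOf k ω → Zero ω
  homogeneous-above n<k hom I = hom I λ { ≡.refl → ℕ.<⇒≱ n<k (∣p∣≤n I) }

  -- Forms of top degree are one-dimensional: the part of `ω` avoiding the first basis vector has
  -- degree above its number of coordinates and vanishes, so only the coefficient at `full` survives
  -- the recursion.
  push-top : ∀ {n} (ws : List (V n)) {ω} → HomogeneousOf (length ws) ω →
             ∀ I → push ws ω I ≈ ω full * ⋀ₗ ws I
  push-top []       hom I = refl
  push-top (w ∷ ws) {ω} hom I = trans
    (+-cong (push-zero ws (homogeneous-above (ℕ.n<1+n _) (λ J → hom (outside Vec.∷ J))) I)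
            (∧-scaleʳ (ω full) w (push-top ws λ J ≢ → hom (inside Vec.∷ J) (≢ ∘ ℕ.suc-injective)) I))
    (+-identityˡ _)

  comb-coords : ∀ {s} {S : Pred Carrier s} {n} {ws : List (V n)} {x} → Comb S ws x →
                ∃ λ a → (∀ i → a i ∈ S) × x ≐ lin ws a
  comb-coords (nil x≈0) = (λ ()) , (λ ()) , x≈0
  comb-coords (cons a y a∈ y∈ x≈) with comb-coords y∈
  ... | b , b∈ , y≐ = (a Vector.∷ b) , (λ { zero → a∈ ; (suc i) → b∈ i }) , λ i → trans (x≈ i) (+-congˡ (y≐ i))

  combs-coords : ∀ {s} {S : Pred Carrier s} {n} {ws xs : List (V n)} → All (Comb S ws) xs →
                 ∃ λ as → All (λ a → ∀ i → a i ∈ S) as × Pointwise _≐_ xs (List.map (lin ws) as) ×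
                          length as ≡ length xs
  combs-coords [] = [] , [] , [] , ≡.refl
  combs-coords (x∈ ∷ xs∈) with comb-coords x∈ | combs-coords xs∈
  ... | a , a∈ , x≐ | as , as∈ , xs≐ , eq = a ∷ as , a∈ ∷ as∈ , x≐ ∷ xs≐ , ≡.cong suc eq

  lin-comb : ∀ {n} (ws : List (V n)) a b {x y z} → (∀ i → z i ≈ a * x i + b * y i) →
             ∀ i → lin ws z i ≈ a * lin ws x i + b * lin ws y i
  lin-comb []       a b z≈ i = solve 2 (λ a b → con 0ℤ := a :* con 0ℤ :+ b :* con 0ℤ) refl a b
  lin-comb (w ∷ ws) a b {x} {y} z≈ i = trans (+-cong (*-congʳ (z≈ zero)) (lin-comb ws a b (z≈ ∘ suc) i))
    (solve 7 (λ a b x y w p q → (a :* x :+ b :* y) :* w :+ (a :* p :+ b :* q) := a :* (x :* w :+ p) :+ b :* (y :* w :+ q))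
      refl a b (x zero) (y zero) (w i) _ _)

  lin-zero : ∀ {n} (ws : List (V n)) {x} → (∀ i → x i ≈ 0#) → ∀ i → lin ws x i ≈ 0#
  lin-zero []       x≈0 i = refl
  lin-zero (w ∷ ws) x≈0 i = trans (+-cong (trans (*-congʳ (x≈0 zero)) (zeroˡ _)) (lin-zero ws (x≈0 ∘ suc) i)) (+-identityʳ _)

  lin-shift : ∀ {n} (ws : List (V n)) a {x y z} → (∀ i → z i ≈ a * x i + y i) →
              ∀ i → lin ws z i ≈ a * lin ws x i + lin ws y i
  lin-shift ws a z≈ i = trans (lin-comb ws a 1# (λ j → trans (z≈ j) (+-congˡ (sym (*-identityˡ _)))) i) (+-congˡ (*-identityˡ _))

  comb-map-lin : ∀ {s} {S : Pred Carrier s} {n} (ws : List (V n)) {as x} → Comb S as x →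
                 Comb S (List.map (lin ws) as) (lin ws x)
  comb-map-lin ws (nil x≈0) = nil (lin-zero ws x≈0)
  comb-map-lin ws (cons a y a∈ y∈ x≈) = cons a (lin ws y) a∈ (comb-map-lin ws y∈) (lin-shift ws a x≈)

  comb-map-lin⁻¹ : ∀ {s} {S : Pred Carrier s} {n} (ws : List (V n)) as {x} →
                   Comb S (List.map (lin ws) as) x → ∃ λ y → Comb S as y × x ≐ lin ws y
  comb-map-lin⁻¹ ws [] (nil x≈0) = (λ _ → 0#) , nil (λ _ → refl) , λ i → trans (x≈0 i) (sym (lin-zero ws (λ _ → refl) i))
  comb-map-lin⁻¹ ws (b ∷ as) (cons a y a∈ y∈ x≈) with comb-map-lin⁻¹ ws as y∈
  ... | z , z∈ , y≐ = (λ i → a * b i + z i) , cons a z a∈ z∈ (λ _ → refl) ,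
    λ i → trans (x≈ i) (trans (+-congˡ (y≐ i)) (sym (lin-shift ws a (λ _ → refl) i)))

  indep-map-lin⁻¹ : ∀ {s} {S : Pred Carrier s} {n} (ws : List (V n)) as →
                    Indep S (List.map (lin ws) as) → Indep S as
  indep-map-lin⁻¹ ws []       []        = []
  indep-map-lin⁻¹ ws (b ∷ as) (h ∷ ind) =
    (λ a y a∈ y∈ eq → h a (lin ws y) a∈ (comb-map-lin ws y∈)
      (λ i → trans (sym (lin-shift ws a (λ _ → refl) i)) (lin-zero ws eq i))) ∷ indep-map-lin⁻¹ ws as ind

  lin-injective : ∀ {n} {ws : List (V n)} → Indep {0ℓ} U ws → ∀ a → (∀ i → lin ws a i ≈ 0#) → ∀ i → a i ≈ 0#
  lin-injective (h ∷ ind) a eq zero = h (a zero) _ tt (lin∈ _ _) eq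
    where
    lin∈ : ∀ {n} (ws : List (V n)) a → Comb U ws (lin ws a)
    lin∈ []       a = nil (λ _ → refl)
    lin∈ (w ∷ ws) a = cons (a zero) _ tt (lin∈ ws _) (λ _ → refl)
  lin-injective {ws = w ∷ ws} ind@(h ∷ ind′) a eq (suc j) = lin-injective ind′ (Vector.tail a)
    (λ i → trans (sym (trans (+-congʳ (trans (*-congʳ (lin-injective ind a eq zero)) (zeroˡ _))) (+-identityˡ _))) (eq i)) j

  indep-map-lin : ∀ {n} {ws : List (V n)} as → Indep {0ℓ} U ws → Indep {0ℓ} U as → Indep {0ℓ} U (List.map (lin ws) as)
  indep-map-lin [] indw [] = []
  indep-map-lin {ws = ws} (b ∷ as) indw (h ∷ ind) = (λ a y _ y∈ eq → let z , z∈ , y≐ = comb-map-lin⁻¹ ws as y∈ in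
      h a z tt z∈ (lin-injective indw _ (λ i → trans (lin-shift ws a (λ _ → refl) i)
        (trans (+-congˡ (sym (y≐ i))) (eq i))))) ∷ indep-map-lin as indw ind

  comb-resp-family : ∀ {s} {S : Pred Carrier s} {n} {xs ys : List (V n)} {z} → Pointwise _≐_ xs ys → Comb S xs z → Comb S ys z
  comb-resp-family [] (nil z≈) = nil z≈
  comb-resp-family (p ∷ ps) (cons a y a∈ y∈ x≈) = cons a y a∈ (comb-resp-family ps y∈) λ i → trans (x≈ i) (+-congʳ (*-congˡ (p i)))

  indep-resp : ∀ {s} {S : Pred Carrier s} {n} {xs ys : List (V n)} → Pointwise _≐_ ys xs → Indep S xs → Indep S ys
  indep-resp [] [] = []
  indep-resp (p ∷ ps) (h ∷ ind) = (λ a y a∈ y∈ eq → h a y a∈ (comb-resp-family ps y∈)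
    (λ i → trans (+-congʳ (*-congˡ (sym (p i)))) (eq i))) ∷ indep-resp ps ind

  NoCoordinate : ∀ {n} → Fin n → Exterior n → Set ℓ
  NoCoordinate p ω = ∀ I → Vec.lookup I p ≡ inside → ω I ≈ 0#

  one-noCoordinate : ∀ {n} (p : Fin n) → NoCoordinate p one
  one-noCoordinate zero    (inside Vec.∷ I)  _  = refl
  one-noCoordinate (suc p) (outside Vec.∷ I) p∈ = one-noCoordinate p I p∈
  one-noCoordinate (suc p) (inside Vec.∷ I)  _  = refl

  ∧-noCoordinate : ∀ {n} (p : Fin n) {v : V n} {ω} → v p ≈ 0# → NoCoordinate p ω → NoCoordinate p (v ∧ ω)
  ∧-noCoordinate zero v≈0 ω∌p (inside Vec.∷ I) p∈ = trans
    (+-cong (trans (*-congʳ v≈0) (zeroˡ _)) (-‿cong (∧-zeroʳ _ (λ J → ω∌p (inside Vec.∷ J) ≡.refl) I)))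
    (-‿inverseʳ 0#)
  ∧-noCoordinate (suc p) v≈0 ω∌p (outside Vec.∷ I) p∈ = ∧-noCoordinate p v≈0 (λ J → ω∌p (outside Vec.∷ J)) I p∈
  ∧-noCoordinate (suc p) v≈0 ω∌p (inside Vec.∷ I) p∈ = trans
    (+-cong (trans (*-congˡ (ω∌p (outside Vec.∷ I) p∈)) (zeroʳ _))
            (-‿cong (∧-noCoordinate p v≈0 (λ J → ω∌p (inside Vec.∷ J)) I p∈)))
    (-‿inverseʳ 0#)

  ⋀ₗ-noCoordinate : ∀ {n} (p : Fin n) {ws : List (V n)} → All (λ w → w p ≈ 0#) ws → NoCoordinate p (⋀ₗ ws)
  ⋀ₗ-noCoordinate p []       = one-noCoordinate p
  ⋀ₗ-noCoordinate p (e ∷ es) = ∧-noCoordinate p e (⋀ₗ-noCoordinate p es)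

  -- Since `ω` does not involve the basis vector at `p`, that vector can only come from `v`. The
  -- sign is the parity of the elements of `I` before `p`; it stays unspecified because absolute
  -- values and vanishing do not see it.
  ∧-pivot : ∀ {n} (p : Fin n) (v : V n) {ω} → NoCoordinate p ω → ∀ I → Vec.lookup I p ≡ outside →
            let x = (v ∧ ω) (I Vec.[ p ]≔ inside) in x ≈ v p * ω I ⊎ - x ≈ v p * ω I
  ∧-pivot zero v ω∌p (outside Vec.∷ I) _ = inj₁ (trans
    (+-congˡ (trans (-‿cong (∧-zeroʳ _ (λ J → ω∌p (inside Vec.∷ J) ≡.refl) I)) -0#≈0#)) (+-identityʳ _))
  ∧-pivot (suc p) v ω∌p (outside Vec.∷ I) p∉ = ∧-pivot p _ (λ J → ω∌p (outside Vec.∷ J)) I p∉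
  ∧-pivot (suc p) v {ω} ω∌p (inside Vec.∷ I) p∉ with ∧-pivot p (Vector.tail v) (λ J → ω∌p (inside Vec.∷ J)) I p∉
  ... | inj₁ eq = inj₂ (trans (trans (-‿cong drop) (-‿involutive _)) eq)
    where drop = trans (+-congʳ (trans (*-congˡ (ω∌p (outside Vec.∷ I Vec.[ p ]≔ inside) (Vec.lookup∘updateAt p I))) (zeroʳ _))) (+-identityˡ _)
  ... | inj₂ eq = inj₁ (trans drop eq)
    where drop = trans (+-congʳ (trans (*-congˡ (ω∌p (outside Vec.∷ I Vec.[ p ]≔ inside) (Vec.lookup∘updateAt p I))) (zeroʳ _))) (+-identityˡ _)

  -- Combinations with coefficients in a subring.

  module _ {s} {S : Pred Carrier s} (isSubring : IsSubring S) where

    open IsSubring isSubring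

    ∧-∈ : ∀ {n} {v : V n} {ω} → (∀ i → v i ∈ S) → (∀ I → ω I ∈ S) → ∀ I → (v ∧ ω) I ∈ S
    ∧-∈ v∈ ω∈ Vec.[]              = 0∈
    ∧-∈ v∈ ω∈ (outside Vec.∷ I) = ∧-∈ (v∈ ∘ suc) (λ J → ω∈ (outside Vec.∷ J)) I
    ∧-∈ v∈ ω∈ (inside Vec.∷ I)  = +∈ (*∈ (v∈ zero) (ω∈ (outside Vec.∷ I))) (-∈ (∧-∈ (v∈ ∘ suc) (λ J → ω∈ (inside Vec.∷ J)) I))

    one-∈ : ∀ {n} I → one {n} I ∈ S
    one-∈ Vec.[]              = 1∈
    one-∈ (outside Vec.∷ I) = one-∈ I
    one-∈ (inside Vec.∷ I)  = 0∈

    ⋀ₗ-∈ : ∀ {n} {ws : List (V n)} → All (λ w → ∀ i → w i ∈ S) ws → ∀ I → ⋀ₗ ws I ∈ S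
    ⋀ₗ-∈ []         = one-∈
    ⋀ₗ-∈ (w∈ ∷ ws∈) = ∧-∈ w∈ (⋀ₗ-∈ ws∈)

    comb-lin : ∀ {n} {ws : List (V n)} {a b x y z} → a ∈ S → b ∈ S → Comb S ws x → Comb S ws y →
               (∀ i → z i ≈ a * x i + b * y i) → Comb S ws z
    comb-lin {a = a} {b} a∈ b∈ (nil x≈0) (nil y≈0) z≈ = nil λ i → trans (z≈ i)
      (trans (+-cong (*-congˡ (x≈0 i)) (*-congˡ (y≈0 i)))
        (solve 2 (λ a b → a :* con 0ℤ :+ b :* con 0ℤ := con 0ℤ) refl a b))
    comb-lin {a = a} {b} a∈ b∈ (cons {w} c x c∈ x∈ x≈) (cons d y d∈ y∈ y≈) z≈ =
      cons (a * c + b * d) (λ i → a * x i + b * y i) (+∈ (*∈ a∈ c∈) (*∈ b∈ d∈))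
        (comb-lin a∈ b∈ x∈ y∈ (λ _ → refl)) λ i → trans (z≈ i) (trans
          (+-cong (*-congˡ (x≈ i)) (*-congˡ (y≈ i)))
          (solve 7 (λ a b c d w x y → a :* (c :* w :+ x) :+ b :* (d :* w :+ y) :=
            (a :* c :+ b :* d) :* w :+ (a :* x :+ b :* y)) refl a b c d (w i) (x i) (y i)))

    comb-zero : ∀ {n} {ws : List (V n)} {x} → (∀ i → x i ≈ 0#) → Comb S ws x
    comb-zero {ws = []}     x≈0 = nil x≈0
    comb-zero {ws = w ∷ ws} x≈0 = cons 0# (λ _ → 0#) 0∈ (comb-zero (λ _ → refl))
      λ i → trans (x≈0 i) (sym (trans (+-identityʳ _) (zeroˡ _)))

    comb-weaken : ∀ {n} {w} {ws : List (V n)} {x} → Comb S ws x → Comb S (w ∷ ws) x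
    comb-weaken x∈ = cons 0# _ 0∈ x∈ λ i → sym (trans (+-congʳ (zeroˡ _)) (+-identityˡ _))

    comb-head : ∀ {n} {w} {ws : List (V n)} → Comb S (w ∷ ws) w
    comb-head = cons 1# (λ _ → 0#) 1∈ (comb-zero (λ _ → refl)) λ i → sym (trans (+-identityʳ _) (*-identityˡ _))

    combs-refl : ∀ {n} (ws : List (V n)) → All (Comb S ws) ws
    combs-refl []       = []
    combs-refl (w ∷ ws) = comb-head ∷ All.map comb-weaken (combs-refl ws)

    comb-scale : ∀ {n} {ws : List (V n)} {a x y} → a ∈ S → Comb S ws x → (∀ i → y i ≈ a * x i) → Comb S ws y
    comb-scale a∈ x∈ y≈ = comb-lin a∈ 0∈ x∈ x∈ λ i → trans (y≈ i) (sym (trans (+-congˡ (zeroˡ _)) (+-identityʳ _)))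

    comb-shift : ∀ {n} {ws : List (V n)} {a x y z} → a ∈ S → Comb S ws x → Comb S ws y →
                 (∀ i → z i ≈ a * x i + y i) → Comb S ws z
    comb-shift a∈ x∈ y∈ z≈ = comb-lin a∈ 1∈ x∈ y∈ λ i → trans (z≈ i) (+-congˡ (sym (*-identityˡ _)))

    comb-trans : ∀ {n} {ws xs : List (V n)} {y} → All (Comb S ws) xs → Comb S xs y → Comb S ws y
    comb-trans = comb-∈ comb-resp (comb-zero (λ _ → refl)) λ a∈ x∈ y∈ → comb-shift a∈ x∈ y∈ (λ _ → refl)

    comb-++ʳ : ∀ {n} (xs : List (V n)) {ys x} → Comb S ys x → Comb S (xs ++ ys) x
    comb-++ʳ []       y∈ = y∈
    comb-++ʳ (x ∷ xs) y∈ = comb-weaken (comb-++ʳ xs y∈)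

    comb-++ˡ : ∀ {n} {xs ys : List (V n)} {x} → Comb S xs x → Comb S (xs ++ ys) x
    comb-++ˡ (nil x≈0)           = comb-zero x≈0
    comb-++ˡ (cons a y a∈ y∈ x≈) = cons a y a∈ (comb-++ˡ y∈) x≈

    comb-++⁻ : ∀ {n} (xs : List (V n)) {ys z} → Comb S (xs ++ ys) z →
               ∃₂ λ x y → Comb S xs x × Comb S ys y × (∀ i → z i ≈ x i + y i)
    comb-++⁻ []       {z = z} z∈ = (λ _ → 0#) , z , nil (λ _ → refl) , z∈ , λ i → sym (+-identityˡ _)
    comb-++⁻ (w ∷ xs) (cons a t a∈ t∈ z≈) with comb-++⁻ xs t∈
    ... | x , y , x∈ , y∈ , t≈ = (λ i → a * w i + x i) , y , cons a x a∈ x∈ (λ _ → refl) , y∈ ,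
      λ i → trans (z≈ i) (trans (+-congˡ (t≈ i)) (sym (+-assoc _ _ _)))

    -- Here `δ` is the determinant of the matrix of coordinates of `xs` with respect to `ws`,
    -- obtained as the coefficient at `full` of the wedge of the coordinate vectors; it lies in `S`
    -- because the coordinates do.
    ⋀ₗ-multiple : ∀ {n} {ws xs : List (V n)} → All (Comb S ws) xs → length xs ≡ length ws →
                  ∃ λ δ → δ ∈ S × (∀ I → ⋀ₗ xs I ≈ δ * ⋀ₗ ws I)
    ⋀ₗ-multiple {ws = ws} {xs} xs∈ |xs|≡|ws| with combs-coords xs∈
    ... | as , as∈ , xs≐ , |as|≡|xs| = ⋀ₗ as full , ⋀ₗ-∈ as∈ full , λ I → begin
      ⋀ₗ xs I                       ≈⟨ ⋀ₗ-cong xs≐ I ⟩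
      ⋀ₗ (List.map (lin ws) as) I   ≈⟨ push-⋀ₗ ws as I ⟨
      push ws (⋀ₗ as) I             ≈⟨ push-top ws (≡.subst (λ k → HomogeneousOf k (⋀ₗ as)) (≡.trans |as|≡|xs| |xs|≡|ws|) (⋀ₗ-homogeneous as)) I ⟩
      ⋀ₗ as full * ⋀ₗ ws I          ∎

    -- The wedge of the coordinate vectors has degree above the number of coordinates, so it is zero
    -- before being pushed forward. All comparisons of lengths rest on this.
    ⋀ₗ-overfull : ∀ {n} {ws xs : List (V n)} → All (Comb S ws) xs → length ws ℕ.< length xs → Zero (⋀ₗ xs)
    ⋀ₗ-overfull {ws = ws} {xs} xs∈ |ws|<|xs| I with combs-coords xs∈
    ... | as , as∈ , xs≐ , |as|≡|xs| = begin
      ⋀ₗ xs I                       ≈⟨ ⋀ₗ-cong xs≐ I ⟩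
      ⋀ₗ (List.map (lin ws) as) I   ≈⟨ push-⋀ₗ ws as I ⟨
      push ws (⋀ₗ as) I             ≈⟨ push-zero ws (homogeneous-above (≡.subst (_ ℕ.<_) (≡.sym |as|≡|xs|) |ws|<|xs|) (⋀ₗ-homogeneous as)) I ⟩
      0#                            ∎

    comb-map-shear : ∀ {n} {s} {t : V n → Carrier} {v} ws {y} → All (λ w → t w ∈ S) ws →
                     Comb S (List.map (shear s t v) ws) y →
                     ∃₂ λ x b → Comb S ws x × b ∈ S × (∀ i → y i ≈ s * x i + b * v i)
    comb-map-shear {s = s} {v = v} [] [] (nil y≈0) = (λ _ → 0#) , 0# , nil (λ _ → refl) , 0∈ ,
      λ i → trans (y≈0 i) (solve 2 (λ s v → con 0ℤ := s :* con 0ℤ :+ con 0ℤ :* v) refl s (v i))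
    comb-map-shear {s = s} {t} {v} (w ∷ ws) (t∈ ∷ ts∈) (cons a z a∈ z∈ y≈) with comb-map-shear ws ts∈ z∈
    ... | x , b , x∈ , b∈ , z≈ = (λ i → a * w i + x i) , a * t w + b , cons a x a∈ x∈ (λ _ → refl) ,
      +∈ (*∈ a∈ t∈) b∈ , λ i → trans (y≈ i) (trans (+-congˡ (z≈ i))
        (solve 7 (λ a s w t v x b → a :* (s :* w :+ t :* v) :+ (s :* x :+ b :* v) :=
          s :* (a :* w :+ x) :+ (a :* t :+ b) :* v) refl a s (w i) (t w) (v i) (x i) b))

  -- Independence and nonvanishing of forms over a field.

  module Field (isField : IsField K) (zero? : ∀ x → Dec (x ≈ 0#)) where

    open IsField isField

    *-cancelˡ-0 : ∀ {a b} → ¬ a ≈ 0# → a * b ≈ 0# → b ≈ 0#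
    *-cancelˡ-0 {a} {b} a≉0 ab≈0 with invertible a a≉0
    ... | a⁻¹ , aa⁻¹≈1 = begin
      b                ≈⟨ *-identityˡ b ⟨
      1# * b           ≈⟨ *-congʳ aa⁻¹≈1 ⟨
      a * a⁻¹ * b      ≈⟨ solve 3 (λ a c b → a :* c :* b := c :* (a :* b)) refl a a⁻¹ b ⟩
      a⁻¹ * (a * b)    ≈⟨ *-congˡ ab≈0 ⟩
      a⁻¹ * 0#         ≈⟨ zeroʳ _ ⟩
      0#               ∎

    ∧-pivot-nonzero : ∀ {n} (p : Fin n) {v : V n} {ω} → ¬ v p ≈ 0# → NoCoordinate p ω → Zero (v ∧ ω) → Zero ω
    ∧-pivot-nonzero p {v} vp≉0 ω∌p z I with Vec.lookup I p in eq
    ... | inside  = ω∌p I eq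
    ... | outside with ∧-pivot p v ω∌p I eq
    ...   | inj₁ e = *-cancelˡ-0 vp≉0 (trans (sym e) (z (I Vec.[ p ]≔ inside)))
    ...   | inj₂ e = *-cancelˡ-0 vp≉0 (trans (sym e) (trans (-‿cong (z (I Vec.[ p ]≔ inside))) -0#≈0#))

    nonzero-coordinate : ∀ {n} {v : V n} → ¬ (∀ i → v i ≈ 0#) → ∃ λ p → ¬ v p ≈ 0#
    nonzero-coordinate = Fin.¬∀⟶∃¬ _ _ (λ i → zero? _)

    -- Cross-multiplication clears coordinate `p` without an inverse of `v p`, so vectors with
    -- entries in a subring keep them there.
    eliminate : ∀ {n} → V n → Fin n → V n → V n
    eliminate v p = shear (v p) (λ w → - w p) v

    -- Wedging a relation `a w + y = 0` with `⋀ₗ ws` kills `y` and leaves `a` times the nonzero form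
    -- of `w ∷ ws`.
    ⋀ₗ-nonzero⇒indep : ∀ {n} {ws : List (V n)} → ¬ Zero (⋀ₗ ws) → Indep {0ℓ} U ws
    ⋀ₗ-nonzero⇒indep {ws = []}     ≉0 = []
    ⋀ₗ-nonzero⇒indep {ws = w ∷ ws} ≉0 = head ∷ ⋀ₗ-nonzero⇒indep (≉0 ∘ ∧-zeroʳ w)
      where
      head : ∀ a y → a ∈ U → Comb U ws y → (∀ i → a * w i + y i ≈ 0#) → a ≈ 0#
      head a y _ y∈ eq with zero? a
      ... | yes a≈0 = a≈0
      ... | no a≉0  = ⊥-elim (≉0 λ I → *-cancelˡ-0 a≉0 (begin
        a * (w ∧ ⋀ₗ ws) I                    ≈⟨ +-identityʳ _ ⟨
        a * (w ∧ ⋀ₗ ws) I + 0#               ≈⟨ +-congˡ (comb-∧-⋀ₗ y∈ I) ⟨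
        a * (w ∧ ⋀ₗ ws) I + (y ∧ ⋀ₗ ws) I    ≈⟨ ∧-shift a (⋀ₗ ws) (λ _ → refl) I ⟨
        ((λ i → a * w i + y i) ∧ ⋀ₗ ws) I    ≈⟨ ∧-zeroˡ _ eq I ⟩
        0#                                   ∎))

    module _ {s} {S : Pred Carrier s} (isSubring : IsSubring S) where

      open IsSubring isSubring

      -- A relation among sheared vectors expands to a relation on `v ∷ w ∷ ws`. Its coefficient at
      -- `v` vanishes first; what is left is a relation on `w ∷ ws` with leading coefficient
      -- `s * a`, and `s` cancels.
      indep-map-shear : ∀ {n} {s} {t : V n → Carrier} {v} ws → s ∈ S → ¬ s ≈ 0# → All (λ w → t w ∈ S) ws →
                        Indep S (v ∷ ws) → Indep S (List.map (shear s t v) ws)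
      indep-map-shear [] s∈ s≉0 ts∈ ind = []
      indep-map-shear {s = s} {t} {v} (w ∷ ws) s∈ s≉0 (t∈ ∷ ts∈) (hv ∷ hw ∷ ind) =
        head ∷ indep-map-shear ws s∈ s≉0 ts∈
          ((λ a y a∈ y∈ → hv a y a∈ (comb-weaken isSubring y∈)) ∷ ind)
        where
        head : ∀ a y → a ∈ S → Comb S (List.map (shear s t v) ws) y →
               (∀ i → a * shear s t v w i + y i ≈ 0#) → a ≈ 0#
        head a y a∈ y∈ eq with comb-map-shear isSubring ws ts∈ y∈
        ... | x , b , x∈ , b∈ , y≈ = *-cancelˡ-0 s≉0 (hw (s * a) (λ i → s * x i) (*∈ s∈ a∈) sx∈ λ i →
            trans (sym (+-identityˡ _)) (trans (+-congʳ (sym (trans (*-congʳ coeff≈0) (zeroˡ _)))) (relation i)))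
          where
          sx∈ : Comb S ws (λ i → s * x i)
          sx∈ = comb-scale isSubring s∈ x∈ (λ _ → refl)
          relation : ∀ i → (a * t w + b) * v i + (s * a * w i + s * x i) ≈ 0#
          relation i = trans (solve 7 (λ a s w t v x b → (a :* t :+ b) :* v :+ (s :* a :* w :+ s :* x) :=
              a :* (s :* w :+ t :* v) :+ (s :* x :+ b :* v)) refl a s (w i) (t w) (v i) (x i) b)
            (trans (+-congˡ (sym (y≈ i))) (eq i))
          coeff≈0 : a * t w + b ≈ 0#
          coeff≈0 = hv _ _ (+∈ (*∈ a∈ t∈) b∈) (cons (s * a) _ (*∈ s∈ a∈) sx∈ (λ _ → refl)) relation

      -- Elimination carried out inside `S`. Clearing a coordinate `p` with `v p` nonzero multiplies
      -- the form by a power of `v p`; the cleared vectors do not involve `p`, so if their wedge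
      -- with `v` vanishes, their own form vanishes. They still have entries in `S` and are
      -- independent over it, which closes the induction. The length `k` drives the recursion
      -- because the tail is replaced by a mapped list.
      indep⇒⋀ₗ-nonzero : ∀ {n} k (as : List (V n)) → length as ≡ k → All (λ a → ∀ i → a i ∈ S) as →
                         Indep S as → ¬ Zero (⋀ₗ as)
      indep⇒⋀ₗ-nonzero k [] _ _ _ z = one-nonzero z
        where
        one-nonzero : ∀ {n} → ¬ Zero (one {n})
        one-nonzero {zero}  z = nontrivial (z Vec.[])
        one-nonzero {suc n} z = one-nonzero {n} λ I → z (outside Vec.∷ I)
      indep⇒⋀ₗ-nonzero (suc k) (v ∷ as) |as| (v∈ ∷ as∈) ind@(hv ∷ _) z
        with nonzero-coordinate {v = v} (λ v≈0 → nontrivial (hv 1# _ 1∈ (comb-zero isSubring (λ _ → refl))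
               λ i → trans (+-identityʳ _) (trans (*-congˡ (v≈0 i)) (zeroʳ _))))
      ... | p , vp≉0 = indep⇒⋀ₗ-nonzero k (List.map (eliminate v p) as)
          (≡.trans (List.length-map _ as) (ℕ.suc-injective |as|))
          (All.map⁺ (All.map (λ a∈ i → +∈ (*∈ (v∈ p) (a∈ i)) (*∈ (-∈ (a∈ p)) (v∈ i))) as∈))
          (indep-map-shear as (v∈ p) vp≉0 (All.map (λ a∈ → -∈ (a∈ p)) as∈) ind)
          (∧-pivot-nonzero p vp≉0
            (⋀ₗ-noCoordinate p (All.map⁺ (All.universal (λ a → solve 2 (λ v a → v :* a :+ (:- a) :* v := con 0ℤ) refl (v p) (a p)) as)))
            λ I → trans (∧-⋀ₗ-shear (v p) _ v as I) (trans (*-congˡ (z I)) (zeroʳ _)))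

    indepU⇒⋀ₗ-nonzero : ∀ {n} {ws : List (V n)} → Indep {0ℓ} U ws → ¬ Zero (⋀ₗ ws)
    indepU⇒⋀ₗ-nonzero {ws = ws} = indep⇒⋀ₗ-nonzero U-subring _ ws ≡.refl (All.universal _ ws)

    -- Elimination in `S` applies to the coordinates of `xs` with respect to `ws`, and a nonzero
    -- form knows nothing of `S`. The coordinates must lie in `S`: arbitrary vectors independent
    -- over a subring can be dependent over the field.
    indep-over-field : ∀ {s} {S : Pred Carrier s} → IsSubring S → ∀ {n} {ws xs : List (V n)} →
                       Indep {0ℓ} U ws → All (Comb S ws) xs → Indep S xs → Indep {0ℓ} U xs
    indep-over-field isSubring {ws = ws} indw xs∈ ind with combs-coords xs∈
    ... | as , as∈ , xs≐ , _ = indep-resp xs≐ (indep-map-lin as indw (⋀ₗ-nonzero⇒indep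
      (indep⇒⋀ₗ-nonzero isSubring _ as ≡.refl as∈ (indep-map-lin⁻¹ ws as (indep-resp (Pointwise.symmetric (λ p i → sym (p i)) xs≐) ind)))))

    indep-length : ∀ {n} {ws xs : List (V n)} → Indep {0ℓ} U xs → All (Comb {0ℓ} U ws) xs → length xs ℕ.≤ length ws
    indep-length ind xs∈ = ℕ.≮⇒≥ λ lt → indepU⇒⋀ₗ-nonzero ind (⋀ₗ-overfull U-subring xs∈ lt)

    -- The nonzero form `⋀ₗ ws` is a multiple of `⋀ₗ xs`, which therefore is nonzero too. So a
    -- change of generators that preserves their number preserves independence.
    indep-transfer : ∀ {n} {ws xs : List (V n)} → length ws ≡ length xs → Indep {0ℓ} U ws → All (Comb {0ℓ} U xs) ws →
                     Indep {0ℓ} U xs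
    indep-transfer eq ind ws∈ with ⋀ₗ-multiple U-subring ws∈ eq
    ... | δ , _ , ⋀≈ = ⋀ₗ-nonzero⇒indep λ z → indepU⇒⋀ₗ-nonzero ind
      λ I → trans (⋀≈ I) (trans (*-congˡ (z I)) (zeroʳ _))

-- Ultrametric absolute values and the norm of a form.

record IsAbsoluteValue (K : CommutativeRing c ℓ) (abs : CommutativeRing.Carrier K → ℚ) : Set (c ⊔ ℓ) where
  open CommutativeRing K
  field
    abs-cong    : ∀ {x y} → x ≈ y → abs x ≡ abs y
    abs-nonNeg  : ∀ x → 0ℚ ℚ.≤ abs x
    abs-0       : abs 0# ≡ 0ℚ
    abs≡0⇒≈0    : ∀ x → abs x ≡ 0ℚ → x ≈ 0#
    abs-1       : abs 1# ≡ 1ℚ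
    abs-neg     : ∀ x → abs (- x) ≡ abs x
    abs-*       : ∀ x y → abs (x * y) ≡ abs x ℚ.* abs y
    ultrametric : ∀ x y → abs (x + y) ℚ.≤ abs x ℚ.⊔ abs y

module ℚ-Lemmas where

  *-mono-≤ : ∀ {p q r s} → 0ℚ ℚ.≤ r → 0ℚ ℚ.≤ q → p ℚ.≤ q → r ℚ.≤ s → p ℚ.* r ℚ.≤ q ℚ.* s
  *-mono-≤ {p} {q} {r} {s} 0≤r 0≤q p≤q r≤s = ℚ.≤-trans
    (ℚ.*-monoʳ-≤-nonNeg r {{ℚ.nonNegative 0≤r}} p≤q) (ℚ.*-monoˡ-≤-nonNeg q {{ℚ.nonNegative 0≤q}} r≤s)

  *-nonNeg : ∀ {p q} → 0ℚ ℚ.≤ p → 0ℚ ℚ.≤ q → 0ℚ ℚ.≤ p ℚ.* q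
  *-nonNeg {p} {q} 0≤p 0≤q = ≡.subst (ℚ._≤ p ℚ.* q) (ℚ.*-zeroˡ 0ℚ) (*-mono-≤ ℚ.≤-refl 0≤p 0≤p 0≤q)

  open CommutativeSemigroupProperties (CommutativeMonoid.commutativeSemigroup ℚ.*-1-commutativeMonoid) public
    using (interchange; x∙yz≈y∙xz; x∙yz≈yx∙z)

module ExteriorNorm (K : CommutativeRing c ℓ) (isField : IsField K)
                    (abs : CommutativeRing.Carrier K → ℚ) (isAbs : IsAbsoluteValue K abs) where

  open CommutativeRing K hiding (zero)
  open IsAbsoluteValue isAbs
  open IsField isField
  open ExteriorAlgebra K
  open ExteriorProperties K
  open IntegerCoefficients K
  open Families K
  open ℚ-Lemmas
  private module ≤ = ℚ.≤-Reasoning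

  zero? : ∀ x → Dec (x ≈ 0#)
  zero? x with abs x ℚ.≟ 0ℚ
  ... | yes eq = yes (abs≡0⇒≈0 x eq)
  ... | no neq = no λ x≈0 → neq (≡.trans (abs-cong x≈0) abs-0)

  open Field isField zero?

  abs-sum-≤ : ∀ {x y B} → abs x ℚ.≤ B → abs y ℚ.≤ B → abs (x + y) ℚ.≤ B
  abs-sum-≤ p q = ℚ.≤-trans (ultrametric _ _) (ℚ.⊔-lub p q)

  -- Taken over subsets of every size and recursive in the first coordinate, as `∧` is. On forms of
  -- degree `k` it agrees with `norm k`, the additional coefficients being 0.
  ‖_‖ : ∀ {n} → Exterior n → ℚ
  ‖_‖ {zero}  ω = abs (ω Vec.[])
  ‖_‖ {suc n} ω = ‖ ω ∘ (outside Vec.∷_) ‖ ℚ.⊔ ‖ ω ∘ (inside Vec.∷_) ‖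

  ‖‖-nonNeg : ∀ {n} (ω : Exterior n) → 0ℚ ℚ.≤ ‖ ω ‖
  ‖‖-nonNeg {zero}  ω = abs-nonNeg _
  ‖‖-nonNeg {suc n} ω = ℚ.≤-trans (‖‖-nonNeg (ω ∘ (outside Vec.∷_))) (ℚ.p≤p⊔q _ _)

  coefficient-≤ : ∀ {n} (ω : Exterior n) I → abs (ω I) ℚ.≤ ‖ ω ‖
  coefficient-≤ ω Vec.[]              = ℚ.≤-refl
  coefficient-≤ ω (outside Vec.∷ I) = ℚ.≤-trans (coefficient-≤ _ I) (ℚ.p≤p⊔q _ _)
  coefficient-≤ ω (inside Vec.∷ I)  = ℚ.≤-trans (coefficient-≤ _ I) (ℚ.p≤q⊔p ‖ ω ∘ (outside Vec.∷_) ‖ _)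

  ‖‖-lub : ∀ {n} {ω : Exterior n} {B} → (∀ I → abs (ω I) ℚ.≤ B) → ‖ ω ‖ ℚ.≤ B
  ‖‖-lub {zero}  h = h Vec.[]
  ‖‖-lub {suc n} h = ℚ.⊔-lub (‖‖-lub (λ I → h (outside Vec.∷ I))) (‖‖-lub (λ I → h (inside Vec.∷ I)))

  ‖‖-cong : ∀ {n} {ω η : Exterior n} → ω ≐ η → ‖ ω ‖ ≡ ‖ η ‖
  ‖‖-cong {zero}  eq = abs-cong (eq Vec.[])
  ‖‖-cong {suc n} eq = ≡.cong₂ ℚ._⊔_ (‖‖-cong (λ I → eq (outside Vec.∷ I))) (‖‖-cong (λ I → eq (inside Vec.∷ I)))

  ‖‖-zero : ∀ {n} {ω : Exterior n} → Zero ω → ‖ ω ‖ ≡ 0ℚ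
  ‖‖-zero {ω = ω} z = ℚ.≤-antisym (‖‖-lub λ I → ℚ.≤-reflexive (≡.trans (abs-cong (z I)) abs-0)) (‖‖-nonNeg ω)

  ‖‖-scale-≥ : ∀ {n} a {ω η : Exterior n} → (∀ I → η I ≈ a * ω I) → 1ℚ ℚ.≤ abs a → ‖ ω ‖ ℚ.≤ ‖ η ‖
  ‖‖-scale-≥ a {ω} {η} η≈ 1≤a = ‖‖-lub λ I → ≤.begin
    abs (ω I)               ≤.≡⟨ ℚ.*-identityˡ _ ⟨
    1ℚ ℚ.* abs (ω I)        ≤.≤⟨ ℚ.*-monoʳ-≤-nonNeg (abs (ω I)) {{ℚ.nonNegative (abs-nonNeg (ω I))}} 1≤a ⟩
    abs a ℚ.* abs (ω I)     ≤.≡⟨ ≡.trans (abs-cong (η≈ I)) (abs-* a (ω I)) ⟨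
    abs (η I)               ≤.≤⟨ coefficient-≤ η I ⟩
    ‖ η ‖                   ≤.∎

  ‖one‖≡1 : ∀ {n} → ‖ one {n} ‖ ≡ 1ℚ
  ‖one‖≡1 {zero}  = abs-1
  ‖one‖≡1 {suc n} = ≡.trans (≡.cong₂ ℚ._⊔_ (‖one‖≡1 {n}) (‖‖-zero {n} (λ _ → refl))) ≡.refl

  -- Each coefficient is a signed sum of products, and by the ultrametric inequality the number of
  -- summands does not enter the bound.
  ∧-≤ : ∀ {n} {v : V n} {ω B C} → 0ℚ ℚ.≤ B → 0ℚ ℚ.≤ C → (∀ i → abs (v i) ℚ.≤ B) → (∀ I → abs (ω I) ℚ.≤ C) →
        ∀ I → abs ((v ∧ ω) I) ℚ.≤ B ℚ.* C
  ∧-≤ {B = B} {C} 0≤B 0≤C v≤ ω≤ Vec.[] = ℚ.≤-trans (ℚ.≤-reflexive abs-0) (*-nonNeg 0≤B 0≤C)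
  ∧-≤ 0≤B 0≤C v≤ ω≤ (outside Vec.∷ I) = ∧-≤ 0≤B 0≤C (v≤ ∘ suc) (λ J → ω≤ (outside Vec.∷ J)) I
  ∧-≤ {v = v} {ω} 0≤B 0≤C v≤ ω≤ (inside Vec.∷ I) = abs-sum-≤
    (ℚ.≤-trans (ℚ.≤-reflexive (abs-* _ _)) (*-mono-≤ (abs-nonNeg _) 0≤B (v≤ zero) (ω≤ (outside Vec.∷ I))))
    (ℚ.≤-trans (ℚ.≤-reflexive (abs-neg _)) (∧-≤ 0≤B 0≤C (v≤ ∘ suc) (λ J → ω≤ (inside Vec.∷ J)) I))

  ‖∧‖-≤ : ∀ {n} {v : V n} {B} (ω : Exterior n) → 0ℚ ℚ.≤ B → (∀ i → abs (v i) ℚ.≤ B) → ‖ v ∧ ω ‖ ℚ.≤ B ℚ.* ‖ ω ‖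
  ‖∧‖-≤ ω 0≤B v≤ = ‖‖-lub (∧-≤ 0≤B (‖‖-nonNeg ω) v≤ (coefficient-≤ ω))

  ‖‖-attained : ∀ {n} (ω : Exterior n) → ∃ λ I → ‖ ω ‖ ≡ abs (ω I)
  ‖‖-attained {zero}  ω = Vec.[] , ≡.refl
  ‖‖-attained {suc n} ω with ℚ.⊔-sel ‖ ω ∘ (outside Vec.∷_) ‖ ‖ ω ∘ (inside Vec.∷_) ‖
  ... | inj₁ eq = let I , eq′ = ‖‖-attained (ω ∘ (outside Vec.∷_)) in outside Vec.∷ I , ≡.trans eq eq′
  ... | inj₂ eq = let I , eq′ = ‖‖-attained (ω ∘ (inside Vec.∷_)) in inside Vec.∷ I , ≡.trans eq eq′

  -- The upper bound for a wedge is attained: adjoin `p` to a subset where `ω` is largest, and the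
  -- coefficient there is, up to sign, the product of the two maxima.
  ‖∧‖-pivot : ∀ {n} (p : Fin n) {v : V n} {ω} → (∀ i → abs (v i) ℚ.≤ abs (v p)) → NoCoordinate p ω →
              ‖ v ∧ ω ‖ ≡ abs (v p) ℚ.* ‖ ω ‖
  ‖∧‖-pivot p {v} {ω} max ω∌p = ℚ.≤-antisym (‖∧‖-≤ ω (abs-nonNeg (v p)) max) lower
    where
    I = proj₁ (‖‖-attained ω)
    lower : abs (v p) ℚ.* ‖ ω ‖ ℚ.≤ ‖ v ∧ ω ‖
    lower with Vec.lookup I p in eq
    -- A largest coefficient at a subset containing `p` is 0, so `ω` has norm 0.
    ... | inside  = ≤.begin
      abs (v p) ℚ.* ‖ ω ‖   ≤.≡⟨ ≡.cong (abs (v p) ℚ.*_) (≡.trans (proj₂ (‖‖-attained ω)) (≡.trans (abs-cong (ω∌p I eq)) abs-0)) ⟩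
      abs (v p) ℚ.* 0ℚ      ≤.≡⟨ ℚ.*-zeroʳ (abs (v p)) ⟩
      0ℚ                    ≤.≤⟨ ‖‖-nonNeg (v ∧ ω) ⟩
      ‖ v ∧ ω ‖             ≤.∎
    ... | outside = ≤.begin
      abs (v p) ℚ.* ‖ ω ‖   ≤.≡⟨ ≡.cong (abs (v p) ℚ.*_) (proj₂ (‖‖-attained ω)) ⟩
      abs (v p) ℚ.* abs (ω I) ≤.≡⟨ abs-* (v p) (ω I) ⟨
      abs (v p * ω I)       ≤.≡⟨ pivot (∧-pivot p v ω∌p I eq) ⟨
      abs ((v ∧ ω) (I Vec.[ p ]≔ inside)) ≤.≤⟨ coefficient-≤ (v ∧ ω) (I Vec.[ p ]≔ inside) ⟩
      ‖ v ∧ ω ‖             ≤.∎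
      where
      pivot : ∀ {x y} → x ≈ y ⊎ - x ≈ y → abs x ≡ abs y
      pivot (inj₁ e) = abs-cong e
      pivot (inj₂ e) = ≡.trans (≡.sym (abs-neg _)) (abs-cong e)

  largest-coordinate : ∀ {n} (v : V n) → (∀ i → v i ≈ 0#) ⊎ ∃ λ p → ¬ v p ≈ 0# × (∀ i → abs (v i) ℚ.≤ abs (v p))
  largest-coordinate {zero}  v = inj₁ λ ()
  largest-coordinate {suc n} v with largest-coordinate (Vector.tail v) | zero? (v zero)
  ... | inj₁ z | yes v₀≈0 = inj₁ λ { zero → v₀≈0 ; (suc i) → z i }
  ... | inj₁ z | no v₀≉0  = inj₂ (zero , v₀≉0 , λ { zero → ℚ.≤-refl ; (suc i) →
      ℚ.≤-trans (ℚ.≤-reflexive (≡.trans (abs-cong (z i)) abs-0)) (abs-nonNeg _) })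
  ... | inj₂ (p , vp≉0 , max) | _ with ℚ.≤-total (abs (v zero)) (abs (v (suc p)))
  ...   | inj₁ v₀≤vp = inj₂ (suc p , vp≉0 , λ { zero → v₀≤vp ; (suc i) → max i })
  ...   | inj₂ vp≤v₀ = inj₂ (zero , (λ v₀≈0 → vp≉0 (abs≡0⇒≈0 _ (ℚ.≤-antisym
      (ℚ.≤-trans vp≤v₀ (ℚ.≤-reflexive (≡.trans (abs-cong v₀≈0) abs-0))) (abs-nonNeg _)))) ,
      λ { zero → ℚ.≤-refl ; (suc i) → ℚ.≤-trans (max i) vp≤v₀ })

  ‖⋀_‖ : ∀ {n} → List (V n) → ℚ
  ‖⋀ ws ‖ = ‖ ⋀ₗ ws ‖

  -- Ultrametric Gram–Schmidt: subtracting multiples of v clears the coordinate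
  -- at which v is largest and does not change v ∧ ⋀ₗ ws.
  reduction : ∀ {n} (v : V n) → ∃₂ λ B (red : V n → V n) → 0ℚ ℚ.≤ B × (∀ i → abs (v i) ℚ.≤ B) ×
              (∀ ws → ‖⋀ v ∷ ws ‖ ≡ B ℚ.* ‖⋀ List.map red ws ‖)
  reduction v with largest-coordinate v
  ... | inj₁ v≈0 = 0ℚ , (λ w → w) , ℚ.≤-refl , (λ i → ℚ.≤-reflexive (≡.trans (abs-cong (v≈0 i)) abs-0)) ,
    λ ws → ≡.trans (‖‖-zero (∧-zeroˡ (⋀ₗ ws) v≈0)) (≡.sym (ℚ.*-zeroˡ ‖⋀ List.map (λ w → w) ws ‖))
  ... | inj₂ (p , vp≉0 , max) with invertible (v p) vp≉0
  ...   | r , vp*r≈1 = abs (v p) , shear 1# t v , abs-nonNeg (v p) , max , λ ws → ≡.trans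
      (‖‖-cong λ I → sym (trans (∧-⋀ₗ-shear 1# t v ws I) (trans (*-congʳ (1^n≈1 (length ws))) (*-identityˡ _))))
      (‖∧‖-pivot p max (⋀ₗ-noCoordinate p (All.map⁺ (All.universal cleared ws))))
      where
      t = λ w → - (w p * r)
      1^n≈1 : ∀ k → 1# ^ k ≈ 1#
      1^n≈1 zero    = refl
      1^n≈1 (suc k) = trans (*-identityˡ _) (1^n≈1 k)
      cleared : ∀ w → shear 1# t v w p ≈ 0#
      cleared w = trans (solve 3 (λ w r v → con 1ℤ :* w :+ (:- (w :* r)) :* v := w :* (con 1ℤ :- v :* r)) refl (w p) r (v p))
        (trans (*-congˡ (trans (+-congˡ (-‿cong vp*r≈1)) (-‿inverseʳ 1#))) (zeroʳ _))

  -- Splitting off `v` also reduces `gs`. This is undone by reading `B` times the norm of the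
  -- reduced `gs` as the norm of `v ∷ gs`, which is at most `B` times that of `gs`. Keeping the
  -- factor `B` throughout includes the case `v = 0`. The recursion is on the length `k`, as `red`
  -- changes the list.
  ‖++‖-≤ : ∀ {n} k (fs gs : List (V n)) → length fs ≡ k → ‖⋀ fs ++ gs ‖ ℚ.≤ ‖⋀ fs ‖ ℚ.* ‖⋀ gs ‖
  ‖++‖-≤ {n} k [] gs _ = ℚ.≤-reflexive (≡.sym (≡.trans (≡.cong (ℚ._* ‖⋀ gs ‖) (‖one‖≡1 {n})) (ℚ.*-identityˡ ‖⋀ gs ‖)))
  ‖++‖-≤ (suc k) (v ∷ fs) gs |fs| with reduction v
  ... | B , red , 0≤B , v≤B , ‖v∷‖ = ≤.begin
    ‖⋀ v ∷ fs ++ gs ‖                ≤.≡⟨ ‖v∷‖ (fs ++ gs) ⟩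
    B ℚ.* ‖⋀ List.map red (fs ++ gs) ‖ ≤.≡⟨ ≡.cong (λ ws → B ℚ.* ‖⋀ ws ‖) (List.map-++ red fs gs) ⟩
    B ℚ.* ‖⋀ rf ++ rg ‖              ≤.≤⟨ ℚ.*-monoˡ-≤-nonNeg B {{ℚ.nonNegative 0≤B}}
                                              (‖++‖-≤ k rf rg (≡.trans (List.length-map red fs) (ℕ.suc-injective |fs|))) ⟩
    B ℚ.* (‖⋀ rf ‖ ℚ.* ‖⋀ rg ‖)      ≤.≡⟨ x∙yz≈y∙xz B ‖⋀ rf ‖ ‖⋀ rg ‖ ⟩
    ‖⋀ rf ‖ ℚ.* (B ℚ.* ‖⋀ rg ‖)      ≤.≡⟨ ≡.cong (‖⋀ rf ‖ ℚ.*_) (‖v∷‖ gs) ⟨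
    ‖⋀ rf ‖ ℚ.* ‖⋀ v ∷ gs ‖        ≤.≤⟨ ℚ.*-monoˡ-≤-nonNeg ‖⋀ rf ‖ {{ℚ.nonNegative (‖‖-nonNeg (⋀ₗ rf))}} (‖∧‖-≤ (⋀ₗ gs) 0≤B v≤B) ⟩
    ‖⋀ rf ‖ ℚ.* (B ℚ.* ‖⋀ gs ‖)      ≤.≡⟨ x∙yz≈yx∙z ‖⋀ rf ‖ B ‖⋀ gs ‖ ⟩
    B ℚ.* ‖⋀ rf ‖ ℚ.* ‖⋀ gs ‖        ≤.≡⟨ ≡.cong (ℚ._* _) (‖v∷‖ fs) ⟨
    ‖⋀ v ∷ fs ‖ ℚ.* ‖⋀ gs ‖        ≤.∎
    where
    rf = List.map red fs
    rg = List.map red gs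

  ‖⋀‖-submodular : ∀ {n} k (es fs gs : List (V n)) → length es ≡ k →
    ‖⋀ es ‖ ℚ.* ‖⋀ es ++ fs ++ gs ‖ ℚ.≤ ‖⋀ es ++ fs ‖ ℚ.* ‖⋀ es ++ gs ‖
  ‖⋀‖-submodular {n} k [] fs gs _ = ≤.begin
    ‖ one {n} ‖ ℚ.* ‖⋀ fs ++ gs ‖    ≤.≡⟨ ≡.cong (ℚ._* ‖⋀ fs ++ gs ‖) (‖one‖≡1 {n}) ⟩
    1ℚ ℚ.* ‖⋀ fs ++ gs ‖             ≤.≡⟨ ℚ.*-identityˡ ‖⋀ fs ++ gs ‖ ⟩
    ‖⋀ fs ++ gs ‖                    ≤.≤⟨ ‖++‖-≤ _ fs gs ≡.refl ⟩
    ‖⋀ fs ‖ ℚ.* ‖⋀ gs ‖              ≤.∎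
  ‖⋀‖-submodular (suc k) (v ∷ es) fs gs |es| with reduction v
  ... | B , red , 0≤B , _ , ‖v∷‖ = ≤.begin
    ‖⋀ v ∷ es ‖ ℚ.* ‖⋀ v ∷ es ++ fs ++ gs ‖
      ≤.≡⟨ ≡.cong₂ ℚ._*_ (‖v∷‖ es) (≡.trans (‖v∷‖ (es ++ fs ++ gs)) (≡.cong (λ ws → B ℚ.* ‖⋀ ws ‖)
             (≡.trans (List.map-++ red es (fs ++ gs)) (≡.cong (re ++_) (List.map-++ red fs gs))))) ⟩
    (B ℚ.* ‖⋀ re ‖) ℚ.* (B ℚ.* ‖⋀ re ++ rf ++ rg ‖)
      ≤.≡⟨ interchange B _ B _ ⟩
    (B ℚ.* B) ℚ.* (‖⋀ re ‖ ℚ.* ‖⋀ re ++ rf ++ rg ‖)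
      ≤.≤⟨ ℚ.*-monoˡ-≤-nonNeg (B ℚ.* B) {{ℚ.nonNegative (*-nonNeg 0≤B 0≤B)}}
             (‖⋀‖-submodular k re rf rg (≡.trans (List.length-map red es) (ℕ.suc-injective |es|))) ⟩
    (B ℚ.* B) ℚ.* (‖⋀ re ++ rf ‖ ℚ.* ‖⋀ re ++ rg ‖)
      ≤.≡⟨ interchange B B _ _ ⟩
    (B ℚ.* ‖⋀ re ++ rf ‖) ℚ.* (B ℚ.* ‖⋀ re ++ rg ‖)
      ≤.≡⟨ ≡.cong₂ ℚ._*_ (red-++ fs) (red-++ gs) ⟨
    ‖⋀ v ∷ es ++ fs ‖ ℚ.* ‖⋀ v ∷ es ++ gs ‖ ≤.∎
    where
    re = List.map red es
    rf = List.map red fs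
    rg = List.map red gs
    red-++ : ∀ ws → ‖⋀ v ∷ es ++ ws ‖ ≡ B ℚ.* ‖⋀ re ++ List.map red ws ‖
    red-++ ws = ≡.trans (‖v∷‖ (es ++ ws)) (≡.cong (λ zs → B ℚ.* ‖⋀ zs ‖) (List.map-++ red es ws))

-- Bézout identities, linear subspaces and concatenated families.

module PrincipalIdealDomain (K : CommutativeRing ℓ ℓ) where

  open CommutativeRing K hiding (zero)
  open ExteriorProperties K using (_≐_)
  open IntegerCoefficients K
  open Families K

  -- A greatest common divisor `d` with quotients `α`, `β` and Bézout coefficients `κ`, `μ`. For `r`
  -- and `s` in `S`, membership of `d` follows from `d≈`.
  record Bézout (S : Pred Carrier ℓ) (r s : Carrier) : Set ℓ where
    field
      {d α β κ μ} : Carrier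
      α∈   : α ∈ S
      β∈   : β ∈ S
      κ∈   : κ ∈ S
      μ∈   : μ ∈ S
      r≈αd : r ≈ α * d
      s≈βd : s ≈ β * d
      d≈   : d ≈ κ * r + μ * s

  record IsLinear {n} (W : Pred (V n) ℓ) : Set ℓ where
    field
      0∈   : ∀ {x} → (∀ i → x i ≈ 0#) → x ∈ W
      lin∈ : ∀ a {x y z} → x ∈ W → y ∈ W → (∀ i → z i ≈ a * x i + y i) → z ∈ W

    resp : ∀ {x y} → x ≐ y → x ∈ W → y ∈ W
    resp x≐y x∈ = lin∈ 1# x∈ (0∈ (λ _ → refl)) λ i →
      trans (sym (x≐y i)) (sym (trans (+-identityʳ _) (*-identityˡ _)))

    comb⊆ : ∀ {s} {S : Pred Carrier s} {ws x} → All W ws → Comb S ws x → x ∈ W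
    comb⊆ = comb-∈ resp (0∈ (λ _ → refl)) λ {a} _ x∈ y∈ → lin∈ a x∈ y∈ (λ _ → refl)

  ∩-linear : ∀ {n} {L M : Pred (V n) ℓ} → IsLinear L → IsLinear M → IsLinear (L ∩ M)
  ∩-linear linL linM = record
    { 0∈   = λ x≈0 → L.0∈ x≈0 , M.0∈ x≈0
    ; lin∈ = λ { a (x∈L , x∈M) (y∈L , y∈M) z≈ → L.lin∈ a x∈L y∈L z≈ , M.lin∈ a x∈M y∈M z≈ }
    }
    where
    module L = IsLinear linL
    module M = IsLinear linM

  Sum : ∀ {n} → Pred (V n) ℓ → Pred (V n) ℓ → Pred (V n) ℓ
  Sum L M x = ∃₂ λ u v → u ∈ L × v ∈ M × (∀ i → x i ≈ u i + v i)

  sum-linear : ∀ {n} {L M : Pred (V n) ℓ} → IsLinear L → IsLinear M → IsLinear (Sum L M)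
  sum-linear linL linM = record
    { 0∈   = λ x≈0 → _ , _ , L.0∈ (λ _ → refl) , M.0∈ (λ _ → refl) , λ i → trans (x≈0 i) (sym (+-identityˡ 0#))
    ; lin∈ = λ { a {x} {y} (u , v , u∈ , v∈ , x≈) (u′ , v′ , u′∈ , v′∈ , y≈) z≈ →
        _ , _ , L.lin∈ a u∈ u′∈ (λ _ → refl) , M.lin∈ a v∈ v′∈ (λ _ → refl) , λ i →
        trans (z≈ i) (trans (+-cong (*-congˡ (x≈ i)) (y≈ i))
          (solve 5 (λ a u v u′ v′ → a :* (u :+ v) :+ (u′ :+ v′) := (a :* u :+ u′) :+ (a :* v :+ v′))
            refl a (u i) (v i) (u′ i) (v′ i))) }
    }
    where
    module L = IsLinear linL
    module M = IsLinear linM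

  -- In a relation on `xs ++ ys` the part in `xs` is the negative of the part in `ys`, hence lies in
  -- both spans.
  indep-++⁺ : ∀ {n} {S : Pred Carrier ℓ} → IsSubring S → ∀ (xs : List (V n)) {ys} → Indep S xs → Indep S ys →
              (∀ {z} → Comb S xs z → Comb S ys z → ∀ i → z i ≈ 0#) → Indep S (xs ++ ys)
  indep-++⁺ isSubring []       []        indy disjoint = indy
  indep-++⁺ {S = S} isSubring (x ∷ xs) {ys} (h ∷ indx) indy disjoint =
    head ∷ indep-++⁺ isSubring xs indx indy (disjoint ∘ comb-weaken isSubring)
    where
    open IsSubring isSubring
    head : ∀ a y → a ∈ S → Comb S (xs ++ ys) y → (∀ i → a * x i + y i ≈ 0#) → a ≈ 0#
    head a y a∈ y∈ eq with comb-++⁻ isSubring xs y∈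
    ... | u , v , u∈ , v∈ , y≈ = h a u a∈ u∈ (disjoint (cons a u a∈ u∈ (λ _ → refl))
      (comb-scale isSubring (-∈ 1∈) v∈ λ i → trans
        (solve 3 (λ p u v → p :+ u := (p :+ (u :+ v)) :+ (:- con 1ℤ) :* v) refl (a * x i) (u i) (v i))
        (trans (+-congʳ (trans (+-congˡ (sym (y≈ i))) (eq i))) (+-identityˡ _))))

  indep-++ˡ : ∀ {s n} {S : Pred Carrier s} → IsSubring S → ∀ (xs : List (V n)) {ys} → Indep S (xs ++ ys) → Indep S xs
  indep-++ˡ isSubring []       ind       = []
  indep-++ˡ isSubring (x ∷ xs) (h ∷ ind) = (λ a y a∈ y∈ → h a y a∈ (comb-++ˡ isSubring y∈)) ∷ indep-++ˡ isSubring xs ind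

  indep-++ʳ : ∀ {s n} {S : Pred Carrier s} (xs : List (V n)) {ys} → Indep S (xs ++ ys) → Indep S ys
  indep-++ʳ []       ind       = ind
  indep-++ʳ (x ∷ xs) (_ ∷ ind) = indep-++ʳ xs ind

  indep-++-disjoint : ∀ {s n} {S : Pred Carrier s} → IsSubring S → ∀ (xs : List (V n)) {ys z} → Indep S (xs ++ ys) →
                      Comb S xs z → Comb S ys z → ∀ i → z i ≈ 0#
  indep-++-disjoint isSubring [] ind (nil z≈0) _ = z≈0
  indep-++-disjoint {S = S} isSubring (x ∷ xs) {ys} {z} (h ∷ ind) (cons a y a∈ y∈ z≈) z∈ =
    indep-++-disjoint isSubring xs ind (comb-resp (λ i → sym (z≈y i)) y∈) z∈
    where
    open IsSubring isSubring
    a≈0 : a ≈ 0#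
    a≈0 = h a _ a∈ (comb-shift isSubring (-∈ 1∈) (comb-++ʳ isSubring xs z∈) (comb-++ˡ isSubring y∈) (λ _ → refl))
      λ i → trans (+-congˡ (+-congʳ (*-congˡ (z≈ i))))
        (solve 3 (λ a x y → a :* x :+ ((:- con 1ℤ) :* (a :* x :+ y) :+ y) := con 0ℤ) refl a (x i) (y i))
    z≈y : ∀ i → z i ≈ y i
    z≈y i = trans (z≈ i) (trans (+-congʳ (trans (*-congʳ a≈0) (zeroˡ _))) (+-identityˡ _))

  indep-mono : ∀ {s t n} {S : Pred Carrier s} {T : Pred Carrier t} {ws : List (V n)} →
               S ⊆ T → Indep T ws → Indep S ws
  indep-mono S⊆T []        = []
  indep-mono S⊆T (h ∷ ind) = (λ a y a∈ y∈ → h a y (S⊆T a∈) (comb-mono S⊆T y∈)) ∷ indep-mono S⊆T ind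

  -- Adapted bases of lattices over a subring with Bézout identities.

  module Lattice (isField : IsField K) (abs : Carrier → ℚ) (isAbs : IsAbsoluteValue K abs)
                 {S : Pred Carrier ℓ} (isSubring : IsSubring S)
                 (bézout : ∀ {r s} → r ∈ S → s ∈ S → Bézout S r s) (lem : ∀ (A : Set ℓ) → Dec A) where

    open IsField isField
    open IsSubring isSubring
    open ExteriorNorm K isField abs isAbs
    open Field isField zero?
    open ℚ-Lemmas

    all-zero : ∀ {n} {x : V n} → ¬ ¬ (∀ i → x i ≈ 0#) → ∀ i → x i ≈ 0#
    all-zero {x = x} ¬¬z i with zero? (x i)
    ... | yes xi≈0 = xi≈0
    ... | no xi≉0  = ⊥-elim (¬¬z λ z → xi≉0 (z i))

    -- Subspaces admit division by nonzero scalars. This makes the intersection of a subspace with a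
    -- lattice a direct summand, so that its bases can be completed.
    unscale : ∀ {n} {W : Pred (V n) ℓ} → IsLinear W → ∀ {d u x} → ¬ d ≈ 0# → (∀ i → x i ≈ d * u i) → x ∈ W → u ∈ W
    unscale linW {d} {u} d≉0 x≈ x∈ with invertible d d≉0
    ... | r , dr≈1 = lin∈ r x∈ (IsLinear.0∈ linW (λ _ → refl)) λ i → sym (trans (+-identityʳ _) (trans (*-congˡ (x≈ i))
        (trans (solve 3 (λ r d u → r :* (d :* u) := d :* r :* u) refl r d (u i)) (trans (*-congʳ dr≈1) (*-identityˡ _)))))
      where open IsLinear linW

    -- Substituting the quotients into `d≈` gives `d = (κ α + μ β) d`, and `d` cancels. The value is
    -- the determinant of the matrix with rows `(α, β)` and `(-μ, κ)` by which `align` changes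
    -- generators.
    bézout-det : ∀ {r s} (b : Bézout S r s) → let open Bézout b in ¬ d ≈ 0# → κ * α + μ * β ≈ 1#
    bézout-det {r} {s} b d≉0 = begin
      κ * α + μ * β                      ≈⟨ solve 1 (λ x → x := (x :- con 1ℤ) :+ con 1ℤ) refl _ ⟩
      (κ * α + μ * β - 1#) + 1#          ≈⟨ +-congʳ (*-cancelˡ-0 d≉0 (begin
        d * (κ * α + μ * β - 1#)           ≈⟨ solve 5 (λ d κ α μ β → d :* (κ :* α :+ μ :* β :- con 1ℤ) :=
                                                (κ :* (α :* d) :+ μ :* (β :* d)) :- d) refl d κ α μ β ⟩
        κ * (α * d) + μ * (β * d) - d      ≈⟨ +-congʳ (+-cong (*-congˡ r≈αd) (*-congˡ s≈βd)) ⟨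
        κ * r + μ * s - d                  ≈⟨ +-congʳ d≈ ⟨
        d - d                              ≈⟨ -‿inverseʳ d ⟩
        0#                                 ∎)) ⟩
      0# + 1#                            ≈⟨ +-identityˡ 1# ⟩
      1#                                 ∎
      where
      open Bézout b
      open SetoidReasoning setoid

    -- Bézout's identity completes the coordinates of x, divided by their gcd,
    -- to a unimodular change of generators.
    align : ∀ {n} w (ws : List (V n)) {x} → Comb S (w ∷ ws) x →
            ∃₂ λ u us → length us ≡ length ws × All (Comb S (u ∷ us)) (w ∷ ws) × All (Comb S (w ∷ ws)) (u ∷ us) ×
            ∃ λ d → d ∈ S × (∀ i → x i ≈ d * u i)
    align w [] (cons a y a∈ (nil y≈0) x≈) = w , [] , ≡.refl , combs-refl isSubring _ , combs-refl isSubring _ ,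
      a , a∈ , λ i → trans (x≈ i) (trans (+-congˡ (y≈0 i)) (+-identityʳ _))
    align w (w′ ∷ ws) {x} (cons a y a∈ y∈ x≈) with align w′ ws y∈
    ... | u′ , us , |us| , ws⊑u′ , u′⊑ws , d′ , d′∈ , y≈ with bézout a∈ d′∈
    ...   | b with zero? (Bézout.d b)
    ...     | yes d≈0 = w , w′ ∷ ws , ≡.refl , combs-refl isSubring _ , combs-refl isSubring _ , 0# , 0∈ , λ i →
      let open Bézout b in trans (x≈ i) (trans
        (+-cong (*-congʳ (trans r≈αd (trans (*-congˡ d≈0) (zeroʳ α))))
                (trans (y≈ i) (*-congʳ (trans s≈βd (trans (*-congˡ d≈0) (zeroʳ β))))))
        (solve 2 (λ w u → con 0ℤ :* w :+ con 0ℤ :* u := con 0ℤ :* w) refl (w i) (u′ i)))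
    ...     | no d≉0 = u , v ∷ us , ≡.cong suc |us| ,
      comb-lin isSubring κ∈ (-∈ β∈) u∈ v∈ (λ i → sym (w≈ i)) ∷ All.map (comb-trans isSubring (u′∈ ∷ us∈)) ws⊑u′ ,
      comb-lin isSubring α∈ β∈ (comb-head isSubring) (comb-weaken isSubring (All.head u′⊑ws)) (λ _ → refl) ∷
      comb-lin isSubring (-∈ μ∈) κ∈ (comb-head isSubring) (comb-weaken isSubring (All.head u′⊑ws)) (λ _ → refl) ∷
      All.map (comb-weaken isSubring) (All.tail u′⊑ws) ,
      d , IsSubring.respects isSubring (sym d≈) (+∈ (*∈ κ∈ a∈) (*∈ μ∈ d′∈)) , λ i → trans (x≈ i) (trans
        (+-cong (*-congʳ r≈αd) (trans (y≈ i) (*-congʳ s≈βd)))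
        (solve 5 (λ α d w β u′ → α :* d :* w :+ β :* d :* u′ := d :* (α :* w :+ β :* u′)) refl α d (w i) β (u′ i)))
      where
      open Bézout b
      u v : V _
      u i = α * w i + β * u′ i
      v i = - μ * w i + κ * u′ i
      det : κ * α + μ * β ≈ 1#
      det = bézout-det b d≉0
      u∈ : Comb S (u ∷ v ∷ us) u
      u∈ = comb-head isSubring
      v∈ : Comb S (u ∷ v ∷ us) v
      v∈ = comb-weaken isSubring (comb-head isSubring)
      us∈ : All (Comb S (u ∷ v ∷ us)) us
      us∈ = All.map (comb-weaken isSubring ∘ comb-weaken isSubring) (combs-refl isSubring us)
      w≈ : ∀ i → κ * u i + - β * v i ≈ w i
      w≈ i = trans (solve 6 (λ α β κ μ w u′ → κ :* (α :* w :+ β :* u′) :+ (:- β) :* ((:- μ) :* w :+ κ :* u′) :=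
        (κ :* α :+ μ :* β) :* w) refl α β κ μ (w i) (u′ i)) (trans (*-congʳ det) (*-identityˡ _))
      u′∈ : Comb S (u ∷ v ∷ us) u′
      u′∈ = comb-lin isSubring μ∈ α∈ u∈ v∈ λ i → sym (trans
        (solve 6 (λ α β κ μ w u′ → μ :* (α :* w :+ β :* u′) :+ α :* ((:- μ) :* w :+ κ :* u′) :=
          (κ :* α :+ μ :* β) :* u′) refl α β κ μ (w i) (u′ i)) (trans (*-congʳ det) (*-identityˡ _)))

    -- If the span contains a nonzero vector of `W`, `align` makes it a multiple `d u` of a first
    -- generator `u`, and `u` lies in `W` by division. Subtracting a multiple of `u` keeps a vector
    -- in `W` and brings it into the span of `us`, where the recursion applies. Otherwise `es` is
    -- empty. Which case holds is settled by `lem`.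
    split : ∀ {n} {W : Pred (V n) ℓ} → IsLinear W → ∀ k (ws : List (V n)) → length ws ≡ k →
            ∃₂ λ es fs → length (es ++ fs) ≡ length ws × All (Comb S (es ++ fs)) ws × All (Comb S ws) (es ++ fs) ×
            All W es × (∀ {x} → x ∈ W → Comb S ws x → Comb S es x)
    split linW k [] _ = [] , [] , ≡.refl , [] , [] , [] , λ _ x∈ → x∈
    split {W = W} linW (suc k) (w ∷ ws) |ws| with lem (∃ λ x → x ∈ W × Comb S (w ∷ ws) x × ¬ (∀ i → x i ≈ 0#))
    ... | no none = [] , w ∷ ws , ≡.refl , combs-refl isSubring _ , combs-refl isSubring _ , [] ,
      λ {x} x∈W x∈ → nil (all-zero λ x≉0 → none (x , x∈W , x∈ , x≉0))
    ... | yes (x , x∈W , x∈ , x≉0) with align w ws x∈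
    ...   | u , us , |us| , ws⊑u , u⊑ws , d , d∈ , x≈ with split linW k us (≡.trans |us| (ℕ.suc-injective |ws|))
    ...     | es , fs , |es++fs| , us⊑es , es⊑us , es∈W , gen = u ∷ es , fs , ≡.cong suc (≡.trans |es++fs| |us|) ,
      All.map (comb-trans isSubring (comb-head isSubring ∷ All.map (comb-weaken isSubring) us⊑es)) ws⊑u ,
      All.head u⊑ws ∷ All.map (comb-trans isSubring (All.tail u⊑ws)) es⊑us ,
      u∈W ∷ es∈W ,
      λ y∈W y∈ → generate y∈W (comb-trans isSubring ws⊑u y∈)
      where
      d≉0 : ¬ d ≈ 0#
      d≉0 d≈0 = x≉0 λ i → trans (x≈ i) (trans (*-congʳ d≈0) (zeroˡ _))
      u∈W : u ∈ W
      u∈W = unscale linW d≉0 x≈ x∈W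
      generate : ∀ {y} → y ∈ W → Comb S (u ∷ us) y → Comb S (u ∷ es) y
      generate y∈W (cons a z a∈ z∈ y≈) = cons a z a∈ (gen (IsLinear.lin∈ linW (- a) u∈W y∈W λ i →
        trans (solve 3 (λ a u z → z := (:- a) :* u :+ (a :* u :+ z)) refl a (u i) (z i)) (+-congˡ (sym (y≈ i)))) z∈) y≈

    ⋀-mono : (∀ {δ} → δ ∈ S → ¬ δ ≈ 0# → 1ℚ ℚ.≤ abs δ) →
             ∀ {n} {xs ys : List (V n)} → Indep {0ℓ} U xs → All (Comb S ys) xs → length xs ≡ length ys →
             ‖⋀ ys ‖ ℚ.≤ ‖⋀ xs ‖
    ⋀-mono 1≤ indx xs⊑ys |xs|≡|ys| with ⋀ₗ-multiple isSubring xs⊑ys |xs|≡|ys|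
    ... | δ , δ∈ , ⋀≈ = ‖‖-scale-≥ δ ⋀≈ (1≤ δ∈ λ δ≈0 →
      indepU⇒⋀ₗ-nonzero indx λ I → trans (⋀≈ I) (trans (*-congʳ δ≈0) (zeroˡ _)))

    toU : ∀ {n} {ws : List (V n)} {x} → Comb S ws x → Comb {0ℓ} U ws x
    toU = comb-mono _

    module InLattice {n} {Δ : Pred (V n) ℓ} (bs : List (V n)) (indb : Indep {0ℓ} U bs)
                     (Δ⊆ : ∀ {x} → x ∈ Δ → Comb S bs x) (⊆Δ : ∀ {x} → Comb S bs x → x ∈ Δ) where

      -- A basis of `W ∩ Δ`, with no claim that it spans `W` over the field. That other half of
      -- rationality is `SpannedBy`.
      record IsBasisOf (W : Pred (V n) ℓ) (ws : List (V n)) : Set ℓ where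
        field
          indep     : Indep {0ℓ} U ws
          ws⊆W      : All W ws
          ws⊆Δ      : All Δ ws
          generates : ∀ {x} → x ∈ W → x ∈ Δ → Comb S ws x

        comb∈Δ : ∀ {x} → Comb S ws x → x ∈ Δ
        comb∈Δ x∈ = ⊆Δ (comb-trans isSubring (All.map Δ⊆ ws⊆Δ) x∈)

      SpannedBy : Pred (V n) ℓ → List (V n) → Set ℓ
      SpannedBy W ws = ∀ {x} → x ∈ W → Comb {0ℓ} U ws x

      -- Splitting the basis `bs` of Δ along `W` keeps the number of vectors, hence independence. It
      -- works for every subspace, so the rationality of an intersection or a sum becomes purely a
      -- question of spanning.
      basis-exists : ∀ {W} → IsLinear W → ∃ (IsBasisOf W)
      basis-exists linW with split linW _ bs ≡.refl
      ... | es , fs , |es++fs| , bs⊑ , ⊑bs , es∈W , gen = es , record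
        { indep     = indep-++ˡ U-subring es (indep-transfer (≡.sym |es++fs|) indb (All.map toU bs⊑))
        ; ws⊆W      = es∈W
        ; ws⊆Δ      = All.map ⊆Δ (All.++⁻ˡ es ⊑bs)
        ; generates = λ x∈W x∈Δ → gen x∈W (Δ⊆ x∈Δ)
        }

      record Extension (W : Pred (V n) ℓ) (as es : List (V n)) : Set ℓ where
        field
          fs     : List (V n)
          indep  : Indep {0ℓ} U (es ++ fs)
          fs⊆W   : All W fs
          fs⊆Δ   : All Δ fs
          as⊑    : All (Comb S (es ++ fs)) as
          length≡ : length as ≡ length (es ++ fs)

      -- Splitting `as` along `P` produces some basis `es₂` of `P ∩ Δ`, not the prescribed `es`. The
      -- two generate each other over `S` and have equal length, so `es` can take the place of
      -- `es₂`. In this way the same `es` is extended both in L and in M.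
      extend : ∀ {W P as es} → IsLinear W → IsLinear P → P ⊆ W → IsBasisOf W as → IsBasisOf P es → Extension W as es
      extend {W} {P} {as} {es} linW linP P⊆W basisW basisP with split linP _ as ≡.refl
      ... | es₂ , fs , |es₂++fs| , as⊑ , ⊑as , es₂∈P , gen = record
        { fs      = fs
        ; indep   = indep-transfer length≡ W.indep (All.map toU as⊑′)
        ; fs⊆W    = All.map (IsLinear.comb⊆ linW W.ws⊆W) (All.++⁻ʳ es₂ ⊑as)
        ; fs⊆Δ    = All.map W.comb∈Δ (All.++⁻ʳ es₂ ⊑as)
        ; as⊑     = as⊑′
        ; length≡ = length≡
        }
        where
        module W = IsBasisOf basisW
        module P = IsBasisOf basisP
        es₂⊑es : All (Comb S es) es₂
        es₂⊑es = All.zipWith (λ { (∈P , ∈as) → P.generates ∈P (W.comb∈Δ ∈as) }) (es₂∈P , All.++⁻ˡ es₂ ⊑as)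
        es⊑es₂ : All (Comb S es₂) es
        es⊑es₂ = All.zipWith (λ { (∈P , ∈Δ) → gen ∈P (W.generates (P⊆W ∈P) ∈Δ) }) (P.ws⊆W , P.ws⊆Δ)
        as⊑′ : All (Comb S (es ++ fs)) as
        as⊑′ = All.map (comb-trans isSubring (All.++⁺ (All.map (comb-++ˡ isSubring) es₂⊑es)
          (All.map (comb-++ʳ isSubring es) (combs-refl isSubring fs)))) as⊑
        indep₂ : Indep {0ℓ} U (es₂ ++ fs)
        indep₂ = indep-transfer (≡.sym |es₂++fs|) W.indep (All.map toU as⊑)
        |es₂|≡|es| : length es₂ ≡ length es
        |es₂|≡|es| = ℕ.≤-antisym (indep-length (indep-++ˡ U-subring es₂ indep₂) (All.map toU es₂⊑es))
                                 (indep-length P.indep (All.map toU es⊑es₂))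
        length≡ : length as ≡ length (es ++ fs)
        length≡ = ≡.trans (≡.sym |es₂++fs|) (≡.trans (List.length-++ es₂)
          (≡.trans (≡.cong (ℕ._+ length fs) |es₂|≡|es|) (≡.sym (List.length-++ es))))

      module RationalPair {L M : Pred (V n) ℓ} (linL : IsLinear L) (linM : IsLinear M) {as cs : List (V n)}
                          (basisL : IsBasisOf L as) (basisM : IsBasisOf M cs)
                          (spanL : SpannedBy L as) (spanM : SpannedBy M cs) {es : List (V n)} (basis∩ : IsBasisOf (L ∩ M) es) where

        private
          module L = IsBasisOf basisL
          module M = IsBasisOf basisM
          module E = IsBasisOf basis∩
          lin∩ = ∩-linear linL linM
          module F = Extension (extend linL lin∩ proj₁ basisL basis∩)
          module G = Extension (extend linM lin∩ proj₂ basisM basis∩)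
          fs = F.fs
          gs = G.fs

        -- Over S the families meet trivially, since a common combination lies in
        -- (L ∩ M) ∩ Δ; independence over S of vectors of Δ is independence over K.
        indep-es-fs-gs : Indep {0ℓ} U ((es ++ fs) ++ gs)
        indep-es-fs-gs = indep-over-field isSubring indb
          (All.++⁺ (All.++⁺ (All.map Δ⊆ E.ws⊆Δ) (All.map Δ⊆ F.fs⊆Δ)) (All.map Δ⊆ G.fs⊆Δ))
          (indep-++⁺ isSubring (es ++ fs) (indep-mono _ F.indep) (indep-mono _ (indep-++ʳ es G.indep))
            λ z∈ef z∈g → indep-++-disjoint isSubring es (indep-mono {T = U} _ G.indep)
              (E.generates (IsLinear.comb⊆ linL (All.++⁺ (All.map proj₁ E.ws⊆W) F.fs⊆W) z∈ef ,
                            IsLinear.comb⊆ linM G.fs⊆W z∈g)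
                           (⊆Δ (comb-trans isSubring (All.map Δ⊆ G.fs⊆Δ) z∈g)))
              z∈g)

        -- As an element of M, the vector is a combination of `es` and `gs`; as an element of L, one
        -- of `es` and `fs`. Its part along `gs` is therefore also in the span of `es ++ fs`, and
        -- `indep-es-fs-gs` forces it to be 0.
        ∩-spanned : SpannedBy (L ∩ M) es
        ∩-spanned (x∈L , x∈M) with comb-++⁻ U-subring es (comb-trans U-subring (All.map toU G.as⊑) (spanM x∈M))
        ... | y , z , y∈ , z∈ , x≈ = comb-resp (λ i → sym (trans (x≈ i) (trans (+-congˡ (z≈0 i)) (+-identityʳ _)))) y∈
          where
          z≈0 : ∀ i → z i ≈ 0#
          z≈0 = indep-++-disjoint U-subring (es ++ fs) indep-es-fs-gs
            (comb-shift U-subring {a = - 1#} _ (comb-++ˡ U-subring y∈) (comb-trans U-subring (All.map toU F.as⊑) (spanL x∈L))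
              λ i → sym (trans (+-congˡ (x≈ i)) (solve 2 (λ y z → (:- con 1ℤ) :* y :+ (y :+ z) := z) refl (y i) (z i))))
            z∈

        module _ {hs} (basis+ : IsBasisOf (Sum L M) hs) where

          private module H = IsBasisOf basis+

          efg⊑hs : All (Comb S hs) ((es ++ fs) ++ gs)
          efg⊑hs = All.++⁺ (All.++⁺ (All.zipWith (λ { ((∈L , _) , ∈Δ) → fromL ∈L ∈Δ }) (E.ws⊆W , E.ws⊆Δ))
                                     (All.zipWith (λ { (∈L , ∈Δ) → fromL ∈L ∈Δ }) (F.fs⊆W , F.fs⊆Δ)))
                           (All.zipWith (λ { (∈M , ∈Δ) → H.generates (_ , _ , IsLinear.0∈ linL (λ _ → refl) , ∈M ,
                              λ i → sym (+-identityˡ _)) ∈Δ }) (G.fs⊆W , G.fs⊆Δ))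
            where
            fromL : ∀ {x} → x ∈ L → x ∈ Δ → Comb S hs x
            fromL ∈L ∈Δ = H.generates (_ , _ , ∈L , IsLinear.0∈ linM (λ _ → refl) , λ i → sym (+-identityʳ _)) ∈Δ

          sum-spanned : SpannedBy (Sum L M) ((es ++ fs) ++ gs)
          sum-spanned (u , v , u∈L , v∈M , x≈) = comb-shift U-subring {a = 1#} _
            (comb-++ˡ U-subring (comb-trans U-subring (All.map toU F.as⊑) (spanL u∈L)))
            (comb-trans U-subring (All.++⁺ (All.map (comb-++ˡ U-subring ∘ comb-++ˡ U-subring) (combs-refl U-subring es))
              (All.map (comb-++ʳ U-subring (es ++ fs)) (combs-refl U-subring gs)))
              (comb-trans U-subring (All.map toU G.as⊑) (spanM v∈M)))
            λ i → trans (x≈ i) (+-congʳ (sym (*-identityˡ _)))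

          +-spanned : SpannedBy (Sum L M) hs
          +-spanned x∈ = comb-trans U-subring (All.map toU efg⊑hs) (sum-spanned x∈)

          -- Over `S` only the containment `efg⊑hs` is available, and it may be proper; over the
          -- field each of the two independent families spans the other.
          |efg|≡|hs| : length ((es ++ fs) ++ gs) ≡ length hs
          |efg|≡|hs| = ℕ.≤-antisym (indep-length indep-es-fs-gs (All.map toU efg⊑hs))
                                   (indep-length H.indep (All.map sum-spanned H.ws⊆W))

          lengths : length as ℕ.+ length cs ≡ length es ℕ.+ length hs
          lengths = begin
            length as ℕ.+ length cs                                          ≡⟨ ≡.cong₂ ℕ._+_ F.length≡ G.length≡ ⟩
            length (es ++ fs) ℕ.+ length (es ++ gs)                          ≡⟨ ≡.cong (length (es ++ fs) ℕ.+_) (List.length-++ es) ⟩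
            length (es ++ fs) ℕ.+ (length es ℕ.+ length gs)                  ≡⟨ ℕ.+-assoc (length (es ++ fs)) _ _ ⟨
            length (es ++ fs) ℕ.+ length es ℕ.+ length gs                    ≡⟨ ≡.cong (ℕ._+ length gs) (ℕ.+-comm (length (es ++ fs)) _) ⟩
            length es ℕ.+ length (es ++ fs) ℕ.+ length gs                    ≡⟨ ℕ.+-assoc (length es) _ _ ⟩
            length es ℕ.+ (length (es ++ fs) ℕ.+ length gs)                  ≡⟨ ≡.cong (length es ℕ.+_) (List.length-++ (es ++ fs)) ⟨
            length es ℕ.+ length ((es ++ fs) ++ gs)                          ≡⟨ ≡.cong (length es ℕ.+_) |efg|≡|hs| ⟩
            length es ℕ.+ length hs                                          ∎
            where open ≡.≡-Reasoning

          ⋀-submodular : (∀ {δ} → δ ∈ S → ¬ δ ≈ 0# → 1ℚ ℚ.≤ abs δ) →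
                         ‖⋀ es ‖ ℚ.* ‖⋀ hs ‖ ℚ.≤ ‖⋀ as ‖ ℚ.* ‖⋀ cs ‖
          ⋀-submodular 1≤ = begin
            ‖⋀ es ‖ ℚ.* ‖⋀ hs ‖                     ≤⟨ ℚ.*-monoˡ-≤-nonNeg ‖⋀ es ‖ {{ℚ.nonNegative (‖‖-nonNeg (⋀ₗ es))}}
                                                         (⋀-mono 1≤ indep-es-fs-gs efg⊑hs |efg|≡|hs|) ⟩
            ‖⋀ es ‖ ℚ.* ‖⋀ (es ++ fs) ++ gs ‖       ≡⟨ ≡.cong (λ ws → ‖⋀ es ‖ ℚ.* ‖⋀ ws ‖) (List.++-assoc es fs gs) ⟩
            ‖⋀ es ‖ ℚ.* ‖⋀ es ++ fs ++ gs ‖         ≤⟨ ‖⋀‖-submodular _ es fs gs ≡.refl ⟩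
            ‖⋀ es ++ fs ‖ ℚ.* ‖⋀ es ++ gs ‖         ≤⟨ *-mono-≤ (‖‖-nonNeg (⋀ₗ (es ++ gs))) (‖‖-nonNeg (⋀ₗ as))
                                                         (⋀-mono 1≤ L.indep F.as⊑ F.length≡)
                                                         (⋀-mono 1≤ M.indep G.as⊑ G.length≡) ⟩
            ‖⋀ as ‖ ℚ.* ‖⋀ cs ‖                     ∎
            where open ℚ.≤-Reasoning

-- Integer powers of a positive integer as rational numbers.

module IntegerPowers (q : ℕ) .{{q≢0 : NonZero q}} where

  open ℚ-Lemmas

  private
    /-unnormalised : ∀ i m .{{_ : NonZero m}} → ℚ.toℚᵘ (i ℚ./ m) ℚᵘ.≃ (i ℚᵘ./ m)
    /-unnormalised i (suc m) = ℚ.toℚᵘ-fromℚᵘ (ℚᵘ.mkℚᵘ i m)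

    -- Unnormalised fractions multiply without cancellation of common factors, so the identity holds
    -- there by computation and is carried back.
    /-* : ∀ i j m n .{{m≢0 : NonZero m}} .{{n≢0 : NonZero n}} .{{mn≢0 : NonZero (m ℕ.* n)}} →
          (i ℚ./ m) ℚ.* (j ℚ./ n) ≡ (i ℤ.* j) ℚ./ (m ℕ.* n)
    /-* i j m@(suc _) n@(suc _) = ℚ.toℚᵘ-injective (begin
      ℚ.toℚᵘ ((i ℚ./ m) ℚ.* (j ℚ./ n))              ≈⟨ ℚ.toℚᵘ-homo-* (i ℚ./ m) (j ℚ./ n) ⟩
      ℚ.toℚᵘ (i ℚ./ m) ℚᵘ.* ℚ.toℚᵘ (j ℚ./ n)        ≈⟨ ℚᵘ.*-cong (/-unnormalised i m) (/-unnormalised j n) ⟩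
      (i ℚᵘ./ m) ℚᵘ.* (j ℚᵘ./ n)                     ≈⟨ /-unnormalised (i ℤ.* j) (m ℕ.* n) ⟨
      ℚ.toℚᵘ ((i ℤ.* j) ℚ./ (m ℕ.* n))               ∎)
      where open SetoidReasoning ℚᵘ.≃-setoid

    /-self : ∀ m .{{_ : NonZero m}} → + m ℚ./ m ≡ 1ℚ
    /-self m@(suc _) = ℚ.toℚᵘ-injective (ℚᵘ.≃-trans (/-unnormalised (+ m) m)
      (ℚᵘ.*≡* (≡.trans (ℤ.*-identityʳ (+ m)) (≡.sym (ℤ.*-identityˡ (+ m))))))

    power reciprocal : ℕ → ℚ
    power k      = + (q ℕ.^ k) ℚ./ 1
    reciprocal k = ℚ._/_ 1ℤ (q ℕ.^ k) {{ℕ.m^n≢0 q k}}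

    power-+ : ∀ k l → power (k ℕ.+ l) ≡ power k ℚ.* power l
    power-+ k l = ≡.sym (≡.trans (/-* (+ (q ℕ.^ k)) (+ (q ℕ.^ l)) 1 1) (≡.cong (ℚ._/ 1)
      (≡.trans (≡.sym (ℤ.pos-* (q ℕ.^ k) (q ℕ.^ l))) (≡.cong +_ (≡.sym (ℕ.^-distribˡ-+-* q k l))))))

    reciprocal-cong : ∀ {m n} .(m≢0 : NonZero m) .(n≢0 : NonZero n) → m ≡ n →
                      ℚ._/_ 1ℤ m {{m≢0}} ≡ ℚ._/_ 1ℤ n {{n≢0}}
    reciprocal-cong _ _ ≡.refl = ≡.refl

    reciprocal-+ : ∀ k l → reciprocal (k ℕ.+ l) ≡ reciprocal k ℚ.* reciprocal l
    reciprocal-+ k l = ≡.sym (≡.trans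
      (/-* 1ℤ 1ℤ (q ℕ.^ k) (q ℕ.^ l) {{ℕ.m^n≢0 q k}} {{ℕ.m^n≢0 q l}} {{kl≢0}})
      (reciprocal-cong kl≢0 (ℕ.m^n≢0 q (k ℕ.+ l)) (≡.sym (ℕ.^-distribˡ-+-* q k l))))
      where
      kl≢0 : NonZero (q ℕ.^ k ℕ.* q ℕ.^ l)
      kl≢0 = ℕ.m*n≢0 _ _ {{ℕ.m^n≢0 q k}} {{ℕ.m^n≢0 q l}}

    power-reciprocal : ∀ k → power k ℚ.* reciprocal k ≡ 1ℚ
    power-reciprocal k = ≡.trans (/-* (+ (q ℕ.^ k)) 1ℤ 1 (q ℕ.^ k) {{_}} {{ℕ.m^n≢0 q k}} {{1k≢0}})
      (≡.trans (same {{1k≢0}} (≡.sym (ℕ.*-identityˡ (q ℕ.^ k)))) (/-self (q ℕ.^ k) {{ℕ.m^n≢0 q k}}))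
      where
      1k≢0 : NonZero (1 ℕ.* q ℕ.^ k)
      1k≢0 = ℕ.m*n≢0 1 _ {{_}} {{ℕ.m^n≢0 q k}}
      same : ∀ {m} .{{m≢0 : NonZero m}} → q ℕ.^ k ≡ m →
             (+ (q ℕ.^ k) ℤ.* 1ℤ) ℚ./ m ≡ ℚ._/_ (+ (q ℕ.^ k)) (q ℕ.^ k) {{ℕ.m^n≢0 q k}}
      same ≡.refl = ≡.cong (λ i → ℚ._/_ i (q ℕ.^ k) {{ℕ.m^n≢0 q k}}) (ℤ.*-identityʳ (+ (q ℕ.^ k)))

    ⊖-power : ∀ m n → q ^ᶻ (m ℤ.⊖ n) ≡ power m ℚ.* reciprocal n
    ⊖-power m       zero    = ≡.sym (ℚ.*-identityʳ (power m))
    ⊖-power zero    (suc n) = ≡.sym (ℚ.*-identityˡ (reciprocal (suc n)))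
    ⊖-power (suc m) (suc n) = begin
      q ^ᶻ (suc m ℤ.⊖ suc n)                                       ≡⟨ ≡.cong (q ^ᶻ_) (ℤ.[1+m]⊖[1+n]≡m⊖n m n) ⟩
      q ^ᶻ (m ℤ.⊖ n)                                               ≡⟨ ⊖-power m n ⟩
      power m ℚ.* reciprocal n                                     ≡⟨ ℚ.*-identityˡ _ ⟨
      1ℚ ℚ.* (power m ℚ.* reciprocal n)                            ≡⟨ ≡.cong (ℚ._* (power m ℚ.* reciprocal n)) (power-reciprocal 1) ⟨
      (power 1 ℚ.* reciprocal 1) ℚ.* (power m ℚ.* reciprocal n)    ≡⟨ interchange (power 1) (reciprocal 1) (power m) (reciprocal n) ⟩
      (power 1 ℚ.* power m) ℚ.* (reciprocal 1 ℚ.* reciprocal n)    ≡⟨ ≡.cong₂ ℚ._*_ (power-+ 1 m) (reciprocal-+ 1 n) ⟨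
      power (suc m) ℚ.* reciprocal (suc n)                         ∎
      where open ≡.≡-Reasoning

  ^ᶻ-+ : ∀ i j → q ^ᶻ (i ℤ.+ j) ≡ (q ^ᶻ i) ℚ.* (q ^ᶻ j)
  ^ᶻ-+ (+ m)    (+ n)    = power-+ m n
  ^ᶻ-+ (+ m)    -[1+ n ] = ⊖-power m (suc n)
  ^ᶻ-+ -[1+ m ] (+ n)    = ≡.trans (⊖-power n (suc m)) (ℚ.*-comm (power n) (reciprocal (suc m)))
  ^ᶻ-+ -[1+ m ] -[1+ n ] = ≡.trans (≡.cong reciprocal (≡.cong suc (≡.sym (ℕ.+-suc m n)))) (reciprocal-+ (suc m) (suc n))

  ^ᶻ-nonNeg : ∀ i → 0ℚ ℚ.≤ q ^ᶻ i
  ^ᶻ-nonNeg (+ n)    = ℚ.nonNegative⁻¹ (power n) {{ℚ.normalize-nonNeg (q ℕ.^ n) 1}}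
  ^ᶻ-nonNeg -[1+ n ] = ℚ.nonNegative⁻¹ (reciprocal (suc n)) {{ℚ.normalize-nonNeg 1 (q ℕ.^ suc n) {{ℕ.m^n≢0 q (suc n)}}}}

  1≤^ᶻ : ∀ {i} → 0ℤ ℤ.≤ i → 1ℚ ℚ.≤ q ^ᶻ i
  1≤^ᶻ {+ n} _ = ℚ.toℚᵘ-cancel-≤ (ℚᵘ.≤-respʳ-≃ (ℚᵘ.≃-sym (/-unnormalised (+ (q ℕ.^ n)) 1))
    (ℚᵘ.*≤* (≡.subst (ℤ._≤ + (q ℕ.^ n) ℤ.* 1ℤ) ≡.refl
      (≡.subst (1ℤ ℤ.≤_) (≡.sym (ℤ.*-identityʳ (+ (q ℕ.^ n)))) (ℤ.+≤+ (ℕ.>-nonZero⁻¹ _ {{ℕ.m^n≢0 q n}}))))))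

  ^ᶻ-mono : ∀ {i j} → i ℤ.≤ j → q ^ᶻ i ℚ.≤ q ^ᶻ j
  ^ᶻ-mono {i} {j} i≤j = begin
    q ^ᶻ i                             ≡⟨ ℚ.*-identityʳ _ ⟨
    (q ^ᶻ i) ℚ.* 1ℚ                    ≤⟨ ℚ.*-monoˡ-≤-nonNeg (q ^ᶻ i) {{ℚ.nonNegative (^ᶻ-nonNeg i)}} (1≤^ᶻ (ℤ.i≤j⇒0≤j-i i≤j)) ⟩
    (q ^ᶻ i) ℚ.* (q ^ᶻ (j ℤ.- i))      ≡⟨ ^ᶻ-+ i (j ℤ.- i) ⟨
    q ^ᶻ (i ℤ.+ (j ℤ.- i))             ≡⟨ ≡.cong (q ^ᶻ_) (≡.trans (ℤ.+-comm i (j ℤ.- i)) (≡.trans (ℤ.+-assoc j (ℤ.- i) i)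
                                            (≡.trans (≡.cong (λ k → j ℤ.+ k) (ℤ.+-inverseˡ i)) (ℤ.+-identityʳ j)))) ⟩
    q ^ᶻ j                             ∎
    where open ℚ.≤-Reasoning

  ^ᶻ≢0 : ∀ i → ¬ q ^ᶻ i ≡ 0ℚ
  ^ᶻ≢0 i q^i≡0 with begin
    1ℚ                                 ≡⟨ ≡.cong (q ^ᶻ_) (ℤ.+-inverseʳ i) ⟨
    q ^ᶻ (i ℤ.- i)                     ≡⟨ ^ᶻ-+ i (ℤ.- i) ⟩
    (q ^ᶻ i) ℚ.* (q ^ᶻ (ℤ.- i))        ≡⟨ ≡.cong (ℚ._* (q ^ᶻ (ℤ.- i))) q^i≡0 ⟩
    0ℚ ℚ.* (q ^ᶻ (ℤ.- i))              ≡⟨ ℚ.*-zeroˡ (q ^ᶻ (ℤ.- i)) ⟩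
    0ℚ                                 ∎
    where open ≡.≡-Reasoning
  ... | ()

-- Discrete valuations and their valuation rings.

≤⁺-trans : ∀ {x y z} → x ≤⁺ y → y ≤⁺ z → x ≤⁺ z
≤⁺-trans = ≤⁺.≤⁺-trans ℤ.≤-trans

≤⁺-reflexive : ∀ {x y} → x ≡ y → x ≤⁺ y
≤⁺-reflexive {[ k ]} ≡.refl = [ ℤ.≤-refl ]≤
≤⁺-reflexive {⊤⁺}    ≡.refl = ⊤⁺ ≤⊤⁺

+∞-mono : ∀ {k l x y} → [ k ] ≤⁺ x → [ l ] ≤⁺ y → [ k ℤ.+ l ] ≤⁺ x +∞ y
+∞-mono [ p ]≤     [ q ]≤     = [ ℤ.+-mono-≤ p q ]≤
+∞-mono [ p ]≤     (_ ≤⊤⁺)    = _ ≤⊤⁺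
+∞-mono (_ ≤⊤⁺) q          = _ ≤⊤⁺

module ValuationProperties {K : CommutativeRing c ℓ} (isField : IsField K) (v : DiscreteValuation K) where

  open CommutativeRing K hiding (zero)
  open IsField isField
  open DiscreteValuation v
  open ValuationRing v
  open Families K using (IsSubring)
  open RingProperties ring using (-1*x≈-x; -0#≈0#; -‿involutive)

  val-zero⇒ : ∀ {x} → val x ≡ ⊤⁺ → x ≈ 0#
  val-zero⇒ = Equivalence.to (val-zero _)

  zero? : ∀ x → Dec (x ≈ 0#)
  zero? x with val x in eq
  ... | ⊤⁺    = yes (val-zero⇒ eq)
  ... | [ k ] = no λ x≈0 → [k]≢⊤⁺ (≡.trans (≡.sym eq) (Equivalence.from (val-zero x) x≈0))
    where
    [k]≢⊤⁺ : ¬ [ k ] ≡ ⊤⁺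
    [k]≢⊤⁺ ()

  private
    double : ∀ k → k ℤ.+ k ≡ 0ℤ → k ≡ 0ℤ
    double (+ zero) _ = ≡.refl

    idempotent : ∀ k → k ≡ k ℤ.+ k → k ≡ 0ℤ
    idempotent k eq = ≡.trans (≡.sym (ℤ.+-identityʳ k)) (≡.trans (≡.cong (λ j → k ℤ.+ j) (≡.sym (ℤ.+-inverseʳ k)))
      (≡.trans (≡.sym (ℤ.+-assoc k k (ℤ.- k))) (≡.trans (≡.cong (ℤ._- k) (≡.sym eq)) (ℤ.+-inverseʳ k))))

    []-injective : ∀ {k l : ℤ} → [ k ] ≡ [ l ] → k ≡ l
    []-injective ≡.refl = ≡.refl

  val-1 : val 1# ≡ [ 0ℤ ]
  val-1 with val 1# in eq | val-* 1# 1#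
  ... | ⊤⁺    | _  = ⊥-elim (nontrivial (val-zero⇒ eq))
  ... | [ k ] | eq₂ = ≡.cong [_] (idempotent k ([]-injective (≡.trans (≡.sym eq)
          (≡.trans (≡.sym (val-cong (*-identityˡ 1#))) eq₂))))

  -- The square of -1 is 1, which has valuation 0, and twice an integer is 0 only for the integer 0.
  val-‿1 : val (- 1#) ≡ [ 0ℤ ]
  val-‿1 with val (- 1#) in eq | val-* (- 1#) (- 1#)
  ... | ⊤⁺    | _   = ⊥-elim (nontrivial (trans (sym (-‿involutive 1#)) (trans (-‿cong (val-zero⇒ eq)) -0#≈0#)))
  ... | [ k ] | eq₂ = ≡.cong [_] (double k ([]-injective (≡.trans (≡.sym eq₂)
          (≡.trans (val-cong (trans (-1*x≈-x (- 1#)) (-‿involutive 1#))) val-1))))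

  val-neg : ∀ x → val (- x) ≡ val x
  val-neg x = ≡.trans (val-cong (sym (-1*x≈-x x))) (≡.trans (val-* (- 1#) x)
    (≡.trans (≡.cong (_+∞ val x) val-‿1) (identityˡ (val x))))
    where
    identityˡ : ∀ k → [ 0ℤ ] +∞ k ≡ k
    identityˡ ⊤⁺    = ≡.refl
    identityˡ [ k ] = ≡.cong [_] (ℤ.+-identityˡ k)

  𝒪-subring : IsSubring 𝒪
  𝒪-subring = record
    { respects = λ x≈y x∈ → ≤⁺-trans x∈ (≤⁺-reflexive (val-cong x≈y))
    ; 0∈       = 0∈𝒪
    ; 1∈       = ≤⁺-reflexive (≡.sym val-1)
    ; +∈       = λ {x} {y} x∈ y∈ → Sum.[ ≤⁺-trans x∈ , ≤⁺-trans y∈ ]′ (val-+ x y)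
    ; *∈       = λ {x} {y} x∈ y∈ → ≤⁺-trans (+∞-mono x∈ y∈) (≤⁺-reflexive (≡.sym (val-* x y)))
    ; -∈       = λ {x} x∈ → ≤⁺-trans x∈ (≤⁺-reflexive (≡.sym (val-neg x)))
    }

-- The affine ring, the absolute value and the norm of the setting.

module SettingProperties {ℓ} (S : Setting ℓ) where

  open Setting S
  open Completion completion using (K̂-isField; embed-isHom)
  open CommutativeRing K̂ hiding (zero)
  open DiscreteValuation v̂ using () renaming (val to val̂)
  open RingMorphisms.IsRingHomomorphism embed-isHom
  private
    module K = CommutativeRing K
    module v̂ = DiscreteValuation v̂
  module V̂ = ValuationProperties K̂-isField v̂
  open IntegerPowers qν {{qν-nonZero}}
  open ExteriorAlgebra K̂ using (Exterior)
  open Families K̂ using (IsSubring; HomogeneousOf)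
  open PrincipalIdealDomain K̂ using (Bézout)
  open IntegerCoefficients K

  Rν-subring : Families.IsSubring K Rν
  Rν-subring = record
    { respects = λ x≈y x∈ w w≉ν → respects w x≈y (x∈ w w≉ν)
    ; 0∈       = λ w _ → 0∈ w
    ; 1∈       = λ w _ → 1∈ w
    ; +∈       = λ x∈ y∈ w w≉ν → +∈ w (x∈ w w≉ν) (y∈ w w≉ν)
    ; *∈       = λ x∈ y∈ w w≉ν → *∈ w (x∈ w w≉ν) (y∈ w w≉ν)
    ; -∈       = λ x∈ w w≉ν → -∈ w (x∈ w w≉ν)
    }
    where open module 𝒪 (w : Place) = Families.IsSubring (ValuationProperties.𝒪-subring K-isField w)

  private module Rν = Families.IsSubring Rν-subring

  embed∈ : ∀ {a} → a ∈ Rν → embed a ∈ R̂ν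
  embed∈ a∈ = _ , a∈ , refl

  R̂ν-subring : IsSubring R̂ν
  R̂ν-subring = record
    { respects = λ { x≈y (a , a∈ , eq) → a , a∈ , trans eq x≈y }
    ; 0∈       = K.0# , Rν.0∈ , 0#-homo
    ; 1∈       = K.1# , Rν.1∈ , 1#-homo
    ; +∈       = λ { (a , a∈ , eq) (b , b∈ , eq′) → a K.+ b , Rν.+∈ a∈ b∈ , trans (+-homo a b) (+-cong eq eq′) }
    ; *∈       = λ { (a , a∈ , eq) (b , b∈ , eq′) → a K.* b , Rν.*∈ a∈ b∈ , trans (*-homo a b) (*-cong eq eq′) }
    ; -∈       = λ { (a , a∈ , eq) → K.- a , Rν.-∈ a∈ , trans (-‿homo a) (-‿cong eq) }
    }

  -- The ideal {x ∈ Rν | x = 0 or A} is generated by a nonzero element iff A holds.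
  excludedMiddle : RνIsPID → (A : Set ℓ) → Dec A
  excludedMiddle pid A with pid (λ x → x ∈ Rν × (x K.≈ K.0# ⊎ A)) proj₁ record
    { respects = λ { x≈y (x∈ , h) → Rν.respects x≈y x∈ , Sum.map₁ (K.trans (K.sym x≈y)) h }
    ; 0ᴹ∈      = Rν.0∈ , inj₁ K.refl
    ; +ᴹ∈      = λ { (x∈ , h) (y∈ , h′) → Rν.+∈ x∈ y∈ , sum h h′ }
    ; *ₗ∈      = λ { r∈ (x∈ , h) → Rν.*∈ r∈ x∈ , Sum.map₁ (λ x≈0 → K.trans (K.*-congˡ x≈0) (K.zeroʳ _)) h }
    }
    where
    sum : ∀ {x y} → x K.≈ K.0# ⊎ A → y K.≈ K.0# ⊎ A → x K.+ y K.≈ K.0# ⊎ A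
    sum (inj₂ a) _        = inj₂ a
    sum (inj₁ _) (inj₂ a) = inj₂ a
    sum (inj₁ e) (inj₁ f) = inj₁ (K.trans (K.+-cong e f) (K.+-identityˡ K.0#))
  ... | d , (_ , inj₂ a) , _ = yes a
  ... | d , (_ , inj₁ d≈0) , generates = no λ a → let r , _ , 1≈rd = generates K.1# (Rν.1∈ , inj₂ a) in
    IsField.nontrivial K-isField (K.trans 1≈rd (K.trans (K.*-congˡ d≈0) (K.zeroʳ r)))

  -- The divisor is a generator of the ideal of all `κ a + μ b` in Rν. The identities hold in K and
  -- are transported along `embed`.
  bézout : RνIsPID → ∀ {r s} → r ∈ R̂ν → s ∈ R̂ν → Bézout R̂ν r s
  bézout pid {r} {s} (a , a∈ , a≈r) (b , b∈ , b≈s)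
    with pid (λ x → ∃₂ λ κ μ → κ ∈ Rν × μ ∈ Rν × x K.≈ κ K.* a K.+ μ K.* b)
             (λ { (κ , μ , κ∈ , μ∈ , x≈) → Rν.respects (K.sym x≈) (Rν.+∈ (Rν.*∈ κ∈ a∈) (Rν.*∈ μ∈ b∈)) }) record
    { respects = λ { x≈y (κ , μ , κ∈ , μ∈ , x≈) → κ , μ , κ∈ , μ∈ , K.trans (K.sym x≈y) x≈ }
    ; 0ᴹ∈      = K.0# , K.0# , Rν.0∈ , Rν.0∈ ,
        solve 2 (λ a b → con 0ℤ := con 0ℤ :* a :+ con 0ℤ :* b) K.refl a b
    ; +ᴹ∈      = λ { (κ , μ , κ∈ , μ∈ , x≈) (κ′ , μ′ , κ′∈ , μ′∈ , y≈) →
        κ K.+ κ′ , μ K.+ μ′ , Rν.+∈ κ∈ κ′∈ , Rν.+∈ μ∈ μ′∈ , K.trans (K.+-cong x≈ y≈)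
          (solve 6 (λ κ μ κ′ μ′ a b → (κ :* a :+ μ :* b) :+ (κ′ :* a :+ μ′ :* b) :=
            (κ :+ κ′) :* a :+ (μ :+ μ′) :* b) K.refl κ μ κ′ μ′ a b) }
    ; *ₗ∈      = λ { {t} t∈ (κ , μ , κ∈ , μ∈ , x≈) → t K.* κ , t K.* μ , Rν.*∈ t∈ κ∈ , Rν.*∈ t∈ μ∈ ,
        K.trans (K.*-congˡ x≈) (solve 5 (λ t κ μ a b → t :* (κ :* a :+ μ :* b) :=
          t :* κ :* a :+ t :* μ :* b) K.refl t κ μ a b) }
    }
  ... | d , (κ , μ , κ∈ , μ∈ , d≈) , generates
    with generates a (K.1# , K.0# , Rν.1∈ , Rν.0∈ , solve 2 (λ a b → a := con 1ℤ :* a :+ con 0ℤ :* b) K.refl a b)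
       | generates b (K.0# , K.1# , Rν.0∈ , Rν.1∈ , solve 2 (λ a b → b := con 0ℤ :* a :+ con 1ℤ :* b) K.refl a b)
  ... | α , α∈ , a≈αd | β , β∈ , b≈βd = record
    { d    = embed d
    ; α∈   = embed∈ α∈
    ; β∈   = embed∈ β∈
    ; κ∈   = embed∈ κ∈
    ; μ∈   = embed∈ μ∈
    ; r≈αd = trans (sym a≈r) (trans (⟦⟧-cong a≈αd) (*-homo α d))
    ; s≈βd = trans (sym b≈s) (trans (⟦⟧-cong b≈βd) (*-homo β d))
    ; d≈   = trans (⟦⟧-cong d≈) (trans (+-homo _ _)
               (+-cong (trans (*-homo κ a) (*-congˡ a≈r)) (trans (*-homo μ b) (*-congˡ b≈s))))
    }

  absVal-* : ∀ x y → absVal (x +∞ y) ≡ absVal x ℚ.* absVal y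
  absVal-* [ k ] [ l ] = ≡.trans (≡.cong (qν^_) (ℤ.neg-distrib-+ k l)) (^ᶻ-+ (ℤ.- k) (ℤ.- l))
    where
    qν^_ : ℤ → ℚ
    qν^ i = _^ᶻ_ qν {{qν-nonZero}} i
  absVal-* [ k ] ⊤⁺    = ≡.sym (ℚ.*-zeroʳ (absVal [ k ]))
  absVal-* ⊤⁺    y     = ≡.sym (ℚ.*-zeroˡ (absVal y))

  absVal-nonNeg : ∀ x → 0ℚ ℚ.≤ absVal x
  absVal-nonNeg [ k ] = ^ᶻ-nonNeg (ℤ.- k)
  absVal-nonNeg ⊤⁺    = ℚ.≤-refl

  absVal-anti : ∀ {x y} → x ≤⁺ y → absVal y ℚ.≤ absVal x
  absVal-anti [ k≤l ]≤  = ^ᶻ-mono (ℤ.neg-mono-≤ k≤l)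
  absVal-anti (k ≤⊤⁺) = absVal-nonNeg k

  absVal≡0 : ∀ x → absVal x ≡ 0ℚ → x ≡ ⊤⁺
  absVal≡0 [ k ] eq = ⊥-elim (^ᶻ≢0 (ℤ.- k) eq)
  absVal≡0 ⊤⁺    _  = ≡.refl

  abs-isAbsoluteValue : IsAbsoluteValue K̂ abs
  abs-isAbsoluteValue = record
    { abs-cong    = λ x≈y → ≡.cong absVal (v̂.val-cong x≈y)
    ; abs-nonNeg  = λ x → absVal-nonNeg (val̂ x)
    ; abs-0       = ≡.cong absVal (Equivalence.from (v̂.val-zero 0#) refl)
    ; abs≡0⇒≈0    = λ x eq → V̂.val-zero⇒ (absVal≡0 (val̂ x) eq)
    ; abs-1       = ≡.cong absVal V̂.val-1
    ; abs-neg     = λ x → ≡.cong absVal (V̂.val-neg x)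
    ; abs-*       = λ x y → ≡.trans (≡.cong absVal (v̂.val-* x y)) (absVal-* (val̂ x) (val̂ y))
    ; ultrametric = λ x y → Sum.[ (λ le → ℚ.≤-trans (absVal-anti le) (ℚ.p≤p⊔q (abs x) (abs y)))
                                , (λ le → ℚ.≤-trans (absVal-anti le) (ℚ.p≤q⊔p (abs x) (abs y))) ]′ (v̂.val-+ x y)
    }

  open ExteriorNorm K̂ K̂-isField abs abs-isAbsoluteValue using (‖_‖; coefficient-≤; ‖‖-lub; ‖‖-nonNeg)

  private
    ⨆ : List ℚ → ℚ
    ⨆ = List.foldr ℚ._⊔_ 0ℚ

    ⨆-lub : ∀ {xs B} → 0ℚ ℚ.≤ B → All (ℚ._≤ B) xs → ⨆ xs ℚ.≤ B
    ⨆-lub 0≤B []       = 0≤B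
    ⨆-lub 0≤B (p ∷ ps) = ℚ.⊔-lub p (⨆-lub 0≤B ps)

    0≤⨆ : ∀ xs → 0ℚ ℚ.≤ ⨆ xs
    0≤⨆ []       = ℚ.≤-refl
    0≤⨆ (x ∷ xs) = ℚ.≤-trans (0≤⨆ xs) (ℚ.p≤q⊔p x (⨆ xs))

    ≤⨆ : ∀ {x xs} → x ∈ₗ xs → x ℚ.≤ ⨆ xs
    ≤⨆ {xs = y ∷ xs} (here ≡.refl) = ℚ.p≤p⊔q y (⨆ xs)
    ≤⨆ {xs = y ∷ xs} (there x∈)    = ℚ.≤-trans (≤⨆ x∈) (ℚ.p≤q⊔p y (⨆ xs))

  ∈-subsets : ∀ {n} (I : Subset n) → I ∈ₗ subsets n
  ∈-subsets Vec.[]              = here ≡.refl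
  ∈-subsets (outside Vec.∷ I) = ∈-++⁺ˡ (∈-map⁺ (outside Vec.∷_) (∈-subsets I))
  ∈-subsets {suc n} (inside Vec.∷ I) = ∈-++⁺ʳ (List.map (outside Vec.∷_) (subsets n)) (∈-map⁺ (inside Vec.∷_) (∈-subsets I))

  norm≡‖‖ : ∀ {n} k {ω : Exterior n} → HomogeneousOf k ω → norm k ω ≡ ‖ ω ‖
  norm≡‖‖ {n} k {ω} hom = ℚ.≤-antisym
    (⨆-lub (‖‖-nonNeg ω) (All.map⁺ (All.universal (coefficient-≤ ω) (List.filter has-size? (subsets n)))))
    (‖‖-lub λ I → bound I)
    where
    has-size? : (I : Subset n) → Dec (∣ I ∣ ≡ k)
    has-size? I = ∣ I ∣ ℕ.≟ k
    bound : ∀ I → abs (ω I) ℚ.≤ norm k ω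
    bound I with has-size? I
    ... | yes |I|≡k = ≤⨆ (∈-map⁺ (abs ∘ ω) (∈-filter⁺ has-size? (∈-subsets I) |I|≡k))
    ... | no |I|≢k  = ℚ.≤-trans (ℚ.≤-reflexive (≡.cong absVal (Equivalence.from (v̂.val-zero (ω I)) (hom I |I|≢k))))
                                (0≤⨆ (List.map (abs ∘ ω) (List.filter has-size? (subsets n))))

-- Lattices and rational subspaces of the statement, and the inequality.

module LatticeProperties {ℓ} (S : Setting ℓ) (pid : Setting.RνIsPID S) (n : ℕ) .{{n≢0 : NonZero n}} where

  open Setting S
  open Lattices n
  open SettingProperties S
  open Completion completion using (K̂-isField)
  open CommutativeRing K̂ hiding (zero)
  open DiscreteValuation v̂ using (val-*; val-cong) renaming (val to val̂)
  open ExteriorAlgebra K̂ using (⋀)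
  open ExteriorProperties K̂ using (_≐_)
  open Families K̂
  open IntegerCoefficients K̂
  open RingProperties ring using (-0#≈0#)
  open PrincipalIdealDomain K̂
  open Lattice K̂-isField abs abs-isAbsoluteValue R̂ν-subring (bézout pid) (excludedMiddle pid)
  open ExteriorNorm K̂ K̂-isField abs abs-isAbsoluteValue using (‖⋀_‖; zero?)
  open Field K̂-isField zero?
  open IsField K̂-isField

  submodule-linear : ∀ {W : Pred Kⁿ ℓ} → IsSubspace W → IsLinear W
  submodule-linear subW = record
    { 0∈   = λ x≈0 → W.respects (λ i → sym (x≈0 i)) W.0ᴹ∈
    ; lin∈ = λ a x∈ y∈ z≈ → W.respects (λ i → sym (z≈ i)) (W.+ᴹ∈ (W.*ₗ∈ {a = a} _ x∈) y∈)
    }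
    where module W = IsSubmodule subW

  submodule-comb : ∀ {a t} {T : Pred Carrier t} {W : Pred Kⁿ a} → IsSubmodule T W →
                   ∀ {ws x} → All W ws → Comb T ws x → x ∈ W
  submodule-comb subW = comb-∈ W.respects W.0ᴹ∈ λ a∈ x∈ y∈ → W.+ᴹ∈ (W.*ₗ∈ a∈ x∈) y∈
    where module W = IsSubmodule subW

  linComb∈Comb : ∀ {t} {T : Pred Carrier t} {k} {a : Vector Carrier k} (w : Vector Kⁿ k) → (∀ i → a i ∈ T) →
                 Comb T (List.tabulate w) (linComb a w)
  linComb∈Comb {k = zero}  w a∈ = nil λ _ → refl
  linComb∈Comb {k = suc k} w a∈ = cons _ _ (a∈ zero) (linComb∈Comb (w ∘ suc) (a∈ ∘ suc)) λ _ → refl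

  comb⇒linComb : ∀ {t} {T : Pred Carrier t} {k} (w : Vector Kⁿ k) {x} → Comb T (List.tabulate w) x →
                 ∃ λ a → (∀ i → a i ∈ T) × x ≐ linComb a w
  comb⇒linComb {k = zero}  w (nil x≈0) = (λ ()) , (λ ()) , x≈0
  comb⇒linComb {k = suc k} w (cons a y a∈ y∈ x≈) with comb⇒linComb (w ∘ suc) y∈
  ... | b , b∈ , y≈ = (a Vector.∷ b) , (λ { zero → a∈ ; (suc i) → b∈ i }) , λ i → trans (x≈ i) (+-congˡ (y≈ i))

  independent⇒indep : ∀ {t} {T : Pred Carrier t} → 0# ∈ T → ∀ {k} (w : Vector Kⁿ k) →
                      Independent T w → Indep T (List.tabulate w)
  independent⇒indep 0∈ {zero}  w ind = []
  independent⇒indep {T = T} 0∈ {suc k} w ind = head ∷ independent⇒indep 0∈ (w ∘ suc) λ a a∈ eq i →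
      ind (0# Vector.∷ a) (λ { zero → 0∈ ; (suc j) → a∈ j })
        (λ j → trans (+-congʳ (zeroˡ _)) (trans (+-identityˡ _) (eq j))) (suc i)
    where
    head : ∀ a y → a ∈ T → Comb T (List.tabulate (w ∘ suc)) y → (∀ i → a * w zero i + y i ≈ 0#) → a ≈ 0#
    head a y a∈ y∈ eq with comb⇒linComb (w ∘ suc) y∈
    ... | b , b∈ , y≈ = ind (a Vector.∷ b) (λ { zero → a∈ ; (suc j) → b∈ j })
      (λ i → trans (+-congˡ (sym (y≈ i))) (eq i)) zero

  indep⇒independent : ∀ {t} {T : Pred Carrier t} {k} (w : Vector Kⁿ k) → Indep T (List.tabulate w) → Independent T w
  indep⇒independent {k = suc k} w (h ∷ ind) a a∈ eq zero = h (a zero) _ (a∈ zero) (linComb∈Comb (w ∘ suc) (a∈ ∘ suc)) eq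
  indep⇒independent {k = suc k} w (h ∷ ind) a a∈ eq (suc i) = indep⇒independent (w ∘ suc) ind (a ∘ suc) (a∈ ∘ suc)
    (λ j → trans (sym (trans (+-congʳ (trans (*-congʳ a₀≈0) (zeroˡ _))) (+-identityˡ _))) (eq j)) i
    where
    a₀≈0 : a zero ≈ 0#
    a₀≈0 = h (a zero) _ (a∈ zero) (linComb∈Comb (w ∘ suc) (a∈ ∘ suc)) eq

  ⋀-tabulate : ∀ {k} (w : Vector Kⁿ k) → ⋀ₗ (List.tabulate w) ≡ ⋀ w
  ⋀-tabulate {zero}  w = ≡.refl
  ⋀-tabulate {suc k} w = ≡.cong (ExteriorAlgebra._∧_ K̂ (w zero)) (⋀-tabulate (w ∘ suc))

  norm-basis : ∀ {k} (w : Vector Kⁿ k) → norm k (⋀ w) ≡ ‖⋀ List.tabulate w ‖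
  norm-basis {k} w = ≡.trans (≡.cong (norm k) (≡.sym (⋀-tabulate w)))
    (norm≡‖‖ k (≡.subst (λ m → HomogeneousOf m (⋀ₗ (List.tabulate w))) (List.length-tabulate w) (⋀ₗ-homogeneous (List.tabulate w))))

  span-comb : ∀ {a} {Λ : Pred Kⁿ a} {ws} → (∀ {x} → x ∈ Λ → Comb {0ℓ} U ws x) → ∀ {x} → Span U Λ x → Comb {0ℓ} U ws x
  span-comb Λ⊆ (k , a , w , _ , w∈ , x≈) = comb-resp (λ i → sym (x≈ i))
    (comb-trans U-subring (All.tabulate⁺ (λ i → Λ⊆ (w∈ i))) (linComb∈Comb w _))

  indep-∷ : ∀ {ws : List Kⁿ} {x} → Indep {0ℓ} U ws → ¬ Comb {0ℓ} U ws x → Indep {0ℓ} U (x ∷ ws)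
  indep-∷ {ws} {x} ind x∉ = head ∷ ind
    where
    head : ∀ a y → a ∈ U → Comb U ws y → (∀ i → a * x i + y i ≈ 0#) → a ≈ 0#
    head a y _ y∈ eq with zero? a
    ... | yes a≈0 = a≈0
    ... | no a≉0 with invertible a a≉0
    ...   | r , ar≈1 = ⊥-elim (x∉ (comb-scale U-subring {a = - r} _ y∈ λ i → begin
      x i                               ≈⟨ *-identityˡ _ ⟨
      1# * x i                          ≈⟨ *-congʳ ar≈1 ⟨
      a * r * x i                       ≈⟨ solve 4 (λ a r x y → a :* r :* x := r :* (a :* x :+ y) :+ (:- r) :* y) refl a r (x i) (y i) ⟩
      r * (a * x i + y i) + - r * y i   ≈⟨ +-congʳ (trans (*-congˡ (eq i)) (zeroʳ r)) ⟩
      0# + - r * y i                    ≈⟨ +-identityˡ _ ⟩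
      - r * y i                         ∎))
      where open SetoidReasoning setoid

  module OfLattice {a b} {V : Pred Kⁿ a} {Λ : Pred Kⁿ b} (lat : IsLattice V Λ) where

    open IsLattice lat
    private module B = IsBasis isBasis

    basisₗ : List Kⁿ
    basisₗ = List.tabulate basis

    basis-indep : Indep {0ℓ} U basisₗ
    basis-indep = independent⇒indep _ basis K̂-indep

    basis∈ : All Λ basisₗ
    basis∈ = All.tabulate⁺ B.members

    lattice⊆comb : ∀ {x} → x ∈ Λ → Comb R̂ν basisₗ x
    lattice⊆comb x∈ with B.generates _ x∈
    ... | a , a∈ , x≈ = comb-resp (λ i → sym (x≈ i)) (linComb∈Comb basis a∈)

    comb⊆lattice : ∀ {x} → Comb R̂ν basisₗ x → x ∈ Λ
    comb⊆lattice = submodule-comb submodule basis∈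

    private
      rs : List Kⁿ
      rs = List.tabulate (proj₁ rank-dim)
      module R = IsBasis (proj₂ rank-dim)
      module D = IsBasis (proj₂ V-dim)

      rs⊑basis : All (Comb {0ℓ} U basisₗ) rs
      rs⊑basis = All.tabulate⁺ λ i → span-comb {Λ = Λ} (toU ∘ lattice⊆comb) (R.members i)

      rs-indep : Indep {0ℓ} U rs
      rs-indep = independent⇒indep _ _ R.independent

      V⊆dim : ∀ {x} → x ∈ V → Comb {0ℓ} U (List.tabulate (proj₁ V-dim)) x
      V⊆dim x∈ with D.generates _ x∈
      ... | a , a∈ , x≈ = comb-resp (λ i → sym (x≈ i)) (linComb∈Comb _ a∈)

      -- Equality of rank and dimension enters here: a vector of `V` outside the span of Λ would
      -- give `dim + 1` independent vectors in a space of dimension `dim`.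
      V⊆rs : ∀ {x} → x ∈ V → Comb {0ℓ} U rs x
      V⊆rs {x} x∈ with excludedMiddle pid (Comb {0ℓ} U rs x)
      ... | yes x∈rs = x∈rs
      ... | no x∉rs  = ⊥-elim (ℕ.<⇒≱ (ℕ.n<1+n dim) (≡.subst₂ ℕ._≤_
              (≡.cong suc (List.length-tabulate (proj₁ rank-dim))) (List.length-tabulate (proj₁ V-dim))
              (indep-length (indep-∷ rs-indep x∉rs)
                (V⊆dim x∈ ∷ All.map (V⊆dim ∘ submodule-comb V-subspace (All.map contained basis∈)) rs⊑basis))))

    spanned : ∀ {x} → x ∈ V → Comb {0ℓ} U basisₗ x
    spanned x∈ = comb-trans U-subring rs⊑basis (V⊆rs x∈)

    dim≡length : dim ≡ length basisₗ
    dim≡length = ≡.trans (≡.sym (List.length-tabulate (proj₁ rank-dim))) (ℕ.≤-antisym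
      (indep-length rs-indep rs⊑basis)
      (indep-length basis-indep (All.map (V⊆rs ∘ contained) basis∈)))

  lower-bound : ∀ {m} (f : Fin m → ℤ∞) → ∃ λ b → ∀ i → [ b ] ≤⁺ f i
  lower-bound {zero}  f = 0ℤ , λ ()
  lower-bound {suc m} f with lower-bound (f ∘ suc) | f zero in eq
  ... | b , b≤ | ⊤⁺    = b , λ { zero → ≤⁺-trans (_ ≤⊤⁺) (≤⁺-reflexive (≡.sym eq)) ; (suc i) → b≤ i }
  ... | b , b≤ | [ k ] = b ℤ.⊓ k , λ
    { zero    → ≤⁺-trans [ ℤ.i⊓j≤j b k ]≤ (≤⁺-reflexive (≡.sym eq))
    ; (suc i) → ≤⁺-trans [ ℤ.i⊓j≤i b k ]≤ (b≤ i) }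

  module _ {Δ : Pred Kⁿ ℓ} (latΔ : IsLattice U Δ) where

    private
      module Δ = IsLattice latΔ
      module B = OfLattice latΔ
      module Δ-sub = IsSubmodule Δ.submodule

    -- As `n` is positive, the vector of ones is nonzero. It lies in the span of the basis of Δ,
    -- which therefore is not empty.
    nonzero-vector : ∃ λ x → x ∈ Δ × ¬ (∀ i → x i ≈ 0#)
    nonzero-vector with B.basisₗ | B.basis-indep | B.basis∈ | B.spanned {λ _ → 1#} tt
    ... | []     | _     | _        | nil 1≈0 = ⊥-elim (nontrivial (1≈0 (Fin.fromℕ< (ℕ.>-nonZero⁻¹ n))))
    ... | x ∷ ws | h ∷ _ | x∈ ∷ _ | _       = x , x∈ , λ x≈0 → nontrivial
      (h 1# (λ _ → 0#) tt (comb-zero U-subring (λ _ → refl))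
        λ i → trans (+-identityʳ _) (trans (*-congˡ (x≈0 i)) (zeroʳ _)))

    -- If |δ| < 1 then the vectors δᴺ x, with x ∈ Δ nonzero, are nonzero elements
    -- of Δ that tend to 0, contradicting discreteness.
    1≤abs : ∀ {δ} → δ ∈ R̂ν → ¬ δ ≈ 0# → 1ℚ ℚ.≤ abs δ
    1≤abs {δ} δ∈ δ≉0 with val̂ δ in eq
    ... | ⊤⁺    = ⊥-elim (δ≉0 (V̂.val-zero⇒ eq))
    ... | [ m ] with m ℤ.≤? 0ℤ
    ...   | yes m≤0 = IntegerPowers.1≤^ᶻ qν {{qν-nonZero}} (ℤ.neg-mono-≤ m≤0)
    ...   | no m≰0  = ⊥-elim contradiction
      where
      1≤m : 1ℤ ℤ.≤ m
      1≤m = ℤ.i<j⇒suc[i]≤j (ℤ.≰⇒> m≰0)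
      x = proj₁ nonzero-vector
      b = proj₁ (lower-bound (val̂ ∘ x))
      small : ∀ N → ∃ λ y → y ∈ Δ × ¬ (∀ i → y i ≈ 0#) × ∀ i → [ + N ℤ.+ b ] ≤⁺ val̂ (y i)
      small zero = x , proj₁ (proj₂ nonzero-vector) , proj₂ (proj₂ nonzero-vector) , λ i →
        ≤⁺-trans (≤⁺-reflexive (≡.cong [_] (ℤ.+-identityˡ b))) (proj₂ (lower-bound (val̂ ∘ x)) i)
      small (suc N) with small N
      ... | y , y∈ , y≉0 , y≥ = (λ i → δ * y i) , Δ-sub.*ₗ∈ δ∈ y∈ ,
        (λ δy≈0 → y≉0 λ i → *-cancelˡ-0 δ≉0 (δy≈0 i)) , λ i →
        ≤⁺-trans (≤⁺-reflexive (≡.cong [_] (ℤ.+-assoc 1ℤ (+ N) b)))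
        (≤⁺-trans (+∞-mono (≤⁺-trans [ 1≤m ]≤ (≤⁺-reflexive (≡.sym eq))) (y≥ i))
                  (≤⁺-reflexive (≡.sym (val-* δ (y i)))))
      contradiction : ⊥
      contradiction with Δ.discrete (λ _ → 0#) Δ-sub.0ᴹ∈
      ... | k , isolated with small ℤ.∣ k ℤ.- b ∣
      ...   | y , y∈ , y≉0 , y≥ = y≉0 (isolated y y∈ λ i → ≤⁺-trans [ k≤ ]≤ (≤⁺-trans (y≥ i)
              (≤⁺-reflexive (val-cong (sym (trans (+-congˡ -0#≈0#) (+-identityʳ _)))))))
        where
        k≤ : k ℤ.≤ + ℤ.∣ k ℤ.- b ∣ ℤ.+ b
        k≤ = ℤ.≤-trans (ℤ.≤-reflexive (≡.sym (≡.trans (ℤ.+-assoc k (ℤ.- b) b)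
          (≡.trans (≡.cong (λ j → k ℤ.+ j) (ℤ.+-inverseˡ b)) (ℤ.+-identityʳ k))))) (ℤ.+-monoˡ-≤ b (i≤∣i∣ (k ℤ.- b)))
          where
          i≤∣i∣ : ∀ i → i ℤ.≤ + ℤ.∣ i ∣
          i≤∣i∣ (+ _)    = ℤ.≤-refl
          i≤∣i∣ -[1+ _ ] = ℤ.-≤+

    open InLattice B.basisₗ B.basis-indep B.lattice⊆comb B.comb⊆lattice

    rational⇒basis : ∀ {W} (ratW : Rational Δ W) → IsBasisOf W (OfLattice.basisₗ ratW)
    rational⇒basis ratW = record
      { indep     = W.basis-indep
      ; ws⊆W      = All.map proj₁ W.basis∈
      ; ws⊆Δ      = All.map proj₂ W.basis∈
      ; generates = λ x∈W x∈Δ → W.lattice⊆comb (x∈W , x∈Δ)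
      }
      where module W = OfLattice ratW

    basis⇒rational : ∀ {W} → IsSubspace W → ∀ {ws} → IsBasisOf W ws → (∀ {x} → x ∈ W → Comb {0ℓ} U ws x) → Rational Δ W
    basis⇒rational {W} subW {ws} basisW W⊆ws = record
      { V-subspace = subW
      ; submodule  = record
        { respects = λ { e (w , δ) → W.respects e w , Δ-sub.respects e δ }
        ; 0ᴹ∈      = W.0ᴹ∈ , Δ-sub.0ᴹ∈
        ; +ᴹ∈      = λ { (w , δ) (w′ , δ′) → W.+ᴹ∈ w w′ , Δ-sub.+ᴹ∈ δ δ′ }
        ; *ₗ∈      = λ { r (w , δ) → W.*ₗ∈ _ w , Δ-sub.*ₗ∈ r δ }
        }
      ; discrete   = λ { x (_ , x∈) → let k , isolated = Δ.discrete x x∈ in k , λ { y (_ , y∈) → isolated y y∈ } }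
      ; contained  = proj₁
      ; size       = length ws
      ; basis      = List.lookup ws
      ; isBasis    = record
        { members     = members
        ; generates   = λ { x (x∈W , x∈Δ) → comb⇒linComb (List.lookup ws) (≡.subst (λ us → Comb R̂ν us x) (≡.sym (List.tabulate-lookup ws)) (W′.generates x∈W x∈Δ)) }
        ; independent = λ a _ → independent a _
        }
      ; K̂-indep    = independent
      ; dim        = length ws
      ; rank-dim   = List.lookup ws , record
        { members     = λ i → 1 , (λ _ → 1#) , (λ _ → List.lookup ws i) , _ , (λ _ → members i) ,
                              λ j → sym (trans (+-identityʳ _) (*-identityˡ _))
        ; generates   = λ x x∈ → generatesU (span-comb {Λ = W ∩ Δ} (W⊆ws ∘ proj₁) x∈)
        ; independent = independent
        }
      ; V-dim      = List.lookup ws , record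
        { members     = proj₁ ∘ members
        ; generates   = λ x x∈ → generatesU (W⊆ws x∈)
        ; independent = independent
        }
      }
      where
      module W  = IsSubmodule subW
      module W′ = IsBasisOf basisW
      members : ∀ i → List.lookup ws i ∈ W ∩ Δ
      members i = All.lookup (All.zip (W′.ws⊆W , W′.ws⊆Δ)) (∈-lookup i)
      independent : Independent U (List.lookup ws)
      independent = indep⇒independent (List.lookup ws) (≡.subst (Indep U) (≡.sym (List.tabulate-lookup ws)) W′.indep)
      generatesU : ∀ {x} → Comb {0ℓ} U ws x → ∃ λ a → (∀ i → a i ∈ U) × x ≐ linComb a (List.lookup ws)
      generatesU {x} x∈ = comb⇒linComb (List.lookup ws) (≡.subst (λ us → Comb U us x) (≡.sym (List.tabulate-lookup ws)) x∈)

    module Pair {L M : Pred Kⁿ ℓ} (subL : IsSubspace L) (subM : IsSubspace M)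
                (ratL : Rational Δ L) (ratM : Rational Δ M) where

      private
        linL = submodule-linear subL
        linM = submodule-linear subM
        module L = OfLattice ratL
        module M = OfLattice ratM
        -- The basis `es` of the intersection stays open: rationality is shown with a constructed
        -- basis, the inequality for the basis carried by any given witness.
        module LM {es} = RationalPair linL linM (rational⇒basis ratL) (rational⇒basis ratM) L.spanned M.spanned {es}

      ∩-subspace : IsSubspace (L ∩ M)
      ∩-subspace = record
        { respects = λ { e (l , m) → L′.respects e l , M′.respects e m }
        ; 0ᴹ∈      = L′.0ᴹ∈ , M′.0ᴹ∈
        ; +ᴹ∈      = λ { (l , m) (l′ , m′) → L′.+ᴹ∈ l l′ , M′.+ᴹ∈ m m′ }
        ; *ₗ∈      = λ { _ (l , m) → L′.*ₗ∈ _ l , M′.*ₗ∈ _ m }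
        }
        where
        module L′ = IsSubmodule subL
        module M′ = IsSubmodule subM

      +-subspace : IsSubspace (L +ₛ M)
      +-subspace = record
        { respects = +-lin.resp
        ; 0ᴹ∈      = +-lin.0∈ (λ _ → refl)
        ; +ᴹ∈      = λ x∈ y∈ → +-lin.lin∈ 1# x∈ y∈ (λ i → +-congʳ (sym (*-identityˡ _)))
        ; *ₗ∈      = λ {a} _ x∈ → +-lin.lin∈ a x∈ (+-lin.0∈ (λ _ → refl)) (λ i → sym (+-identityʳ _))
        }
        where module +-lin = IsLinear (sum-linear linL linM)

      private
        basis∩ = basis-exists (∩-linear linL linM)
        basis+ = basis-exists (sum-linear linL linM)

      ∩-rational : Rational Δ (L ∩ M)
      ∩-rational = basis⇒rational ∩-subspace (proj₂ basis∩)
        (LM.∩-spanned (proj₂ basis∩))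

      +-rational : Rational Δ (L +ₛ M)
      +-rational = basis⇒rational +-subspace (proj₂ basis+)
        (LM.+-spanned (proj₂ basis∩) (proj₂ basis+))

      module _ (rat∩ : Rational Δ (L ∩ M)) (rat+ : Rational Δ (L +ₛ M)) where

        private
          module I = OfLattice rat∩
          module J = OfLattice rat+
          dim : ∀ {W : Pred Kⁿ ℓ} → Rational Δ W → ℕ
          dim = IsLattice.dim

        d-submodular : d Δ (L ∩ M) rat∩ ℚ.* d Δ (L +ₛ M) rat+ ℚ.≤ d Δ L ratL ℚ.* d Δ M ratM
        d-submodular = ≡.subst₂ ℚ._≤_
          (≡.sym (≡.cong₂ ℚ._*_ (norm-basis (IsLattice.basis rat∩)) (norm-basis (IsLattice.basis rat+))))
          (≡.sym (≡.cong₂ ℚ._*_ (norm-basis (IsLattice.basis ratL)) (norm-basis (IsLattice.basis ratM))))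
          (LM.⋀-submodular (rational⇒basis rat∩) (rational⇒basis rat+) 1≤abs)

        -- With this the powers of `q` on the two sides of the covolume inequality have the same
        -- total exponent, which turns it into the inequality for `d`.
        dim-modular : dim ratL ℕ.+ dim ratM ≡ dim rat∩ ℕ.+ dim rat+
        dim-modular = ≡.trans (≡.cong₂ ℕ._+_ L.dim≡length M.dim≡length) (≡.trans
          (LM.lengths (rational⇒basis rat∩) (rational⇒basis rat+))
          (≡.sym (≡.cong₂ ℕ._+_ I.dim≡length J.dim≡length)))

        covol-submodular : Covol (L ∩ M) ((L ∩ M) ∩ Δ) rat∩ ℚ.* Covol (L +ₛ M) ((L +ₛ M) ∩ Δ) rat+
                           ℚ.≤ Covol L (L ∩ Δ) ratL ℚ.* Covol M (M ∩ Δ) ratM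
        covol-submodular = begin
          (Q (dim rat∩) ℚ.* d∩) ℚ.* (Q (dim rat+) ℚ.* d+)     ≡⟨ interchange (Q (dim rat∩)) d∩ (Q (dim rat+)) d+ ⟩
          (Q (dim rat∩) ℚ.* Q (dim rat+)) ℚ.* (d∩ ℚ.* d+)     ≡⟨ ≡.cong (ℚ._* (d∩ ℚ.* d+)) (Q-+ (dim rat∩) (dim rat+)) ⟩
          Q (dim rat∩ ℕ.+ dim rat+) ℚ.* (d∩ ℚ.* d+)           ≤⟨ ℚ.*-monoˡ-≤-nonNeg (Q (dim rat∩ ℕ.+ dim rat+))
                                                                   {{ℚ.nonNegative (^ᶻ-nonNeg (genus ℤ.* + (dim rat∩ ℕ.+ dim rat+)))}} d-submodular ⟩
          Q (dim rat∩ ℕ.+ dim rat+) ℚ.* (dL ℚ.* dM)           ≡⟨ ≡.cong (λ k → Q k ℚ.* (dL ℚ.* dM)) dim-modular ⟨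
          Q (dim ratL ℕ.+ dim ratM) ℚ.* (dL ℚ.* dM)           ≡⟨ ≡.cong (ℚ._* (dL ℚ.* dM)) (Q-+ (dim ratL) (dim ratM)) ⟨
          (Q (dim ratL) ℚ.* Q (dim ratM)) ℚ.* (dL ℚ.* dM)     ≡⟨ interchange (Q (dim ratL)) (Q (dim ratM)) dL dM ⟩
          (Q (dim ratL) ℚ.* dL) ℚ.* (Q (dim ratM) ℚ.* dM)     ∎
          where
          open ℚ.≤-Reasoning
          open ℚ-Lemmas
          open IntegerPowers q {{q-nonZero}}
          genus = + g ℤ.- 1ℤ
          d∩ = d Δ (L ∩ M) rat∩
          d+ = d Δ (L +ₛ M) rat+
          dL = d Δ L ratL
          dM = d Δ M ratM
          Q : ℕ → ℚ
          Q k = _^ᶻ_ q {{q-nonZero}} (genus ℤ.* + k)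
          Q-+ : ∀ k l → Q k ℚ.* Q l ≡ Q (k ℕ.+ l)
          Q-+ k l = ≡.sym (≡.trans (≡.cong (λ i → _^ᶻ_ q {{q-nonZero}} i) (ℤ.*-distribˡ-+ genus (+ k) (+ l)))
            (^ᶻ-+ (genus ℤ.* + k) (genus ℤ.* + l)))

open import Data.Rational.Base using (_*_; _≥_)

theorem1p4 : ∀ {ℓ} (S : Setting ℓ) → Setting.RνIsPID S →
    (n : ℕ) .{{_ : NonZero n}} (let open Setting.Lattices S n) →
    (Δ : Pred Kⁿ ℓ) → IsLattice U Δ →
    (L M : Pred Kⁿ ℓ) → IsSubspace L → IsSubspace M →
    (ratL : Rational Δ L) (ratM : Rational Δ M) →
    Rational Δ (L ∩ M) × Rational Δ (L +ₛ M) ×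
    ((rat∩ : Rational Δ (L ∩ M)) (rat+ : Rational Δ (L +ₛ M)) →
    (d Δ L ratL * d Δ M ratM ≥ d Δ (L ∩ M) rat∩ * d Δ (L +ₛ M) rat+) ×
    (Covol L (L ∩ Δ) ratL * Covol M (M ∩ Δ) ratM
    ≥ Covol (L ∩ M) ((L ∩ M) ∩ Δ) rat∩ * Covol (L +ₛ M) ((L +ₛ M) ∩ Δ) rat+))
theorem1p4 S pid n Δ latΔ L M subL subM ratL ratM =
  ∩-rational , +-rational , λ rat∩ rat+ → d-submodular rat∩ rat+ , covol-submodular rat∩ rat+
  where open LatticeProperties.Pair S pid n latΔ subL subM ratL ratM
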